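{- Let $\varphi:\mathfrak{h}\to V^*$ be a real factorization structure and $\varphi^{\mathbb{C}}:\mathfrak{h}\otimes\mathbb{C}\to V^*\otimes\mathbb{C}$ its complexification (a complex factorization structure). For each $j$, the factorization curve $\psi_j$ of $\varphi$ is decomposable if and only if the $j$-th factorization curve $\psi_j^{\mathbb{C}}$ of $\varphi^{\mathbb{C}}$ is decomposable. Moreover, a real decomposable curve $\psi_j$ admits the real analogue of the characterisation of decomposable curves: there exist $S\subset\{1,\ldots,m\}$ with $|S|=\deg\psi_j$, a real 1-dimensional subspace $\Gamma_j\subset\bigotimes_{r\notin S}V_r^*$ and real invertible projective transformations $g_r:\mathbb{P}(V_j^*)\to\mathbb{P}(V_r^*)$, $r\in S$, such that for all $\ell\in\mathbb{P}(V_j)$ the line $\varphi(\psi_j(\ell))$ is spanned by the tensor with $g_r\ell^0$ in slot $r$ for $r\in S$ and $\Gamma_j$ in the other slots.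
   Context: $V_1,\ldots,V_m$ are 2-dimensional real vector spaces, $V^*=V_1^*\otimes\cdots\otimes V_m^*$; for a complex version all spaces are tensored with $\mathbb{C}$ and $V^*\otimes\mathbb{C}=\bigotimes_j(V_j^*\otimes\mathbb{C})$. $\ell^0$ denotes the annihilator of a line $\ell$. "Generic" means on a nonempty Zariski-open subset of a projective space. $\Sigma^0_{j,\ell}=V_1^*\otimes\cdots\otimes\ell^0\otimes\cdots\otimes V_m^*$. A (real or complex) factorization structure of dimension $m$ is an injective linear map $\varphi:\mathfrak{h}\to V^*$, $\dim\mathfrak{h}=m+1$, with $\dim(\varphi(\mathfrak{h})\cap\Sigma^0_{j,\ell})=1$ for all $j$ and generic $\ell\in\mathbb{P}(V_j)$. The $j$-th factorization curve $\psi_j:\mathbb{P}(V_j)\to\mathbb{P}(\mathfrak{h})$ is the unique regular extension of the generically defined regular map $\ell\mapsto\varphi^{ -1}(\varphi(\mathfrak{h})\cap\Sigma^0_{j,\ell})$; $\deg\psi_j$ is the integer $e$ with $\psi_j^*\mathcal{O}_{\mathfrak{h}}(1)\cong\mathcal{O}_{V_j}(e)$. Curves with the same image are equivalent; $\psi_j$ is decomposable if its equivalence class in $\{\psi_1,\ldots,\psi_m\}$ has exactly $\deg\psi_j$ elements. -}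

module Defs where

open import Algebra.Bundles using (CommutativeMonoid; CommutativeRing; Semiring)
open import Algebra.Module.Bundles using (LeftModule)
import Algebra.Module.Construct.TensorUnit as TensorUnit
open import Algebra.Module.Morphism.Structures
  using (IsLeftModuleHomomorphism; IsLeftModuleIsomorphism)
import Algebra.Definitions.RawMonoid as RawMonoidDefs
import Algebra.Definitions.RawSemiring as RawSemiringDefs
import Algebra.Properties.AbelianGroup as AbelianGroupProperties
import Algebra.Properties.CommutativeSemigroup as CommutativeSemigroupProperties
import Algebra.Properties.Ring as RingProperties
open import Data.Fin.Base using (Fin)
open import Data.Fin.Subset using (Subset; _∈_; _∉_; ∣_∣)
open import Data.Fin.Subset.Properties using (_∈?_)
open import Data.Nat.Base using (ℕ; suc)
import Data.Nat.Base as ℕ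
open import Data.Product.Base using (Σ; ∃; ∃-syntax; _×_; _,_; proj₁; proj₂)
open import Data.Unit.Base using (⊤)
open import Function.Base using (_∘_)
open import Function.Bundles using (_⇔_)
open import Function.Definitions using (Injective)
open import Level using (0ℓ)
open import Relation.Binary.Core using (Rel)
open import Relation.Binary.Structures using (IsEquivalence; IsTotalOrder)
open import Relation.Binary.PropositionalEquality.Core using (_≡_; _≢_)
import Relation.Binary.Reasoning.Setoid as SetoidReasoning
open import Relation.Nullary.Decidable.Core using (yes; no)
open import Relation.Nullary.Negation.Core using (¬_)

-- The real numbers, axiomatically: classically, a Dedekind-complete ordered
-- field exists and is unique up to isomorphism.

record Reals : Set₁ where
  field
    commutativeRing : CommutativeRing 0ℓ 0ℓ

  open CommutativeRing commutativeRing

  infix 4 _≤_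

  field
    0≉1          : ¬ (0# ≈ 1#)
    inverse      : ∀ x → ¬ (x ≈ 0#) → ∃[ y ] x * y ≈ 1#
    _≤_          : Rel Carrier 0ℓ
    isTotalOrder : IsTotalOrder _≈_ _≤_
    +-monoˡ-≤    : ∀ z {x y} → x ≤ y → x + z ≤ y + z
    *-nonNeg     : ∀ {x y} → 0# ≤ x → 0# ≤ y → 0# ≤ x * y

  UpperBound : (Carrier → Set) → Carrier → Set
  UpperBound P b = ∀ x → P x → x ≤ b

  field
    supremum : (P : Carrier → Set) → ∃ P → ∃ (UpperBound P) →
               ∃[ s ] UpperBound P s × (∀ b → UpperBound P b → s ≤ b)

-- Only used for K = ℝ and K = ℂ, where a module is a vector space.
VectorSpace : CommutativeRing 0ℓ 0ℓ → Set₁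
VectorSpace K = LeftModule (CommutativeRing.ring K) 0ℓ 0ℓ

module LinearAlgebra (K : CommutativeRing 0ℓ 0ℓ) where

  open CommutativeRing K
  open RawSemiringDefs (Semiring.rawSemiring semiring) using (_^_)
  open RawMonoidDefs +-rawMonoid using (sum)

  ∥_∥ : VectorSpace K → Set
  ∥ V ∥ = LeftModule.Carrierᴹ V

  -- A vector space whose negation is multiplication by -1.
  mkVectorSpace :
    {A : Set} (_≈′_ : Rel A 0ℓ) (_+′_ : A → A → A) (0′ : A)
    (_*′_ : Carrier → A → A) →
    IsEquivalence _≈′_ →
    (∀ {x y u v} → x ≈′ y → u ≈′ v → (x +′ u) ≈′ (y +′ v)) →
    (∀ x y z → ((x +′ y) +′ z) ≈′ (x +′ (y +′ z))) →
    (∀ x y → (x +′ y) ≈′ (y +′ x)) →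
    (∀ x → (0′ +′ x) ≈′ x) →
    (∀ {a b x y} → a ≈ b → x ≈′ y → (a *′ x) ≈′ (b *′ y)) →
    (∀ a b x → ((a * b) *′ x) ≈′ (a *′ (b *′ x))) →
    (∀ x → (1# *′ x) ≈′ x) →
    (∀ x → (0# *′ x) ≈′ 0′) →
    (∀ x a b → ((a + b) *′ x) ≈′ ((a *′ x) +′ (b *′ x))) →
    (∀ a x y → (a *′ (x +′ y)) ≈′ ((a *′ x) +′ (a *′ y))) →
    VectorSpace K
  mkVectorSpace {A} _≈′_ _+′_ 0′ _*′_ isEq +c +a +m +i *c *a *i *z *dʳ *dˡ =
    record
    { Carrierᴹ = A
    ; _≈ᴹ_ = _≈′_
    ; _+ᴹ_ = _+′_
    ; _*ₗ_ = _*′_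
    ; 0ᴹ = 0′
    ; -ᴹ_ = neg
    ; isLeftModule = record
      { isLeftSemimodule = record
        { +ᴹ-isCommutativeMonoid = record
          { isMonoid = record
            { isSemigroup = record
              { isMagma = record { isEquivalence = isEq ; ∙-cong = +c }
              ; assoc = +a
              }
            ; identity = +i , λ x → tr (+m x 0′) (+i x)
            }
          ; comm = +m
          }
        ; isPreleftSemimodule = record
          { *ₗ-cong = *c
          ; *ₗ-zeroˡ = *z
          ; *ₗ-distribʳ = *dʳ
          ; *ₗ-identityˡ = *i
          ; *ₗ-assoc = *a
          ; *ₗ-zeroʳ = λ a →
              tr (*c refl (sy (*z 0′)))
                 (tr (sy (*a a 0# 0′)) (tr (*c (zeroʳ a) re) (*z 0′)))
          ; *ₗ-distribˡ = *dˡ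
          }
        }
      ; -ᴹ‿cong = *c refl
      ; -ᴹ‿inverse = invˡ , λ x → tr (+m x (neg x)) (invˡ x)
      }
    }
    where
    open IsEquivalence isEq renaming (refl to re; sym to sy; trans to tr)
    neg : A → A
    neg x = (- 1#) *′ x
    invˡ : ∀ x → (neg x +′ x) ≈′ 0′
    invˡ x = tr (+c re (sy (*i x)))
                (tr (sy (*dʳ x (- 1#) 1#)) (tr (*c (-‿inverseˡ 1#) re) (*z x)))

  record LinearMap (V W : VectorSpace K) : Set where
    field
      ⟦_⟧            : ∥ V ∥ → ∥ W ∥
      isHomomorphism : IsLeftModuleHomomorphism
                         (LeftModule.rawLeftModule V)
                         (LeftModule.rawLeftModule W) ⟦_⟧

    open IsLeftModuleHomomorphism isHomomorphism public

  open LinearMap using (⟦_⟧)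

  module _ {V W : VectorSpace K} where
    private
      module V = LeftModule V
      module W = LeftModule W

    mkLinearMap : (f : ∥ V ∥ → ∥ W ∥) →
      (∀ {x y} → x V.≈ᴹ y → f x W.≈ᴹ f y) →
      (∀ x y → f (x V.+ᴹ y) W.≈ᴹ f x W.+ᴹ f y) →
      (∀ c x → f (c V.*ₗ x) W.≈ᴹ c W.*ₗ f x) →
      LinearMap V W
    mkLinearMap f f-cong f-+ f-* = record
      { ⟦_⟧ = f
      ; isHomomorphism = record
        { +ᴹ-isGroupHomomorphism = record
          { isMonoidHomomorphism = record
            { isMagmaHomomorphism = record
              { isRelHomomorphism = record { cong = f-cong }
              ; homo = f-+
              }
            ; ε-homo = f-0
            }
          ; ⁻¹-homo = λ x → AbelianGroupProperties.inverseˡ-unique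
              W.+ᴹ-abelianGroup (f (V.-ᴹ x)) (f x)
              (W.≈ᴹ-trans (W.≈ᴹ-sym (f-+ (V.-ᴹ x) x))
                (W.≈ᴹ-trans (f-cong (V.-ᴹ‿inverseˡ x)) f-0))
          }
        ; *ₗ-homo = f-*
        }
      }
      where
      f-0 : f V.0ᴹ W.≈ᴹ W.0ᴹ
      f-0 = W.≈ᴹ-trans (f-cong (V.≈ᴹ-sym (V.*ₗ-zeroˡ V.0ᴹ)))
              (W.≈ᴹ-trans (f-* 0# V.0ᴹ) (W.*ₗ-zeroˡ (f V.0ᴹ)))

    IsInjective IsIsomorphism : LinearMap V W → Set
    IsInjective f   = Injective V._≈ᴹ_ W._≈ᴹ_ ⟦ f ⟧
    IsIsomorphism f = IsLeftModuleIsomorphism V.rawLeftModule W.rawLeftModule ⟦ f ⟧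

  ⟨K⟩ : VectorSpace K
  ⟨K⟩ = TensorUnit.leftModule

  Covector : VectorSpace K → Set
  Covector V = LinearMap V ⟨K⟩

  Dual : VectorSpace K → VectorSpace K
  Dual V = mkVectorSpace {A = Covector V}
    (λ α β → ∀ v → ⟦ α ⟧ v ≈ ⟦ β ⟧ v)
    (λ α β → mkLinearMap (λ v → ⟦ α ⟧ v + ⟦ β ⟧ v)
      (λ e → +-cong (LinearMap.⟦⟧-cong α e) (LinearMap.⟦⟧-cong β e))
      (λ x y → trans (+-cong (LinearMap.+ᴹ-homo α x y) (LinearMap.+ᴹ-homo β x y))
                     (interchange _ _ _ _))
      (λ c x → trans (+-cong (LinearMap.*ₗ-homo α c x) (LinearMap.*ₗ-homo β c x))
                     (sym (distribˡ c _ _))))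
    (mkLinearMap (λ _ → 0#)
      (λ _ → refl)
      (λ _ _ → sym (+-identityˡ 0#))
      (λ c _ → sym (zeroʳ c)))
    (λ a α → mkLinearMap (λ v → a * ⟦ α ⟧ v)
      (λ e → *-congˡ (LinearMap.⟦⟧-cong α e))
      (λ x y → trans (*-congˡ (LinearMap.+ᴹ-homo α x y)) (distribˡ a _ _))
      (λ c x → trans (*-congˡ (LinearMap.*ₗ-homo α c x)) (x∙yz≈y∙xz a c _)))
    (record { refl = λ _ → refl ; sym = λ e v → sym (e v)
            ; trans = λ e f v → trans (e v) (f v) })
    (λ e f v → +-cong (e v) (f v))
    (λ _ _ _ v → +-assoc _ _ _)
    (λ _ _ v → +-comm _ _)
    (λ _ v → +-identityˡ _)
    (λ e f v → *-cong e (f v))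
    (λ a b _ v → *-assoc a b _)
    (λ _ v → *-identityˡ _)
    (λ _ v → zeroˡ _)
    (λ _ a b v → distribʳ _ a b)
    (λ a _ _ v → distribˡ a _ _)
    where
    open CommutativeSemigroupProperties +-commutativeSemigroup using (interchange)
    open CommutativeSemigroupProperties *-commutativeSemigroup using (x∙yz≈y∙xz)

  module _ (V : VectorSpace K) where
    open LeftModule V

    NonZero : ∥ V ∥ → Set
    NonZero v = ¬ (v ≈ᴹ 0ᴹ)

    -- Points of ℙ(V) are represented by nonzero vectors; for nonzero
    -- vectors SameLine is equality of the points they represent.
    SameLine : ∥ V ∥ → ∥ V ∥ → Set
    SameLine x y = ∃[ c ] ¬ (c ≈ 0#) × x ≈ᴹ c *ₗ y

    linearCombination : ∀ {n} → (Fin n → Carrier) → (Fin n → ∥ V ∥) → ∥ V ∥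
    linearCombination c b = RawMonoidDefs.sum +ᴹ-rawMonoid (λ i → c i *ₗ b i)

    SubspaceDimension : (∥ V ∥ → Set) → ℕ → Set
    SubspaceDimension P n = Σ (Fin n → ∥ V ∥) λ b →
      (∀ i → P (b i)) ×
      (∀ c → linearCombination c b ≈ᴹ 0ᴹ → ∀ i → c i ≈ 0#) ×
      (∀ x → P x → ∃[ c ] x ≈ᴹ linearCombination c b)

    Dimension : ℕ → Set
    Dimension = SubspaceDimension (λ _ → ⊤)

  -- The tensor product: formal combinations of pure tensors, modulo the
  -- congruence generated by the vector space axioms and multilinearity.

  module _ {I : Set} (W : I → VectorSpace K) where
    private module W i = LeftModule (W i)

    infixl 6 _⊕_
    infixr 7 _⊙_
    infix 4 _≋_

    data Tensor : Set where
      pure : (∀ i → ∥ W i ∥) → Tensor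
      𝟘    : Tensor
      _⊕_  : Tensor → Tensor → Tensor
      _⊙_  : Carrier → Tensor → Tensor

    data _≋_ : Tensor → Tensor → Set where
      ≋-refl  : ∀ {s} → s ≋ s
      ≋-sym   : ∀ {s t} → s ≋ t → t ≋ s
      ≋-trans : ∀ {s t u} → s ≋ t → t ≋ u → s ≋ u
      ⊕-cong  : ∀ {s t u v} → s ≋ t → u ≋ v → s ⊕ u ≋ t ⊕ v
      ⊕-assoc : ∀ s t u → (s ⊕ t) ⊕ u ≋ s ⊕ (t ⊕ u)
      ⊕-comm  : ∀ s t → s ⊕ t ≋ t ⊕ s
      ⊕-identityˡ : ∀ s → 𝟘 ⊕ s ≋ s
      ⊙-cong  : ∀ {a b s t} → a ≈ b → s ≋ t → a ⊙ s ≋ b ⊙ t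
      ⊙-assoc : ∀ a b s → (a * b) ⊙ s ≋ a ⊙ (b ⊙ s)
      ⊙-identityˡ : ∀ s → 1# ⊙ s ≋ s
      ⊙-zeroˡ : ∀ s → 0# ⊙ s ≋ 𝟘
      ⊙-distribʳ : ∀ s a b → (a + b) ⊙ s ≋ a ⊙ s ⊕ b ⊙ s
      ⊙-distribˡ : ∀ a s t → a ⊙ (s ⊕ t) ≋ a ⊙ s ⊕ a ⊙ t
      pure-cong : ∀ {w w′} → (∀ i → W._≈ᴹ_ i (w i) (w′ i)) → pure w ≋ pure w′
      pure-+ : ∀ i {w u v} → W._≈ᴹ_ i (w i) (W._+ᴹ_ i (u i) (v i)) →
               (∀ k → k ≢ i → W._≈ᴹ_ k (w k) (u k) × W._≈ᴹ_ k (w k) (v k)) →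
               pure w ≋ pure u ⊕ pure v
      pure-* : ∀ i a {w u} → W._≈ᴹ_ i (w i) (W._*ₗ_ i a (u i)) →
               (∀ k → k ≢ i → W._≈ᴹ_ k (w k) (u k)) →
               pure w ≋ a ⊙ pure u

    ⨂ : VectorSpace K
    ⨂ = mkVectorSpace _≋_ _⊕_ 𝟘 _⊙_
      (record { refl = ≋-refl ; sym = ≋-sym ; trans = ≋-trans })
      ⊕-cong ⊕-assoc ⊕-comm ⊕-identityˡ
      ⊙-cong ⊙-assoc ⊙-identityˡ ⊙-zeroˡ ⊙-distribʳ ⊙-distribˡ

  -- Inserts the vectors w r in the slots r ∈ S and the tensor t in the
  -- remaining slots.
  fill : ∀ {m} {W : Fin m → VectorSpace K} (S : Subset m) →
         (∀ r → r ∈ S → ∥ W r ∥) →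
         Tensor {I = ∃[ r ] r ∉ S} (W ∘ proj₁) →
         Tensor W
  fill {W = W} S w (pure u) = pure slot
    where
    slot : ∀ r → ∥ W r ∥
    slot r with r ∈? S
    ... | yes r∈S = w r r∈S
    ... | no  r∉S = u (r , r∉S)
  fill S w 𝟘       = 𝟘
  fill S w (s ⊕ t) = fill S w s ⊕ fill S w t
  fill S w (a ⊙ t) = a ⊙ fill S w t

  -- M-valued homogeneous polynomials of degree e on V, as functions.  The
  -- fields of interest are infinite, so a polynomial is determined by its
  -- values.
  data IsForm (V M : VectorSpace K) : ℕ → (∥ V ∥ → ∥ M ∥) → Set where
    const  : ∀ a → IsForm V M 0 (λ _ → a)
    times  : ∀ {e f} (ξ : Covector V) → IsForm V M e f →
             IsForm V M (suc e) (λ v → LeftModule._*ₗ_ M (⟦ ξ ⟧ v) (f v))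
    plus   : ∀ {e f g} → IsForm V M e f → IsForm V M e g →
             IsForm V M e (λ v → LeftModule._+ᴹ_ M (f v) (g v))
    equal  : ∀ {e f g} → (∀ v → LeftModule._≈ᴹ_ M (f v) (g v)) →
             IsForm V M e f → IsForm V M e g

  -- A Zariski-open subset of ℙ(V): the complement of the common zero set
  -- of scalar forms; finitely many suffice, by the Hilbert basis theorem.
  record ZariskiOpen (V : VectorSpace K) : Set where
    field
      {size} : ℕ
      degree : Fin size → ℕ
      form   : Fin size → ∥ V ∥ → Carrier
      isForm : ∀ i → IsForm V ⟨K⟩ (degree i) (form i)

    Contains : ∥ V ∥ → Set
    Contains v = ∃[ i ] ¬ (form i v ≈ 0#)

  Generic : (V : VectorSpace K) → (∥ V ∥ → Set) → Set
  Generic V P = Σ (ZariskiOpen V) λ U → let open ZariskiOpen U in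
    (∃[ v ] NonZero V v × Contains v) ×
    (∀ v → NonZero V v → Contains v → P v)

  -- A morphism ℙ(V) → ℙ(H) is an H-valued form whose components, as
  -- sections of 𝒪(deg), generate 𝒪(deg); deg is then the degree of the
  -- pullback of 𝒪(1).  Generation means that the ideal of the components
  -- contains a power of every linear form, i.e. that the components have
  -- no common zero on the scheme ℙ(V).  Having no common zero among
  -- K-rational points would be too weak over ℝ.
  record RegularMap (V H : VectorSpace K) : Set where
    field
      deg       : ℕ
      form      : ∥ V ∥ → ∥ H ∥
      isForm    : IsForm V H deg form
      generates : ∀ (ξ : Covector V) →
        Σ ℕ λ d → Σ ℕ λ n →
        Σ (Fin n → ∥ V ∥ → Carrier) λ p → Σ (Fin n → Covector H) λ η →
          (∀ i → IsForm V ⟨K⟩ d (p i)) ×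
          (∀ v → ⟦ ξ ⟧ v ^ (d ℕ.+ deg) ≈ sum (λ i → p i v * ⟦ η i ⟧ (form v)))

  open RegularMap using (deg; form)

  SameImage : {V V′ H : VectorSpace K} → RegularMap V H → RegularMap V′ H → Set
  SameImage {V} {V′} {H} ψ χ =
    (∀ v → NonZero V v → ∃[ w ] NonZero V′ w × SameLine H (form ψ v) (form χ w)) ×
    (∀ w → NonZero V′ w → ∃[ v ] NonZero V v × SameLine H (form ψ v) (form χ w))

  module _ {m : ℕ} (V : Fin m → VectorSpace K) where

    V* : VectorSpace K
    V* = ⨂ (λ r → Dual (V r))

    -- The subspace V₁* ⊗ ⋯ ⊗ ℓ⁰ ⊗ ⋯ ⊗ Vₘ*, for ℓ spanned by v and ℓ⁰ in
    -- slot j: all sums of pure tensors whose j-th factor annihilates v.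
    Σ⁰ : (j : Fin m) → ∥ V j ∥ → ∥ V* ∥ → Set
    Σ⁰ j v T = Σ ℕ λ n → Σ (Fin n → ∀ r → Covector (V r)) λ α →
      (∀ k → ⟦ α k j ⟧ v ≈ 0#) ×
      LeftModule._≈ᴹ_ V* T
        (RawMonoidDefs.sum (LeftModule.+ᴹ-rawMonoid V*) (λ k → pure (α k)))

  module _ {m : ℕ} {V : Fin m → VectorSpace K} {H : VectorSpace K}
           (φ : LinearMap H (V* V)) where

    private
      module H = LeftModule H
      module V* = LeftModule (V* V)

    record IsFactorizationStructure : Set where
      field
        dimension-V  : ∀ j → Dimension (V j) 2
        dimension-H  : Dimension H (suc m)
        injective    : IsInjective φ
        intersection : ∀ j → Generic (V j) λ v →
          SubspaceDimension (V* V)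
            (λ T → (∃[ x ] ⟦ φ ⟧ x V*.≈ᴹ T) × Σ⁰ V j v T) 1

    -- A regular map is determined by its restriction to a nonempty open set,
    -- so this is ψⱼ: it agrees generically with ℓ ↦ φ⁻¹(φ(𝔥) ∩ Σ⁰).
    record FactorizationCurve (j : Fin m) : Set where
      field
        curve   : RegularMap (V j) H
        extends : Generic (V j) λ v → ∀ x →
          (∃[ c ] x H.≈ᴹ c H.*ₗ form curve v) ⇔ Σ⁰ V j v (⟦ φ ⟧ x)

    open FactorizationCurve

    -- S is the equivalence class of ψⱼ; curves are counted by their index.
    Decomposable : (∀ j → FactorizationCurve j) → Fin m → Set
    Decomposable ψ j = Σ (Subset m) λ S →
      (∀ i → i ∈ S ⇔ SameImage (curve (ψ i)) (curve (ψ j))) ×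
      ∣ S ∣ ≡ deg (curve (ψ j))

    -- The 1-dimensional subspace Γⱼ is spanned by the nonzero tensor γ, and
    -- the projective transformation g r is induced by a linear isomorphism.
    HasDecomposition : ∀ {j} → FactorizationCurve j → Set
    HasDecomposition {j} ψ =
      Σ (Subset m) λ S →
      Σ (Tensor {I = ∃[ r ] r ∉ S} (λ r → Dual (V (proj₁ r)))) λ γ →
      Σ (∀ r → r ∈ S → LinearMap (Dual (V j)) (Dual (V r))) λ g →
        ∣ S ∣ ≡ deg (curve ψ) ×
        NonZero (⨂ _) γ ×
        (∀ r r∈S → IsIsomorphism (g r r∈S)) ×
        (∀ v → NonZero (V j) v →
         ∀ α → NonZero (Dual (V j)) α → ⟦ α ⟧ v ≈ 0# →
         SameLine (V* V) (⟦ φ ⟧ (form (curve ψ) v))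
                         (fill S (λ r r∈S → ⟦ g r r∈S ⟧ α) γ))

-- The operations making V ⊕ iV a module over R[i].  Taking V = R gives the
-- multiplication of R[i] itself, so the laws are proved once, before R[i]
-- is available as a ring.
module PairLaws (R : CommutativeRing 0ℓ 0ℓ) (V : VectorSpace R) where

  open CommutativeRing R
  open RingProperties ring using (-0#≈0#; -‿+-comm; -‿distribˡ-*; -‿distribʳ-*)
  open LeftModule V
  open CommutativeSemigroupProperties
    (CommutativeMonoid.commutativeSemigroup +ᴹ-commutativeMonoid)
    using (interchange)
  open SetoidReasoning ≈ᴹ-setoid

  infix  4 _≈²_
  infixl 6 _+²_
  infixr 7 _*²_

  Pair : Set
  Pair = Carrierᴹ × Carrierᴹ

  _≈²_ : Pair → Pair → Set
  (x , y) ≈² (x′ , y′) = x ≈ᴹ x′ × y ≈ᴹ y′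

  _+²_ : Pair → Pair → Pair
  (x , y) +² (x′ , y′) = x +ᴹ x′ , y +ᴹ y′

  0² : Pair
  0² = 0ᴹ , 0ᴹ

  -- (a + bi)(x + iy) = (ax − by) + i(ay + bx)
  _*²_ : Carrier × Carrier → Pair → Pair
  (a , b) *² (x , y) = a *ₗ x +ᴹ (- b) *ₗ y , a *ₗ y +ᴹ b *ₗ x

  isEquivalence² : IsEquivalence _≈²_
  isEquivalence² = record
    { refl  = ≈ᴹ-refl , ≈ᴹ-refl
    ; sym   = λ (p , q) → ≈ᴹ-sym p , ≈ᴹ-sym q
    ; trans = λ (p , q) (p′ , q′) → ≈ᴹ-trans p p′ , ≈ᴹ-trans q q′
    }

  +²-cong : ∀ {x y u v} → x ≈² y → u ≈² v → x +² u ≈² y +² v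
  +²-cong (p , q) (p′ , q′) = +ᴹ-cong p p′ , +ᴹ-cong q q′

  +²-assoc : ∀ x y z → (x +² y) +² z ≈² x +² (y +² z)
  +²-assoc _ _ _ = +ᴹ-assoc _ _ _ , +ᴹ-assoc _ _ _

  +²-comm : ∀ x y → x +² y ≈² y +² x
  +²-comm _ _ = +ᴹ-comm _ _ , +ᴹ-comm _ _

  +²-identityˡ : ∀ x → 0² +² x ≈² x
  +²-identityˡ _ = +ᴹ-identityˡ _ , +ᴹ-identityˡ _

  *²-cong : ∀ {a b a′ b′ x y} → a ≈ a′ → b ≈ b′ → x ≈² y → (a , b) *² x ≈² (a′ , b′) *² y
  *²-cong p q (r , s) =
    +ᴹ-cong (*ₗ-cong p r) (*ₗ-cong (-‿cong q) s) , +ᴹ-cong (*ₗ-cong p s) (*ₗ-cong q r)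

  private
    shuffle : ∀ p q r s → (p +ᴹ q) +ᴹ (r +ᴹ s) ≈ᴹ (p +ᴹ r) +ᴹ (s +ᴹ q)
    shuffle p q r s =
      ≈ᴹ-trans (interchange p q r s) (+ᴹ-congˡ (+ᴹ-comm q s))

    assoc-component : ∀ a b c d e f x y →
      (a * c + b * d) *ₗ x +ᴹ (a * e + b * f) *ₗ y ≈ᴹ
      a *ₗ (c *ₗ x +ᴹ e *ₗ y) +ᴹ b *ₗ (f *ₗ y +ᴹ d *ₗ x)
    assoc-component a b c d e f x y = begin
      (a * c + b * d) *ₗ x +ᴹ (a * e + b * f) *ₗ y
        ≈⟨ +ᴹ-cong (*ₗ-distribʳ x _ _) (*ₗ-distribʳ y _ _) ⟩
      ((a * c) *ₗ x +ᴹ (b * d) *ₗ x) +ᴹ ((a * e) *ₗ y +ᴹ (b * f) *ₗ y)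
        ≈⟨ shuffle _ _ _ _ ⟩
      ((a * c) *ₗ x +ᴹ (a * e) *ₗ y) +ᴹ ((b * f) *ₗ y +ᴹ (b * d) *ₗ x)
        ≈⟨ +ᴹ-cong (+ᴹ-cong (*ₗ-assoc a c x) (*ₗ-assoc a e y))
                   (+ᴹ-cong (*ₗ-assoc b f y) (*ₗ-assoc b d x)) ⟩
      (a *ₗ c *ₗ x +ᴹ a *ₗ e *ₗ y) +ᴹ (b *ₗ f *ₗ y +ᴹ b *ₗ d *ₗ x)
        ≈⟨ +ᴹ-cong (*ₗ-distribˡ a _ _) (*ₗ-distribˡ b _ _) ⟨
      a *ₗ (c *ₗ x +ᴹ e *ₗ y) +ᴹ b *ₗ (f *ₗ y +ᴹ d *ₗ x) ∎

  *²-assoc : ∀ a b c d v →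
    (a * c + (- b) * d , a * d + b * c) *² v ≈² (a , b) *² ((c , d) *² v)
  *²-assoc a b c d (x , y) =
    ≈ᴹ-trans
      (+ᴹ-congˡ (*ₗ-congʳ (trans (sym (-‿+-comm _ _))
                                 (+-cong (-‿distribʳ-* a d) (-‿distribˡ-* b c)))))
      (assoc-component a (- b) c d (- d) c x y) ,
    ≈ᴹ-trans
      (+ᴹ-congʳ (*ₗ-congʳ (+-congˡ (trans (sym (-‿distribˡ-* b d)) (-‿distribʳ-* b d)))))
      (assoc-component a b c (- d) d c y x)

  *²-identityˡ : ∀ v → (1# , 0#) *² v ≈² v
  *²-identityˡ (x , y) = lemma -0#≈0# , lemma refl
    where
    lemma : ∀ {a u w} → a ≈ 0# → 1# *ₗ u +ᴹ a *ₗ w ≈ᴹ u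
    lemma {a} {u} {w} a≈0 =
      ≈ᴹ-trans (+ᴹ-cong (*ₗ-identityˡ u) (≈ᴹ-trans (*ₗ-congʳ a≈0) (*ₗ-zeroˡ w)))
               (+ᴹ-identityʳ u)

  *²-zeroˡ : ∀ v → (0# , 0#) *² v ≈² 0²
  *²-zeroˡ (x , y) = lemma -0#≈0# , lemma refl
    where
    lemma : ∀ {a u w} → a ≈ 0# → 0# *ₗ u +ᴹ a *ₗ w ≈ᴹ 0ᴹ
    lemma {a} {u} {w} a≈0 =
      ≈ᴹ-trans (+ᴹ-cong (*ₗ-zeroˡ u) (≈ᴹ-trans (*ₗ-congʳ a≈0) (*ₗ-zeroˡ w)))
               (+ᴹ-identityʳ 0ᴹ)

  *²-distribʳ : ∀ v a b c d →
    (a + c , b + d) *² v ≈² ((a , b) *² v) +² ((c , d) *² v)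
  *²-distribʳ (x , y) a b c d =
    ≈ᴹ-trans (+ᴹ-cong (*ₗ-distribʳ x a c)
                      (≈ᴹ-trans (*ₗ-congʳ (sym (-‿+-comm b d))) (*ₗ-distribʳ y _ _)))
             (interchange _ _ _ _) ,
    ≈ᴹ-trans (+ᴹ-cong (*ₗ-distribʳ y a c) (*ₗ-distribʳ x b d))
             (interchange _ _ _ _)

  *²-distribˡ : ∀ a v w → a *² (v +² w) ≈² (a *² v) +² (a *² w)
  *²-distribˡ (a , b) _ _ =
    ≈ᴹ-trans (+ᴹ-cong (*ₗ-distribˡ a _ _) (*ₗ-distribˡ (- b) _ _)) (interchange _ _ _ _) ,
    ≈ᴹ-trans (+ᴹ-cong (*ₗ-distribˡ a _ _) (*ₗ-distribˡ b _ _)) (interchange _ _ _ _)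

module Complexification (R : CommutativeRing 0ℓ 0ℓ) where

  open CommutativeRing R
  private
    module LR = LinearAlgebra R
    module P = PairLaws R LR.⟨K⟩

  -- R[i]; the pair (a , b) is a + bi.
  ℂ : CommutativeRing 0ℓ 0ℓ
  ℂ = record
    { Carrier = Carrier × Carrier
    ; _≈_ = P._≈²_
    ; _+_ = P._+²_
    ; _*_ = P._*²_
    ; -_  = λ (a , b) → - a , - b
    ; 0#  = P.0²
    ; 1#  = 1# , 0#
    ; isCommutativeRing = record
      { isRing = record
        { +-isAbelianGroup = record
          { isGroup = record
            { isMonoid = record
              { isSemigroup = record
                { isMagma = record
                  { isEquivalence = P.isEquivalence² ; ∙-cong = P.+²-cong }
                ; assoc = P.+²-assoc
                }
              ; identity = P.+²-identityˡ , λ _ → +-identityʳ _ , +-identityʳ _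
              }
            ; inverse = (λ _ → -‿inverseˡ _ , -‿inverseˡ _)
                      , (λ _ → -‿inverseʳ _ , -‿inverseʳ _)
            ; ⁻¹-cong = λ (p , q) → -‿cong p , -‿cong q
            }
          ; comm = P.+²-comm
          }
        ; *-cong = λ (p , q) → P.*²-cong p q
        ; *-assoc = λ (a , b) (c , d) → P.*²-assoc a b c d
        ; *-identity = P.*²-identityˡ
                     , λ x → tr (*²-comm x (1# , 0#)) (P.*²-identityˡ x)
        ; distrib = P.*²-distribˡ , λ x (a , b) (c , d) → P.*²-distribʳ x a b c d
        }
      ; *-comm = *²-comm
      }
    }
    where
    open IsEquivalence P.isEquivalence² using () renaming (trans to tr)
    open RingProperties ring using (-‿distribˡ-*; -‿distribʳ-*)
    *²-comm : ∀ x y → x P.*² y P.≈² y P.*² x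
    *²-comm (a , b) (c , d) =
      +-cong (*-comm a c)
             (trans (sym (-‿distribˡ-* b d))
                    (trans (-‿cong (*-comm b d)) (-‿distribˡ-* d b))) ,
      trans (+-comm _ _) (+-cong (*-comm b c) (*-comm a d))

  module ℂ = CommutativeRing ℂ
  module Lℂ = LinearAlgebra ℂ
  open LR using (Covector; LinearMap; ∥_∥; Dual; V*)
  open LR.LinearMap using (⟦_⟧)

  fromReal : Carrier → ℂ.Carrier
  fromReal a = a , 0#

  𝕚 : ℂ.Carrier
  𝕚 = 0# , 1#

  -- V ⊗ ℂ = V ⊕ iV
  _⊗ℂ : VectorSpace R → VectorSpace ℂ
  V ⊗ℂ = Lℂ.mkVectorSpace _≈²_ _+²_ 0² _*²_ isEquivalence²
    +²-cong +²-assoc +²-comm +²-identityˡ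
    (λ (p , q) → *²-cong p q)
    (λ (a , b) (c , d) → *²-assoc a b c d)
    *²-identityˡ *²-zeroˡ
    (λ v (a , b) (c , d) → *²-distribʳ v a b c d)
    *²-distribˡ
    where open PairLaws R V

  -- The ℂ-linear extension x + iy ↦ g x + i (g y) of an ℝ-linear map g.
  module _ {V : VectorSpace R} {W : VectorSpace ℂ} where
    private
      module V = LeftModule V
      module W = LeftModule W

    extend : (g : ∥ V ∥ → Lℂ.∥ W ∥) →
      (∀ {x y} → x V.≈ᴹ y → g x W.≈ᴹ g y) →
      (∀ x y → g (x V.+ᴹ y) W.≈ᴹ g x W.+ᴹ g y) →
      (∀ a x → g (a V.*ₗ x) W.≈ᴹ fromReal a W.*ₗ g x) →
      Lℂ.LinearMap (V ⊗ℂ) W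
    extend g g-cong g-+ g-* = Lℂ.mkLinearMap
      (λ (x , y) → g x W.+ᴹ 𝕚 W.*ₗ g y)
      (λ (p , q) → W.+ᴹ-cong (g-cong p) (W.*ₗ-congˡ (g-cong q)))
      (λ (x , y) (x′ , y′) → W.≈ᴹ-trans
        (W.+ᴹ-cong (g-+ x x′)
                   (W.≈ᴹ-trans (W.*ₗ-congˡ (g-+ y y′)) (W.*ₗ-distribˡ 𝕚 _ _)))
        (interchange _ _ _ _))
      scale
      where
      open CommutativeSemigroupProperties
        (CommutativeMonoid.commutativeSemigroup W.+ᴹ-commutativeMonoid)
        using (interchange)
      open SetoidReasoning W.≈ᴹ-setoid

      real+imaginary : ∀ a b → fromReal a ℂ.+ 𝕚 ℂ.* fromReal b ℂ.≈ (a , b)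
      real+imaginary a b =
        trans (+-congˡ (trans (+-cong (zeroˡ b) (zeroʳ _)) (+-identityˡ 0#)))
              (+-identityʳ a) ,
        trans (+-identityˡ _)
              (trans (+-cong (zeroˡ 0#) (*-identityˡ b)) (+-identityˡ b))

      times-𝕚 : ∀ a b → fromReal (- b) ℂ.+ 𝕚 ℂ.* fromReal a ℂ.≈ (a , b) ℂ.* 𝕚
      times-𝕚 a b = ℂ.trans (real+imaginary (- b) a)
        ( sym (trans (+-cong (zeroʳ a) (*-identityʳ (- b))) (+-identityˡ (- b)))
        , sym (trans (+-cong (*-identityʳ a) (zeroʳ b)) (+-identityʳ a)) )

      collect : ∀ a b x → fromReal a W.*ₗ x W.+ᴹ 𝕚 W.*ₗ fromReal b W.*ₗ x W.≈ᴹ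
                          (fromReal a ℂ.+ 𝕚 ℂ.* fromReal b) W.*ₗ x
      collect a b x = W.≈ᴹ-trans (W.+ᴹ-congˡ (W.≈ᴹ-sym (W.*ₗ-assoc 𝕚 _ x)))
                                 (W.≈ᴹ-sym (W.*ₗ-distribʳ x _ _))

      g-linear : ∀ a x b y → g (a V.*ₗ x V.+ᴹ b V.*ₗ y) W.≈ᴹ
                             fromReal a W.*ₗ g x W.+ᴹ fromReal b W.*ₗ g y
      g-linear a x b y = W.≈ᴹ-trans (g-+ _ _) (W.+ᴹ-cong (g-* a x) (g-* b y))

      scale : ∀ c v → let open PairLaws R V in
              g (proj₁ (c *² v)) W.+ᴹ 𝕚 W.*ₗ g (proj₂ (c *² v)) W.≈ᴹ
              c W.*ₗ (g (proj₁ v) W.+ᴹ 𝕚 W.*ₗ g (proj₂ v))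
      scale (a , b) (x , y) = begin
        g (a V.*ₗ x V.+ᴹ (- b) V.*ₗ y) W.+ᴹ 𝕚 W.*ₗ g (a V.*ₗ y V.+ᴹ b V.*ₗ x)
          ≈⟨ W.+ᴹ-cong (g-linear a x (- b) y)
               (W.*ₗ-congˡ (W.≈ᴹ-trans (g-linear a y b x) (W.+ᴹ-comm _ _))) ⟩
        (fromReal a W.*ₗ g x W.+ᴹ fromReal (- b) W.*ₗ g y) W.+ᴹ
          𝕚 W.*ₗ (fromReal b W.*ₗ g x W.+ᴹ fromReal a W.*ₗ g y)
          ≈⟨ W.+ᴹ-congˡ (W.*ₗ-distribˡ 𝕚 _ _) ⟩
        (fromReal a W.*ₗ g x W.+ᴹ fromReal (- b) W.*ₗ g y) W.+ᴹ
          (𝕚 W.*ₗ fromReal b W.*ₗ g x W.+ᴹ 𝕚 W.*ₗ fromReal a W.*ₗ g y)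
          ≈⟨ interchange _ _ _ _ ⟩
        (fromReal a W.*ₗ g x W.+ᴹ 𝕚 W.*ₗ fromReal b W.*ₗ g x) W.+ᴹ
          (fromReal (- b) W.*ₗ g y W.+ᴹ 𝕚 W.*ₗ fromReal a W.*ₗ g y)
          ≈⟨ W.+ᴹ-cong (collect a b (g x)) (collect (- b) a (g y)) ⟩
        (fromReal a ℂ.+ 𝕚 ℂ.* fromReal b) W.*ₗ g x W.+ᴹ
          (fromReal (- b) ℂ.+ 𝕚 ℂ.* fromReal a) W.*ₗ g y
          ≈⟨ W.+ᴹ-cong (W.*ₗ-congʳ (real+imaginary a b)) (W.*ₗ-congʳ (times-𝕚 a b)) ⟩
        (a , b) W.*ₗ g x W.+ᴹ ((a , b) ℂ.* 𝕚) W.*ₗ g y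
          ≈⟨ W.+ᴹ-congˡ (W.*ₗ-assoc _ _ _) ⟩
        (a , b) W.*ₗ g x W.+ᴹ (a , b) W.*ₗ 𝕚 W.*ₗ g y
          ≈⟨ W.*ₗ-distribˡ _ _ _ ⟨
        (a , b) W.*ₗ (g x W.+ᴹ 𝕚 W.*ₗ g y) ∎

  fromReal-* : ∀ a b → fromReal (a * b) ℂ.≈ fromReal a ℂ.* fromReal b
  fromReal-* a b =
    sym (trans (+-congˡ (zeroʳ _)) (+-identityʳ _)) ,
    sym (trans (+-cong (zeroʳ a) (zeroˡ b)) (+-identityˡ 0#))

  fromReal-+ : ∀ a b → fromReal (a + b) ℂ.≈ fromReal a ℂ.+ fromReal b
  fromReal-+ a b = refl , sym (+-identityˡ 0#)

  -- The embedding V* → (V ⊗ ℂ)*, which identifies V* ⊗ ℂ with (V ⊗ ℂ)*.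
  dual⊗ℂ : ∀ {V} → Covector V → Lℂ.Covector (V ⊗ℂ)
  dual⊗ℂ {V} α = extend {V = V} {W = Lℂ.⟨K⟩} (fromReal ∘ ⟦ α ⟧)
    (λ e → LR.LinearMap.⟦⟧-cong α e , refl)
    (λ x y → ℂ.trans (LR.LinearMap.+ᴹ-homo α x y , refl) (fromReal-+ _ _))
    (λ a x → ℂ.trans (LR.LinearMap.*ₗ-homo α a x , refl) (fromReal-* _ _))

  module _ {V : VectorSpace R} where
    private
      module D = LeftModule (Dual V)
      module Dℂ = LeftModule (Lℂ.Dual (V ⊗ℂ))

    dual⊗ℂ-cong : ∀ (α β : Covector V) → α D.≈ᴹ β → dual⊗ℂ α Dℂ.≈ᴹ dual⊗ℂ β
    dual⊗ℂ-cong α β e (x , y) =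
      ℂ.+-cong (e x , refl) (ℂ.*-congˡ {x = 𝕚} (e y , refl))

    dual⊗ℂ-+ : ∀ (α β : Covector V) →
      dual⊗ℂ (α D.+ᴹ β) Dℂ.≈ᴹ dual⊗ℂ α Dℂ.+ᴹ dual⊗ℂ β
    dual⊗ℂ-+ α β (x , y) = ℂ.trans
      (ℂ.+-cong (fromReal-+ _ _)
        (ℂ.trans (ℂ.*-congˡ {x = 𝕚} (fromReal-+ _ _)) (ℂ.distribˡ 𝕚 _ _)))
      (interchange _ _ _ _)
      where
      open CommutativeSemigroupProperties
        (CommutativeMonoid.commutativeSemigroup ℂ.+-commutativeMonoid)
        using (interchange)

    dual⊗ℂ-* : ∀ a (α : Covector V) →
      dual⊗ℂ (a D.*ₗ α) Dℂ.≈ᴹ fromReal a Dℂ.*ₗ dual⊗ℂ α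
    dual⊗ℂ-* a α (x , y) = ℂ.trans
      (ℂ.+-cong (fromReal-* _ _)
        (ℂ.trans (ℂ.*-congˡ {x = 𝕚} (fromReal-* _ _))
                 (x∙yz≈y∙xz 𝕚 (fromReal a) _)))
      (ℂ.sym (ℂ.distribˡ (fromReal a) _ _))
      where
      open CommutativeSemigroupProperties
        (CommutativeMonoid.commutativeSemigroup ℂ.*-commutativeMonoid)
        using (x∙yz≈y∙xz)

  module _ {m : ℕ} {V : Fin m → VectorSpace R} where

    Vℂ : Fin m → VectorSpace ℂ
    Vℂ r = V r ⊗ℂ

    -- The embedding V* → ⨂ᵣ (Vᵣ ⊗ ℂ)*, which identifies V* ⊗ ℂ with
    -- ⨂ᵣ (Vᵣ* ⊗ ℂ).
    tensor⊗ℂ : ∥ V* V ∥ → Lℂ.∥ Lℂ.V* Vℂ ∥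
    tensor⊗ℂ (LR.pure α) = Lℂ.pure (λ r → dual⊗ℂ (α r))
    tensor⊗ℂ LR.𝟘        = Lℂ.𝟘
    tensor⊗ℂ (s LR.⊕ t)  = tensor⊗ℂ s Lℂ.⊕ tensor⊗ℂ t
    tensor⊗ℂ (a LR.⊙ t)  = fromReal a Lℂ.⊙ tensor⊗ℂ t

    tensor⊗ℂ-cong : ∀ {s t} → LeftModule._≈ᴹ_ (V* V) s t →
                    LeftModule._≈ᴹ_ (Lℂ.V* Vℂ) (tensor⊗ℂ s) (tensor⊗ℂ t)
    tensor⊗ℂ-cong LR.≋-refl            = Lℂ.≋-refl
    tensor⊗ℂ-cong (LR.≋-sym p)         = Lℂ.≋-sym (tensor⊗ℂ-cong p)
    tensor⊗ℂ-cong (LR.≋-trans p q)     = Lℂ.≋-trans (tensor⊗ℂ-cong p) (tensor⊗ℂ-cong q)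
    tensor⊗ℂ-cong (LR.⊕-cong p q)      = Lℂ.⊕-cong (tensor⊗ℂ-cong p) (tensor⊗ℂ-cong q)
    tensor⊗ℂ-cong (LR.⊕-assoc s t u)   = Lℂ.⊕-assoc (tensor⊗ℂ s) (tensor⊗ℂ t) (tensor⊗ℂ u)
    tensor⊗ℂ-cong (LR.⊕-comm s t)      = Lℂ.⊕-comm (tensor⊗ℂ s) (tensor⊗ℂ t)
    tensor⊗ℂ-cong (LR.⊕-identityˡ s)   = Lℂ.⊕-identityˡ (tensor⊗ℂ s)
    tensor⊗ℂ-cong (LR.⊙-cong e p)      = Lℂ.⊙-cong (e , refl) (tensor⊗ℂ-cong p)
    tensor⊗ℂ-cong (LR.⊙-assoc a b s)   =
      Lℂ.≋-trans (Lℂ.⊙-cong (fromReal-* a b) Lℂ.≋-refl)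
                 (Lℂ.⊙-assoc (fromReal a) (fromReal b) (tensor⊗ℂ s))
    tensor⊗ℂ-cong (LR.⊙-identityˡ s)   = Lℂ.⊙-identityˡ (tensor⊗ℂ s)
    tensor⊗ℂ-cong (LR.⊙-zeroˡ s)       = Lℂ.⊙-zeroˡ (tensor⊗ℂ s)
    tensor⊗ℂ-cong (LR.⊙-distribʳ s a b) =
      Lℂ.≋-trans (Lℂ.⊙-cong (fromReal-+ a b) Lℂ.≋-refl)
                 (Lℂ.⊙-distribʳ (tensor⊗ℂ s) (fromReal a) (fromReal b))
    tensor⊗ℂ-cong (LR.⊙-distribˡ a s t) =
      Lℂ.⊙-distribˡ (fromReal a) (tensor⊗ℂ s) (tensor⊗ℂ t)
    tensor⊗ℂ-cong (LR.pure-cong {w} {w′} e) =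
      Lℂ.pure-cong (λ i → dual⊗ℂ-cong (w i) (w′ i) (e i))
    tensor⊗ℂ-cong (LR.pure-+ i {w} {u} {v} e o) = Lℂ.pure-+ i
      (λ z → ℂ.trans (dual⊗ℂ-cong (w i) (LeftModule._+ᴹ_ (Dual (V i)) (u i) (v i)) e z)
                     (dual⊗ℂ-+ (u i) (v i) z))
      (λ k k≢i → dual⊗ℂ-cong (w k) (u k) (proj₁ (o k k≢i))
               , dual⊗ℂ-cong (w k) (v k) (proj₂ (o k k≢i)))
    tensor⊗ℂ-cong (LR.pure-* i a {w} {u} e o) = Lℂ.pure-* i (fromReal a)
      (λ z → ℂ.trans (dual⊗ℂ-cong (w i) (LeftModule._*ₗ_ (Dual (V i)) a (u i)) e z)
                     (dual⊗ℂ-* a (u i) z))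
      (λ k k≢i → dual⊗ℂ-cong (w k) (u k) (o k k≢i))

    complexify : ∀ {H} → LinearMap H (V* V) → Lℂ.LinearMap (H ⊗ℂ) (Lℂ.V* Vℂ)
    complexify {H} φ = extend {V = H} {W = Lℂ.V* Vℂ} (tensor⊗ℂ ∘ ⟦ φ ⟧)
      (tensor⊗ℂ-cong ∘ LR.LinearMap.⟦⟧-cong φ)
      (λ x y → tensor⊗ℂ-cong (LR.LinearMap.+ᴹ-homo φ x y))
      (λ a x → tensor⊗ℂ-cong (LR.LinearMap.*ₗ-homo φ a x))

{-# OPTIONS --safe #-}

-- Fix j, let e = deg ψⱼ, and write the coordinates of φ(ψⱼ(ℓ)) on the affine
-- line of ℙ(Vⱼ) as real polynomials of degree at most e.  Let T be the set of
-- slots i in which this tensor splits off a nonconstant factor: all 2 × 2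
-- minors of its two halves vanish, and their ratio is not constant.  Dividing
-- by these ratios in lowest terms, one slot at a time, lowers the degree each
-- time, so T has at most e elements; if it has e, all ratios are linear,
-- hence projective transformations, and the remaining factor Γⱼ is constant.
--
-- A curve ψᵢ with the same image as ψⱼ, over ℝ or over ℂ, puts i into T: only
-- the values at real points are tested, and ψⱼ is injective because no nonzero
-- tensor lies in two of the spaces Σ⁰ of one slot.  If T has e elements,
-- the linear ratios conversely identify the image of ψⱼ with that of ψᵢ, over
-- both fields.  As deg ψⱼ is unchanged by complexification, decomposability
-- means |T| = e over either field.
--
-- That φ ⊗ ℂ is a factorization structure follows by fraction-free elimination:
-- where a complex form does not vanish, the kernel of the incidence equations
-- is spanned by a vector of forms.  It satisfies these equations at
-- generic real points, hence identically.
module Submission where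

open import Defs
open import Algebra.Bundles using (CommutativeRing; RawRing; CommutativeMonoid; Semiring)
import Algebra.Definitions.RawMonoid as RawMonoidDefs
import Algebra.Definitions.RawSemiring as RawSemiringDefs
open import Algebra.Module.Bundles using (LeftModule)
import Algebra.Properties.CommutativeMonoid.Sum as CommutativeMonoidSum
import Algebra.Properties.CommutativeSemigroup as CommutativeSemigroupProperties
import Algebra.Properties.Ring as RingProperties
import Algebra.Properties.Semiring.Mult.TCOptimised as Mult
import Algebra.Solver.Ring as RingSolver
open import Algebra.Solver.Ring.AlmostCommutativeRing using (fromCommutativeRing; _-Raw-AlmostCommutative⟶_)
open import Axiom.ExcludedMiddle using (ExcludedMiddle)
open import Data.Bool.Base using (Bool; true; false)
open import Data.Empty using (⊥; ⊥-elim)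
open import Data.Fin.Base using (Fin; zero; suc; punchIn; punchOut)
open import Data.Fin.Properties using (_≟_; punchIn-punchOut; suc-injective)
open import Data.Fin.Subset using (Subset; ∣_∣; _∈_; _∉_)
open import Data.Fin.Subset.Properties using (_∈?_; p⊆q⇒∣p∣≤∣q∣)
open import Data.Maybe.Base using (Maybe; just; nothing)
open import Data.Nat.Base as ℕ using (ℕ; zero; suc; z≤n; s≤s)
import Data.Nat.Properties as ℕₚ
open import Data.Product.Base using (Σ; ∃-syntax; _×_; _,_; proj₁; proj₂)
open import Data.Sum.Base using (_⊎_; inj₁; inj₂)
open import Data.Unit.Base using (tt)
open import Data.Vec.Base using (Vec; []; _∷_; lookup; _[_]≔_; tabulate)
import Data.Vec.Functional as Vector
open import Data.Vec.Functional using (insertAt)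
open import Data.Vec.Functional.Properties using (insertAt-lookup; insertAt-punchIn)
open import Data.Vec.Properties using (lookup∘update; lookup∘update′; []≔-idempotent; []≔-lookup; []≔-commutes; lookup∘tabulate; []=⇒lookup; lookup⇒[]=)
open import Function.Base using (_∘_)
open import Function.Bundles using (_⇔_; mk⇔; Equivalence)
open import Level using (0ℓ)
open import Relation.Binary.PropositionalEquality.Core as ≡ using (_≡_; _≢_)
import Relation.Binary.Reasoning.Setoid as SetoidReasoning
open import Relation.Binary.Structures using (IsTotalOrder)
open import Relation.Nullary.Decidable.Core using (Dec; yes; no; ⌊_⌋)
open import Relation.Nullary.Negation.Core using (¬_)
open Complexification using () renaming (ℂ to complexNumbers; _⊗ℂ to complexSpace; Vℂ to complexSpaces)

-- The real and the complex equivalence class of a curve are never compared directly: a real point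
-- of one curve might a priori be the image of a nonreal point of another. Both are compared with
-- `T`, whose defining conditions do not mention the point witnessing incidence, so a nonreal
-- witness serves as well as a real one. Demanding a nonconstant ratio makes every slot of `T` cost
-- at least one degree; a slot with a constant factor belongs to Γⱼ.
--
-- A form is an inductively generated function without coefficients. Degrees are recovered from
-- values: over an infinite field a function has at most one leading coefficient in each degree. To
-- compare degrees over ℝ and ℂ, a curve must have no zeros over ℂ either. Absence of real zeros
-- does not guarantee this, but the certificate in `generates` does, being an identity between forms
-- that survives complexification.
--
-- Statements about all points are phrased as vanishing of forms, namely 2 × 2 minors or incidence
-- equations; they then extend from generic or from real points to all points.

-- The coefficients of the ring solver are integers, represented as
-- differences of natural numbers; unlike coefficients in the ring itself,
-- they have decidable equality.
module Solver (R : CommutativeRing 0ℓ 0ℓ) where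

  open CommutativeRing R
  open RingProperties ring
  open Mult semiring using (×-homo-+; ×1-homo-*) renaming (_×_ to _•_)
  open CommutativeSemigroupProperties +-commutativeSemigroup using (interchange)
  open SetoidReasoning setoid

  private
    -- Makes one entry zero, so that a computed 0 or 1 is again represented like the constants 0 and
    -- 1.
    reduce : ℕ → ℕ → ℕ × ℕ
    reduce (suc a) (suc b) = reduce a b
    reduce a       b       = a , b

    Difference : RawRing 0ℓ 0ℓ
    Difference = record
      { Carrier = ℕ × ℕ
      ; _≈_ = _≡_
      ; _+_ = λ (a , b) (c , d) → reduce (a ℕ.+ c) (b ℕ.+ d)
      ; _*_ = λ (a , b) (c , d) → reduce (a ℕ.* c ℕ.+ b ℕ.* d) (a ℕ.* d ℕ.+ b ℕ.* c)
      ; -_ = λ (a , b) → b , a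
      ; 0# = 0 , 0
      ; 1# = 1 , 0
      }

    ⟪_⟫ : ℕ → Carrier
    ⟪ n ⟫ = n • 1#

    minus : ℕ × ℕ → Carrier
    minus (a , b) = ⟪ a ⟫ + - ⟪ b ⟫

    -- The special case makes the constants 0 and 1 denote 0# and 1#.
    difference : ℕ × ℕ → Carrier
    difference (a , zero)  = ⟪ a ⟫
    difference (a , suc b) = minus (a , suc b)

    difference≈minus : ∀ x → difference x ≈ minus x
    difference≈minus (a , zero)  = sym (trans (+-congˡ -0#≈0#) (+-identityʳ _))
    difference≈minus (a , suc b) = refl

    minus-reduce : ∀ a b → minus (reduce a b) ≈ ⟪ a ⟫ + - ⟪ b ⟫
    minus-reduce zero    b       = refl
    minus-reduce (suc a) zero    = refl
    minus-reduce (suc a) (suc b) = begin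
      minus (reduce a b)                             ≈⟨ minus-reduce a b ⟩
      ⟪ a ⟫ + - ⟪ b ⟫                                ≈⟨ +-identityˡ _ ⟨
      0# + (⟪ a ⟫ + - ⟪ b ⟫)                         ≈⟨ +-congʳ (-‿inverseʳ 1#) ⟨
      (1# + - 1#) + (⟪ a ⟫ + - ⟪ b ⟫)                ≈⟨ interchange _ _ _ _ ⟩
      (1# + ⟪ a ⟫) + (- 1# + - ⟪ b ⟫)                ≈⟨ +-congˡ (-‿+-comm _ _) ⟩
      (1# + ⟪ a ⟫) + - (1# + ⟪ b ⟫)                  ≈⟨ +-cong (×-homo-+ 1# 1 a) (-‿cong (×-homo-+ 1# 1 b)) ⟨
      ⟪ suc a ⟫ + - ⟪ suc b ⟫ ∎

    +-homo : ∀ x y → minus (RawRing._+_ Difference x y) ≈ minus x + minus y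
    +-homo (a , b) (c , d) = begin
      minus (reduce (a ℕ.+ c) (b ℕ.+ d))
        ≈⟨ minus-reduce (a ℕ.+ c) (b ℕ.+ d) ⟩
      ⟪ a ℕ.+ c ⟫ + - ⟪ b ℕ.+ d ⟫
        ≈⟨ +-cong (×-homo-+ 1# a c) (-‿cong (×-homo-+ 1# b d)) ⟩
      (⟪ a ⟫ + ⟪ c ⟫) + - (⟪ b ⟫ + ⟪ d ⟫)
        ≈⟨ +-congˡ (-‿+-comm _ _) ⟨
      (⟪ a ⟫ + ⟪ c ⟫) + (- ⟪ b ⟫ + - ⟪ d ⟫)
        ≈⟨ interchange _ _ _ _ ⟩
      (⟪ a ⟫ + - ⟪ b ⟫) + (⟪ c ⟫ + - ⟪ d ⟫) ∎

    product : ∀ a b c d → (a + - b) * (c + - d) ≈ (a * c + b * d) + - (a * d + b * c)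
    product a b c d = begin
      (a + - b) * (c + - d)                              ≈⟨ distribʳ _ _ _ ⟩
      a * (c + - d) + - b * (c + - d)                    ≈⟨ +-cong (distribˡ _ _ _) (distribˡ _ _ _) ⟩
      (a * c + a * - d) + (- b * c + - b * - d)          ≈⟨ +-cong (+-congˡ (sym (-‿distribʳ-* a d))) (+-cong (sym (-‿distribˡ-* b c)) minus²) ⟩
      (a * c + - (a * d)) + (- (b * c) + b * d)          ≈⟨ +-congˡ (+-comm _ _) ⟩
      (a * c + - (a * d)) + (b * d + - (b * c))          ≈⟨ interchange _ _ _ _ ⟩
      (a * c + b * d) + (- (a * d) + - (b * c))          ≈⟨ +-congˡ (-‿+-comm _ _) ⟩
      (a * c + b * d) + - (a * d + b * c) ∎
      where
      minus² : - b * - d ≈ b * d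
      minus² = trans (sym (-‿distribˡ-* b (- d)))
                     (trans (-‿cong (sym (-‿distribʳ-* b d))) (-‿involutive (b * d)))

    *-homo : ∀ x y → minus (RawRing._*_ Difference x y) ≈ minus x * minus y
    *-homo (a , b) (c , d) = begin
      minus (reduce (a ℕ.* c ℕ.+ b ℕ.* d) (a ℕ.* d ℕ.+ b ℕ.* c))
        ≈⟨ minus-reduce (a ℕ.* c ℕ.+ b ℕ.* d) (a ℕ.* d ℕ.+ b ℕ.* c) ⟩
      ⟪ a ℕ.* c ℕ.+ b ℕ.* d ⟫ + - ⟪ a ℕ.* d ℕ.+ b ℕ.* c ⟫
        ≈⟨ +-cong (sum-of-products a c b d) (-‿cong (sum-of-products a d b c)) ⟩
      (⟪ a ⟫ * ⟪ c ⟫ + ⟪ b ⟫ * ⟪ d ⟫) + - (⟪ a ⟫ * ⟪ d ⟫ + ⟪ b ⟫ * ⟪ c ⟫)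
        ≈⟨ product _ _ _ _ ⟨
      (⟪ a ⟫ + - ⟪ b ⟫) * (⟪ c ⟫ + - ⟪ d ⟫) ∎
      where
      sum-of-products : ∀ a c b d → ⟪ a ℕ.* c ℕ.+ b ℕ.* d ⟫ ≈ ⟪ a ⟫ * ⟪ c ⟫ + ⟪ b ⟫ * ⟪ d ⟫
      sum-of-products a c b d =
        trans (×-homo-+ 1# (a ℕ.* c) (b ℕ.* d)) (+-cong (×1-homo-* a c) (×1-homo-* b d))

    homomorphism : Difference -Raw-AlmostCommutative⟶ fromCommutativeRing R
    homomorphism = record
      { ⟦_⟧ = difference
      ; +-homo = λ x y → trans (difference≈minus (RawRing._+_ Difference x y))
          (trans (+-homo x y) (sym (+-cong (difference≈minus x) (difference≈minus y))))
      ; *-homo = λ x y → trans (difference≈minus (RawRing._*_ Difference x y))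
          (trans (*-homo x y) (sym (*-cong (difference≈minus x) (difference≈minus y))))
      ; -‿homo = λ (a , b) → trans (difference≈minus (b , a)) (trans (+-comm _ _)
          (trans (+-congˡ (sym (-‿involutive ⟪ b ⟫)))
            (trans (-‿+-comm ⟪ a ⟫ (- ⟪ b ⟫)) (-‿cong (sym (difference≈minus (a , b)))))))
      ; 0-homo = refl
      ; 1-homo = refl
      }

    equal? : ∀ x y → Maybe (difference x ≈ difference y)
    equal? (a , b) (c , d) with a ℕ.+ d ℕₚ.≟ c ℕ.+ b
    ... | no _ = nothing
    ... | yes e = just (trans (difference≈minus (a , b)) (trans (begin
      ⟪ a ⟫ + - ⟪ b ⟫                              ≈⟨ +-identityʳ _ ⟨
      (⟪ a ⟫ + - ⟪ b ⟫) + 0#                       ≈⟨ +-congˡ (-‿inverseʳ ⟪ d ⟫) ⟨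
      (⟪ a ⟫ + - ⟪ b ⟫) + (⟪ d ⟫ + - ⟪ d ⟫)        ≈⟨ interchange _ _ _ _ ⟩
      (⟪ a ⟫ + ⟪ d ⟫) + (- ⟪ b ⟫ + - ⟪ d ⟫)        ≈⟨ +-congʳ (×-homo-+ 1# a d) ⟨
      ⟪ a ℕ.+ d ⟫ + (- ⟪ b ⟫ + - ⟪ d ⟫)            ≡⟨ ≡.cong (λ n → ⟪ n ⟫ + (- ⟪ b ⟫ + - ⟪ d ⟫)) e ⟩
      ⟪ c ℕ.+ b ⟫ + (- ⟪ b ⟫ + - ⟪ d ⟫)            ≈⟨ +-cong (×-homo-+ 1# c b) (+-comm _ _) ⟩
      (⟪ c ⟫ + ⟪ b ⟫) + (- ⟪ d ⟫ + - ⟪ b ⟫)        ≈⟨ interchange _ _ _ _ ⟩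
      (⟪ c ⟫ + - ⟪ d ⟫) + (⟪ b ⟫ + - ⟪ b ⟫)        ≈⟨ +-congˡ (-‿inverseʳ ⟪ b ⟫) ⟩
      (⟪ c ⟫ + - ⟪ d ⟫) + 0#                       ≈⟨ +-identityʳ _ ⟩
      ⟪ c ⟫ + - ⟪ d ⟫ ∎) (sym (difference≈minus (c , d)))))

  open RingSolver Difference (fromCommutativeRing R) homomorphism equal? public
    using (solve; _:=_; _:+_; _:*_; _:-_; :-_; con; Polynomial)

  :0 :1 : ∀ {n} → Polynomial n
  :0 = con (0 , 0)
  :1 = con (1 , 0)

  difference-zero : ∀ {x y} → x + - y ≈ 0# → x ≈ y
  difference-zero {x} {y} e = trans (solve 2 (λ x y → x := (x :+ :- y) :+ y) refl x y)
                                    (trans (+-congʳ e) (+-identityˡ y))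

  zero-difference : ∀ {x y} → x ≈ y → x + - y ≈ 0#
  zero-difference {x} {y} e = trans (+-congʳ e) (-‿inverseʳ y)

-- Infinite fields

record IsInfiniteField (K : CommutativeRing 0ℓ 0ℓ) : Set where
  open CommutativeRing K
  field
    0≉1             : ¬ (0# ≈ 1#)
    inverse         : ∀ x → ¬ (x ≈ 0#) → ∃[ y ] x * y ≈ 1#
    -- Infinitude is given as an injective sequence, so that a polynomial can be tested on the tails
    -- of `point`, which stay infinite when a root is divided out.
    point           : ℕ → Carrier
    point-injective : ∀ i j → point i ≈ point j → i ≡ j

module FieldProperties (K : CommutativeRing 0ℓ 0ℓ) (F : IsInfiniteField K) (em : ExcludedMiddle 0ℓ) where

  open CommutativeRing K
  open IsInfiniteField F public
  open Solver K
  open SetoidReasoning setoid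

  *-cancelˡ-nonzero : ∀ {a x y} → ¬ (a ≈ 0#) → a * x ≈ a * y → x ≈ y
  *-cancelˡ-nonzero {a} {x} {y} a≉0 e with inverse a a≉0
  ... | b , ab = begin
    x            ≈⟨ unit x ⟨
    b * (a * x)  ≈⟨ *-congˡ e ⟩
    b * (a * y)  ≈⟨ unit y ⟩
    y ∎
    where
    unit : ∀ z → b * (a * z) ≈ z
    unit z = trans (solve 3 (λ a b z → b :* (a :* z) := (a :* b) :* z) refl a b z)
                   (trans (*-congʳ ab) (*-identityˡ z))

  *-zero-cancelˡ : ∀ {a x} → ¬ (a ≈ 0#) → a * x ≈ 0# → x ≈ 0#
  *-zero-cancelˡ {a} a≉0 e = *-cancelˡ-nonzero a≉0 (trans e (sym (zeroʳ a)))

  *-nonzero : ∀ {a b} → ¬ (a ≈ 0#) → ¬ (b ≈ 0#) → ¬ (a * b ≈ 0#)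
  *-nonzero a≉0 b≉0 e = b≉0 (*-zero-cancelˡ a≉0 e)

  *-nonzeroˡ : ∀ {a b} → ¬ (a * b ≈ 0#) → ¬ (a ≈ 0#)
  *-nonzeroˡ {a} {b} ab≉0 e = ab≉0 (trans (*-congʳ e) (zeroˡ b))

  *-nonzeroʳ : ∀ {a b} → ¬ (a * b ≈ 0#) → ¬ (b ≈ 0#)
  *-nonzeroʳ {a} {b} ab≉0 e = ab≉0 (trans (*-congˡ e) (zeroʳ a))

  1≉0 : ¬ (1# ≈ 0#)
  1≉0 e = 0≉1 (sym e)

  inverse-nonzero : ∀ {a b} → a * b ≈ 1# → ¬ (b ≈ 0#)
  inverse-nonzero {a} ab e = 0≉1 (trans (sym (zeroʳ a)) (trans (*-congˡ (sym e)) ab))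

  _≟0 : ∀ x → Dec (x ≈ 0#)
  x ≟0 = em

  nonzero-member : ∀ {A : Set} (f : A → Carrier) → ¬ (∀ a → f a ≈ 0#) → ∃[ a ] ¬ (f a ≈ 0#)
  nonzero-member f ¬all with em {∃[ a ] ¬ (f a ≈ 0#)}
  ... | yes p = p
  ... | no ¬p = ⊥-elim (¬all λ a → zero-of a)
    where
    zero-of : ∀ a → f a ≈ 0#
    zero-of a with f a ≟0
    ... | yes e = e
    ... | no ne = ⊥-elim (¬p (a , ne))

-- Polynomial functions of one variable: degrees, roots, coprime factorizations

module Polynomials (K : CommutativeRing 0ℓ 0ℓ) (F : IsInfiniteField K) (em : ExcludedMiddle 0ℓ) where

  open CommutativeRing K hiding (zero)
  open FieldProperties K F em
  open Solver K
  open SetoidReasoning setoid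

  Vanishes : (Carrier → Carrier) → Set
  Vanishes f = ∀ t → f t ≈ 0#

  -- Poly d c f: the function f is a polynomial of degree at most d, and c is
  -- its coefficient of t^d.
  data Poly : ℕ → Carrier → (Carrier → Carrier) → Set where
    constant : ∀ {c f} → (∀ t → f t ≈ c) → Poly 0 c f
    horner   : ∀ {d c f g} a → Poly d c g → (∀ t → f t ≈ a + t * g t) → Poly (suc d) c f

  poly-cong : ∀ {d c f g} → (∀ t → g t ≈ f t) → Poly d c f → Poly d c g
  poly-cong e (constant p)   = constant λ t → trans (e t) (p t)
  poly-cong e (horner a p q) = horner a p λ t → trans (e t) (q t)

  lead-cong : ∀ {d c c′ f} → c ≈ c′ → Poly d c f → Poly d c′ f
  lead-cong e (constant p)   = constant λ t → trans (p t) e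
  lead-cong e (horner a p q) = horner a (lead-cong e p) q

  poly-+ : ∀ {d c c′ f g} → Poly d c f → Poly d c′ g → Poly d (c + c′) (λ t → f t + g t)
  poly-+ (constant p)   (constant q)   = constant λ t → +-cong (p t) (q t)
  poly-+ (horner {g = g} a p e) (horner {g = h} b q e′) = horner (a + b) (poly-+ p q) λ t →
    trans (+-cong (e t) (e′ t))
          (solve 5 (λ a b t x y → (a :+ t :* x) :+ (b :+ t :* y) := (a :+ b) :+ t :* (x :+ y))
             refl a b t (g t) (h t))

  poly-scale : ∀ {d c f} a → Poly d c f → Poly d (a * c) (λ t → a * f t)
  poly-scale a (constant p) = constant λ t → *-congˡ (p t)
  poly-scale a (horner {g = g} b p e) = horner (a * b) (poly-scale a p) λ t →
    trans (*-congˡ (e t))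
          (solve 4 (λ a b t x → a :* (b :+ t :* x) := a :* b :+ t :* (a :* x)) refl a b t (g t))

  raise : ∀ {d c f} → Poly d c f → Poly (suc d) 0# f
  raise {c = c} (constant p) = horner c (constant (λ t → refl {0#})) λ t →
    trans (p t) (sym (trans (+-congˡ (zeroʳ t)) (+-identityʳ c)))
  raise (horner a p e) = horner a (raise p) e

  raise-by : ∀ k {d c f} → Poly d c f → Poly (suc (k ℕ.+ d)) 0# f
  raise-by zero    p = raise p
  raise-by (suc k) p = raise (raise-by k p)

  raise-to : ∀ {d n c f} → d ℕ.≤ n → Poly d c f → ∃[ c′ ] Poly n c′ f
  raise-to {d} {n} {c} {f} d≤n p with ℕₚ.m≤n⇒m<n∨m≡n d≤n
  ... | inj₂ ≡.refl = c , p
  ... | inj₁ d<n with ℕₚ.m≤n⇒∃[o]m+o≡n d<n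
  ...   | k , ≡.refl = 0# , ≡.subst (λ n → Poly n 0# f) (≡.cong suc (ℕₚ.+-comm k d)) (raise-by k p)

  shift : ∀ {d c f} → Poly d c f → Poly (suc d) c (λ t → t * f t)
  shift p = horner 0# p λ t → sym (+-identityˡ _)

  poly-* : ∀ {d e c c′ f g} → Poly d c f → Poly e c′ g → Poly (d ℕ.+ e) (c * c′) (λ t → f t * g t)
  poly-* (constant {c} p) q = poly-cong (λ t → *-congʳ (p t)) (poly-scale c q)
  poly-* {g = g} (horner {d = d} {g = f′} a p e) q =
    poly-cong (λ t → trans (*-congʳ (e t))
        (solve 4 (λ a t x y → (a :+ t :* x) :* y := a :* y :+ t :* (x :* y)) refl a t (f′ t) (g t)))
      (lead-cong (+-identityˡ _)
        (poly-+ (raise-by d (poly-scale a q)) (shift (poly-* p q))))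

  linear-poly : ∀ a b → Poly 1 b (λ t → a + t * b)
  linear-poly a b = horner a (constant λ _ → refl) λ _ → refl

  monomial : ∀ n → ∃[ f ] Poly n 1# f
  monomial zero    = (λ _ → 1#) , constant λ _ → refl
  monomial (suc n) = _ , shift (proj₂ (monomial n))

  -- Synthetic division by `t - a`. The leading coefficient passes to the quotient unchanged, so an
  -- induction along divisions still controls the original coefficient.
  factor : ∀ {d c f} → Poly (suc d) c f → ∀ a →
           ∃[ q ] Poly d c q × (∀ t → f t ≈ f a + (t + - a) * q t)
  factor {c = c} {f} (horner {g = g} b (constant p) e) a = (λ _ → c) , constant (λ _ → refl) , λ t → begin
    f t                        ≈⟨ at t ⟩
    b + t * c                  ≈⟨ solve 4 (λ a b c t → b :+ t :* c := (b :+ a :* c) :+ (t :+ :- a) :* c) refl a b c t ⟩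
    (b + a * c) + (t + - a) * c ≈⟨ +-congʳ (at a) ⟨
    f a + (t + - a) * c ∎
    where
    at : ∀ t → f t ≈ b + t * c
    at t = trans (e t) (+-congˡ (*-congˡ (p t)))
  factor {f = f} (horner {g = g} b p@(horner _ _ _) e) a with factor p a
  ... | q , q-poly , g≈ = (λ t → g a + t * q t) , horner (g a) q-poly (λ _ → refl) , λ t → begin
    f t                                              ≈⟨ e t ⟩
    b + t * g t                                      ≈⟨ +-congˡ (*-congˡ (g≈ t)) ⟩
    b + t * (g a + (t + - a) * q t)                  ≈⟨ solve 5 (λ a b t x y → b :+ t :* (x :+ (t :+ :- a) :* y)
                                                           := (b :+ a :* x) :+ (t :+ :- a) :* (x :+ t :* y)) refl a b t (g a) (q t) ⟩
    (b + a * g a) + (t + - a) * (g a + t * q t)      ≈⟨ +-congʳ (e a) ⟨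
    f a + (t + - a) * (g a + t * q t) ∎

  -- Dividing by `t - point n` leaves a quotient that vanishes at all later points. Speaking of
  -- tails of the sequence avoids counting roots.
  vanishing-from : ∀ {d c f} n → Poly d c f → (∀ i → n ℕ.≤ i → f (point i) ≈ 0#) →
                   c ≈ 0# × Vanishes f
  vanishing-from n (constant p) z = c≈0 , λ t → trans (p t) c≈0
    where c≈0 = trans (sym (p (point n))) (z n ℕₚ.≤-refl)
  vanishing-from {d = suc d} {c} {f} n p z = conclude (vanishing-from (suc n) q-poly q-root)
    where
    q = proj₁ (factor p (point n))
    q-poly : Poly d c q
    q-poly = proj₁ (proj₂ (factor p (point n)))
    f≈ : ∀ t → f t ≈ (t + - point n) * q t
    f≈ t = trans (proj₂ (proj₂ (factor p (point n))) t)
                 (trans (+-congʳ (z n ℕₚ.≤-refl)) (+-identityˡ _))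
    q-root : ∀ i → suc n ℕ.≤ i → q (point i) ≈ 0#
    q-root i n<i = *-zero-cancelˡ
      (λ e → ℕₚ.<⇒≢ n<i (≡.sym (point-injective i n (difference-zero e))))
      (trans (sym (f≈ (point i))) (z i (ℕₚ.<⇒≤ n<i)))
    conclude : c ≈ 0# × Vanishes q → c ≈ 0# × Vanishes f
    conclude (c≈0 , q≈0) = c≈0 , λ t → trans (f≈ t) (trans (*-congˡ (q≈0 t)) (zeroʳ _))

  poly-vanishes : ∀ {d c f} → Poly d c f → (∀ i → f (point i) ≈ 0#) → Vanishes f
  poly-vanishes p z = proj₂ (vanishing-from 0 p λ i _ → z i)

  lead-vanishes : ∀ {d c f} → Poly d c f → Vanishes f → c ≈ 0#
  lead-vanishes p z = proj₁ (vanishing-from 0 p λ i _ → z (point i))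

  lead-unique : ∀ {d c c′ f} → Poly d c f → Poly d c′ f → c ≈ c′
  lead-unique {c = c} {c′} {f} p q = difference-zero (trans (+-congˡ (sym (*-minus c′)))
      (lead-vanishes (poly-+ p (poly-scale (- 1#) q)) λ t → trans (+-congˡ (*-minus (f t))) (-‿inverseʳ (f t))))
    where
    *-minus : ∀ x → - 1# * x ≈ - x
    *-minus = solve 1 (λ x → (:- :1) :* x := :- x) refl

  -- If `d` were smaller than `n`, raising the first presentation to degree `n` would give leading
  -- coefficient 0, against `lead-unique`.
  degree-≤ : ∀ {d n c c′ f} → Poly d c f → Poly n c′ f → ¬ (c′ ≈ 0#) → n ℕ.≤ d
  degree-≤ {d} {n} {f = f} p q c′≉0 with n ℕₚ.≤? d
  ... | yes n≤d = n≤d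
  ... | no n≰d with ℕₚ.m≤n⇒∃[o]m+o≡n (ℕₚ.≰⇒> n≰d)
  ...   | k , ≡.refl = ⊥-elim (c′≉0 (lead-unique q
            (≡.subst (λ n → Poly n 0# f) (≡.cong suc (ℕₚ.+-comm k d)) (raise-by k p))))

  lower : ∀ {d c f} → Poly (suc d) c f → c ≈ 0# → ∃[ c′ ] Poly d c′ f
  lower (horner a (constant p) e) c≈0 = a , constant λ t →
    trans (e t) (trans (+-congˡ (trans (*-congˡ (trans (p t) c≈0)) (zeroʳ t))) (+-identityʳ a))
  lower (horner a p@(horner _ _ _) e) c≈0 with lower p c≈0
  ... | c′ , p′ = c′ , horner a p′ e

  exact-degree : ∀ {d c f} → Poly d c f → ¬ Vanishes f →
                 ∃[ n ] ∃[ c′ ] n ℕ.≤ d × ¬ (c′ ≈ 0#) × Poly n c′ f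
  exact-degree {d} {c} p f≉0 with c ≟0
  exact-degree {d} {c} p f≉0 | no c≉0 = d , c , ℕₚ.≤-refl , c≉0 , p
  exact-degree (constant p) f≉0 | yes c≈0 = ⊥-elim (f≉0 λ t → trans (p t) c≈0)
  exact-degree p@(horner _ _ _) f≉0 | yes c≈0 with lower p c≈0
  ... | _ , p′ with exact-degree p′ f≉0
  ...   | n , c′ , n≤d , rest = n , c′ , ℕₚ.m≤n⇒m≤1+n n≤d , rest

  IsPoly : (Carrier → Carrier) → Set
  IsPoly f = ∃[ d ] ∃[ c ] Poly d c f

  isPoly-const : ∀ a → IsPoly (λ _ → a)
  isPoly-const a = 0 , a , constant λ _ → refl

  isPoly-* : ∀ {f g} → IsPoly f → IsPoly g → IsPoly (λ t → f t * g t)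
  isPoly-* (_ , _ , p) (_ , _ , q) = _ , _ , poly-* p q

  isPoly-+ : ∀ {f g} → IsPoly f → IsPoly g → IsPoly (λ t → f t + g t)
  isPoly-+ (d , _ , p) (e , _ , q) =
    _ , _ , poly-+ (proj₂ (raise-to (ℕₚ.m≤m+n d e) p)) (proj₂ (raise-to (ℕₚ.m≤n+m e d) q))

  isPoly-neg : ∀ {f} → IsPoly f → IsPoly (λ t → - f t)
  isPoly-neg {f} (d , _ , p) = _ , _ ,
    poly-cong (λ t → solve 1 (λ x → :- x := (:- :1) :* x) refl (f t)) (poly-scale (- 1#) p)

  -- If neither function vanished, the product of their exact leading coefficients would be the
  -- leading coefficient of the zero function.
  no-zero-divisors : ∀ {f g} → IsPoly f → IsPoly g → (∀ t → f t * g t ≈ 0#) →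
                     ¬ Vanishes g → Vanishes f
  no-zero-divisors {f} (_ , _ , p) (_ , _ , q) fg≈0 g≉0 with em {Vanishes f}
  ... | yes f≈0 = f≈0
  ... | no f≉0 with exact-degree p f≉0 | exact-degree q g≉0
  ...   | _ , _ , _ , a≉0 , p′ | _ , _ , _ , b≉0 , q′ =
    ⊥-elim (*-nonzero a≉0 b≉0 (lead-vanishes (poly-* p′ q′) fg≈0))

  -- `p : q` is the ratio `a : b` in lowest terms, and `g` the greatest common divisor. The Bezout
  -- identity later replaces division by `p` and `q`. If both functions vanish, the construction
  -- below returns the ratio 0 : 1.
  record CoprimeFactorization (a b : Carrier → Carrier) : Set where
    field
      g p q u v : Carrier → Carrier
      p-poly    : IsPoly p
      q-poly    : IsPoly q
      u-poly    : IsPoly u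
      v-poly    : IsPoly v
      a≈gp      : ∀ t → a t ≈ g t * p t
      b≈gq      : ∀ t → b t ≈ g t * q t
      bezout    : ∀ t → u t * p t + v t * q t ≈ 1#

  private
    swap : ∀ {a b} → CoprimeFactorization a b → CoprimeFactorization b a
    swap c = record
      { g = g ; p = q ; q = p ; u = v ; v = u
      ; p-poly = q-poly ; q-poly = p-poly ; u-poly = v-poly ; v-poly = u-poly
      ; a≈gp = b≈gq ; b≈gq = a≈gp ; bezout = λ t → trans (+-comm _ _) (bezout t)
      }
      where open CoprimeFactorization c

    first-vanishes : ∀ {a b} → Vanishes a → CoprimeFactorization a b
    first-vanishes {b = b} a≈0 = record
      { g = b ; p = λ _ → 0# ; q = λ _ → 1# ; u = λ _ → 0# ; v = λ _ → 1#
      ; p-poly = isPoly-const 0# ; q-poly = isPoly-const 1# ; u-poly = isPoly-const 0# ; v-poly = isPoly-const 1#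
      ; a≈gp = λ t → trans (a≈0 t) (sym (zeroʳ _)) ; b≈gq = λ t → sym (*-identityʳ _)
      ; bezout = λ t → solve 0 (:0 :* :0 :+ :1 :* :1 := :1) refl
      }

    add-multiple : ∀ {a a′ b} h → IsPoly h → (∀ t → a t ≈ a′ t + h t * b t) →
                   CoprimeFactorization a′ b → CoprimeFactorization a b
    add-multiple {a} {a′} {b} h h-poly a≈ c = record
      { g = g ; p = λ t → p t + h t * q t ; q = q ; u = u ; v = λ t → v t + - (u t * h t)
      ; p-poly = isPoly-+ p-poly (isPoly-* h-poly q-poly) ; q-poly = q-poly
      ; u-poly = u-poly ; v-poly = isPoly-+ v-poly (isPoly-neg (isPoly-* u-poly h-poly))
      ; a≈gp = λ t → begin
          a t                         ≈⟨ a≈ t ⟩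
          a′ t + h t * b t            ≈⟨ +-cong (a≈gp t) (*-congˡ (b≈gq t)) ⟩
          g t * p t + h t * (g t * q t)
            ≈⟨ solve 4 (λ g p h q → g :* p :+ h :* (g :* q) := g :* (p :+ h :* q)) refl (g t) (p t) (h t) (q t) ⟩
          g t * (p t + h t * q t) ∎
      ; b≈gq = b≈gq
      ; bezout = λ t → trans
          (solve 5 (λ u p h q v → u :* (p :+ h :* q) :+ (v :+ :- (u :* h)) :* q := u :* p :+ v :* q)
             refl (u t) (p t) (h t) (q t) (v t))
          (bezout t)
      }
      where open CoprimeFactorization c

    -- One step of long division: `h` is the quotient of the leading coefficients times a power of
    -- t, chosen to cancel the top term of `a`. A constant with cancelled top term is zero, hence
    -- the alternative.
    reduce : ∀ {n k c c′ a b} → Poly n c a → Poly k c′ b → ¬ (c′ ≈ 0#) → k ℕ.≤ n →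
             ∃[ h ] IsPoly h × ∃[ a′ ] (∀ t → a t ≈ a′ t + h t * b t) ×
             (Vanishes a′ ⊎ ∃[ n′ ] ∃[ d ] n′ ℕ.< n × Poly n′ d a′)
    reduce {n} {k} {c} {c′} {a} {b} p q c′≉0 k≤n
      with inverse c′ c′≉0 | ℕₚ.m≤n⇒∃[o]m+o≡n k≤n
    ... | y , c′y | j , ≡.refl = h , (_ , _ , h-poly) , a′ , a≈ , smaller p′ lead≈0
      where
      x = proj₁ (monomial j)
      h a′ : Carrier → Carrier
      h t = (c * y) * x t
      h-poly : Poly j ((c * y) * 1#) h
      h-poly = poly-scale (c * y) (proj₂ (monomial j))
      a′ t = a t + (- 1#) * (h t * b t)
      p′ : Poly (k ℕ.+ j) (c + (- 1#) * (((c * y) * 1#) * c′)) a′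
      p′ = poly-+ p (poly-scale (- 1#) (≡.subst (λ n → Poly n (((c * y) * 1#) * c′) (λ t → h t * b t)) (ℕₚ.+-comm j k) (poly-* h-poly q)))
      a≈ : ∀ t → a t ≈ a′ t + h t * b t
      a≈ t = solve 2 (λ a z → a := (a :+ (:- :1) :* z) :+ z) refl (a t) (h t * b t)
      lead≈0 : c + (- 1#) * (((c * y) * 1#) * c′) ≈ 0#
      lead≈0 = begin
        c + (- 1#) * (((c * y) * 1#) * c′)
          ≈⟨ solve 3 (λ c y d → c :+ (:- :1) :* (((c :* y) :* :1) :* d) := c :+ :- (c :* (d :* y))) refl c y c′ ⟩
        c + - (c * (c′ * y)) ≈⟨ +-congˡ (-‿cong (*-congˡ c′y)) ⟩
        c + - (c * 1#)       ≈⟨ solve 1 (λ c → c :+ :- (c :* :1) := :0) refl c ⟩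
        0# ∎
      smaller : ∀ {n l f} → Poly n l f → l ≈ 0# → Vanishes f ⊎ ∃[ n′ ] ∃[ d ] n′ ℕ.< n × Poly n′ d f
      smaller (constant r) l≈0 = inj₁ λ t → trans (r t) l≈0
      smaller r@(horner _ _ _) l≈0 = inj₂ (_ , proj₁ (lower r l≈0) , ℕₚ.≤-refl , proj₂ (lower r l≈0))

    -- Euclid's algorithm by induction on a bound `N` for the sum of the two degrees. Nonzero inputs
    -- are first given their exact degrees, which makes the leading coefficient of the divisor
    -- invertible, and `swap` puts the larger degree first.
    euclid : ∀ N {n k c c′ a b} → n ℕ.+ k ℕ.≤ N → Poly n c a → Poly k c′ b → CoprimeFactorization a b
    euclid-≤ : ∀ N {n k c c′ a b} → n ℕ.+ k ℕ.≤ N → Poly n c a → Poly k c′ b → ¬ (c′ ≈ 0#) → k ℕ.≤ n →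
               CoprimeFactorization a b

    euclid-≤ N bound p q c′≉0 k≤n with reduce p q c′≉0 k≤n
    euclid-≤ N bound p q c′≉0 k≤n | h , h-poly , a′ , a≈ , inj₁ a′≈0 =
      add-multiple h h-poly a≈ (first-vanishes a′≈0)
    euclid-≤ zero bound p q c′≉0 k≤n | h , h-poly , a′ , a≈ , inj₂ (n′ , _ , n′<n , p′) =
      ⊥-elim (ℕₚ.n≮0 (ℕₚ.≤-trans n′<n (ℕₚ.m+n≤o⇒m≤o _ bound)))
    euclid-≤ (suc N) bound p q c′≉0 k≤n | h , h-poly , a′ , a≈ , inj₂ (n′ , _ , n′<n , p′) =
      add-multiple h h-poly a≈ (euclid N (ℕₚ.≤-pred (ℕₚ.≤-trans (ℕₚ.+-monoˡ-≤ _ n′<n) bound)) p′ q)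

    euclid N {a = a} {b} bound p q with em {Vanishes a} | em {Vanishes b}
    ... | yes a≈0 | _ = first-vanishes a≈0
    ... | no _ | yes b≈0 = swap (first-vanishes b≈0)
    ... | no a≉0 | no b≉0 with exact-degree p a≉0 | exact-degree q b≉0
    ...   | n , _ , n≤ , c≉0 , p′ | k , _ , k≤ , c′≉0 , q′ with ℕₚ.≤-total k n
    ...     | inj₁ k≤n = euclid-≤ N (ℕₚ.≤-trans (ℕₚ.+-mono-≤ n≤ k≤) bound) p′ q′ c′≉0 k≤n
    ...     | inj₂ n≤k = swap (euclid-≤ N
                (ℕₚ.≤-trans (ℕₚ.≤-reflexive (ℕₚ.+-comm k n)) (ℕₚ.≤-trans (ℕₚ.+-mono-≤ n≤ k≤) bound)) q′ p′ c≉0 n≤k)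

  coprimeFactorization : ∀ {a b} → IsPoly a → IsPoly b → CoprimeFactorization a b
  coprimeFactorization (_ , _ , p) (_ , _ , q) = euclid _ ℕₚ.≤-refl p q

-- Updates and products over slots

pattern 0F = zero
pattern 1F = suc zero

upd : ∀ {m} {A : Fin m → Set} (i : Fin m) → A i → (∀ r → A r) → ∀ r → A r
upd i x f r with r ≟ i
... | yes ≡.refl = x
... | no _ = f r

upd-at : ∀ {m} {A : Fin m → Set} (i : Fin m) (x : A i) (f : ∀ r → A r) → upd {A = A} i x f i ≡ x
upd-at i x f with i ≟ i
... | yes ≡.refl = ≡.refl
... | no i≢i = ⊥-elim (i≢i ≡.refl)

upd-off : ∀ {m} {A : Fin m → Set} (i : Fin m) (x : A i) (f : ∀ r → A r) {r} → r ≢ i → upd {A = A} i x f r ≡ f r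
upd-off i x f {r} r≢i with r ≟ i
... | yes r≡i = ⊥-elim (r≢i r≡i)
... | no _ = ≡.refl

module Products (K : CommutativeRing 0ℓ 0ℓ) where

  open CommutativeRing K hiding (zero)
  open Solver K

  ∏ : ∀ {n} → (Fin n → Carrier) → Carrier
  ∏ {zero}  f = 1#
  ∏ {suc n} f = f zero * ∏ (f ∘ suc)

  ∏-cong : ∀ {n} {f g : Fin n → Carrier} → (∀ i → f i ≈ g i) → ∏ f ≈ ∏ g
  ∏-cong {zero}  e = refl
  ∏-cong {suc n} e = *-cong (e zero) (∏-cong (e ∘ suc))

  ∏-* : ∀ {n} (f g : Fin n → Carrier) → ∏ (λ i → f i * g i) ≈ ∏ f * ∏ g
  ∏-* {zero}  f g = sym (*-identityˡ 1#)
  ∏-* {suc n} f g = trans (*-congˡ (∏-* (f ∘ suc) (g ∘ suc)))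
    (solve 4 (λ a b c d → (a :* b) :* (c :* d) := (a :* c) :* (b :* d)) refl _ _ _ _)

  -- The hypotheses mirror those of `pure-*`, and those of `∏-additive` mirror `pure-+`; together
  -- they let products of values respect the tensor congruence.
  ∏-homogeneous : ∀ {n} (i : Fin n) {a} {w u : Fin n → Carrier} → w i ≈ a * u i →
                  (∀ k → k ≢ i → w k ≈ u k) → ∏ w ≈ a * ∏ u
  ∏-homogeneous zero e o =
    trans (*-cong e (∏-cong λ k → o (suc k) λ ())) (*-assoc _ _ _)
  ∏-homogeneous (suc i) {a} {w} {u} e o =
    trans (*-cong (o zero λ ()) (∏-homogeneous i e λ k k≢i → o (suc k) λ { ≡.refl → k≢i ≡.refl }))
          (solve 3 (λ x a y → x :* (a :* y) := a :* (x :* y)) refl (u zero) a _)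

  ∏-additive : ∀ {n} (i : Fin n) {w u v : Fin n → Carrier} → w i ≈ u i + v i →
               (∀ k → k ≢ i → w k ≈ u k × w k ≈ v k) → ∏ w ≈ ∏ u + ∏ v
  ∏-additive zero {w} {u} {v} e o = trans (*-congʳ e) (trans (distribʳ _ _ _)
    (+-cong (*-congˡ (∏-cong λ k → proj₁ (o (suc k) λ ())))
            (*-congˡ (∏-cong λ k → proj₂ (o (suc k) λ ())))))
  ∏-additive (suc i) {w} {u} {v} e o =
    trans (*-congˡ (∏-additive i e λ k k≢i → o (suc k) λ { ≡.refl → k≢i ≡.refl }))
      (trans (distribˡ _ _ _)
        (+-cong (*-congʳ (proj₁ (o zero λ ()))) (*-congʳ (proj₂ (o zero λ ())))))

  -- Restricts a product over all slots to a subset: slots outside contribute the factor 1.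
  mask : Bool → Carrier → Carrier
  mask true  x = x
  mask false x = 1#

  except : ∀ {n} → Fin n → (Fin n → Carrier) → Fin n → Carrier
  except i = upd i 1#

  ∏-split : ∀ {n} (i : Fin n) (f : Fin n → Carrier) → ∏ f ≈ f i * ∏ (except i f)
  ∏-split i f = ∏-homogeneous i
    (trans (sym (*-identityʳ _)) (*-congˡ (reflexive (≡.sym (upd-at i 1# f)))))
    λ k k≢i → reflexive (≡.sym (upd-off i 1# f k≢i))

  ∏-except-cong : ∀ {n} (i : Fin n) {f g : Fin n → Carrier} → (∀ k → k ≢ i → f k ≈ g k) →
                  ∏ (except i f) ≈ ∏ (except i g)
  ∏-except-cong i {f} {g} e = ∏-cong pointwise
    where
    pointwise : ∀ k → except i f k ≈ except i g k
    pointwise k with k ≟ i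
    ... | yes ≡.refl = refl
    ... | no k≢i = e k k≢i

-- Coordinates, covectors and lines

module VectorSpaces (K : CommutativeRing 0ℓ 0ℓ) (F : IsInfiniteField K) (em : ExcludedMiddle 0ℓ) where

  open CommutativeRing K hiding (zero)
  open FieldProperties K F em
  open Solver K
  open LinearAlgebra K
  open LinearMap using (⟦_⟧)
  open RawMonoidDefs +-rawMonoid using (sum)
  open SetoidReasoning setoid

  cov-cong : ∀ {V} (ξ : Covector V) {x y} → LeftModule._≈ᴹ_ V x y → ⟦ ξ ⟧ x ≈ ⟦ ξ ⟧ y
  cov-cong ξ = LinearMap.⟦⟧-cong ξ

  cov-+ : ∀ {V} (ξ : Covector V) x y → ⟦ ξ ⟧ (LeftModule._+ᴹ_ V x y) ≈ ⟦ ξ ⟧ x + ⟦ ξ ⟧ y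
  cov-+ ξ = LinearMap.+ᴹ-homo ξ

  cov-* : ∀ {V} (ξ : Covector V) a x → ⟦ ξ ⟧ (LeftModule._*ₗ_ V a x) ≈ a * ⟦ ξ ⟧ x
  cov-* ξ = LinearMap.*ₗ-homo ξ

  cov-0 : ∀ {V} (ξ : Covector V) → ⟦ ξ ⟧ (LeftModule.0ᴹ V) ≈ 0#
  cov-0 ξ = LinearMap.0ᴹ-homo ξ

  composite : ∀ {U V W} → LinearMap V W → LinearMap U V → LinearMap U W
  composite {U} {V} {W} g f = mkLinearMap (λ u → ⟦ g ⟧ (⟦ f ⟧ u))
    (λ e → LinearMap.⟦⟧-cong g (LinearMap.⟦⟧-cong f e))
    (λ x y → W.≈ᴹ-trans (LinearMap.⟦⟧-cong g (LinearMap.+ᴹ-homo f x y)) (LinearMap.+ᴹ-homo g _ _))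
    (λ c x → W.≈ᴹ-trans (LinearMap.⟦⟧-cong g (LinearMap.*ₗ-homo f c x)) (LinearMap.*ₗ-homo g c _))
    where module W = LeftModule W

  module _ (V : VectorSpace K) where
    open LeftModule V
    private module ΣV = RawMonoidDefs +ᴹ-rawMonoid

    msum : ∀ {n} → (Fin n → ∥ V ∥) → ∥ V ∥
    msum = ΣV.sum

    msum-cong : ∀ {n} {f g : Fin n → ∥ V ∥} → (∀ i → f i ≈ᴹ g i) → msum f ≈ᴹ msum g
    msum-cong {zero}  e = ≈ᴹ-refl
    msum-cong {suc n} e = +ᴹ-cong (e zero) (msum-cong (e ∘ suc))

    linearCombination-cong : ∀ {n} {c d : Fin n → Carrier} (b : Fin n → ∥ V ∥) → (∀ i → c i ≈ d i) →
                             linearCombination V c b ≈ᴹ linearCombination V d b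
    linearCombination-cong b e = msum-cong λ i → *ₗ-congʳ (e i)

    linearCombination-+ : ∀ {n} (c d : Fin n → Carrier) (b : Fin n → ∥ V ∥) →
      linearCombination V (λ i → c i + d i) b ≈ᴹ linearCombination V c b +ᴹ linearCombination V d b
    linearCombination-+ c d b =
      ≈ᴹ-trans (msum-cong λ i → *ₗ-distribʳ (b i) (c i) (d i))
               (CommutativeMonoidSum.∑-distrib-+ +ᴹ-commutativeMonoid (λ i → c i *ₗ b i) (λ i → d i *ₗ b i))

    linearCombination-* : ∀ {n} a (c : Fin n → Carrier) (b : Fin n → ∥ V ∥) →
      linearCombination V (λ i → a * c i) b ≈ᴹ a *ₗ linearCombination V c b
    linearCombination-* {zero}  a c b = ≈ᴹ-sym (*ₗ-zeroʳ a)
    linearCombination-* {suc n} a c b =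
      ≈ᴹ-trans (+ᴹ-cong (*ₗ-assoc a _ _) (linearCombination-* a (c ∘ suc) (b ∘ suc)))
               (≈ᴹ-sym (*ₗ-distribˡ a _ _))

    neg-*ₗ : ∀ x → (- 1#) *ₗ x +ᴹ x ≈ᴹ 0ᴹ
    neg-*ₗ x = ≈ᴹ-trans (+ᴹ-congˡ (≈ᴹ-sym (*ₗ-identityˡ x)))
      (≈ᴹ-trans (≈ᴹ-sym (*ₗ-distribʳ x (- 1#) 1#)) (≈ᴹ-trans (*ₗ-congʳ (-‿inverseˡ 1#)) (*ₗ-zeroˡ x)))

    msum-basis : ∀ {n} (i : Fin n) (c : Fin n → Carrier) (b : Fin n → ∥ V ∥) →
      c i ≈ 1# → (∀ k → k ≢ i → c k ≈ 0#) → linearCombination V c b ≈ᴹ b i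
    msum-basis zero c b e o = ≈ᴹ-trans
      (+ᴹ-cong (≈ᴹ-trans (*ₗ-congʳ e) (*ₗ-identityˡ _)) (zeros (λ k → o (suc k) λ ()))) (+ᴹ-identityʳ _)
      where
      zeros : ∀ {n} {c : Fin n → Carrier} {b : Fin n → ∥ V ∥} → (∀ k → c k ≈ 0#) → linearCombination V c b ≈ᴹ 0ᴹ
      zeros {zero}  z = ≈ᴹ-refl
      zeros {suc n} z = ≈ᴹ-trans (+ᴹ-cong (≈ᴹ-trans (*ₗ-congʳ (z zero)) (*ₗ-zeroˡ _)) (zeros (z ∘ suc))) (+ᴹ-identityˡ _)
    msum-basis (suc i) c b e o = ≈ᴹ-trans
      (+ᴹ-cong (≈ᴹ-trans (*ₗ-congʳ (o zero λ ())) (*ₗ-zeroˡ _))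
               (msum-basis i (c ∘ suc) (b ∘ suc) e λ k k≢i → o (suc k) λ { ≡.refl → k≢i ≡.refl }))
      (+ᴹ-identityˡ _)

  module _ {V W : VectorSpace K} (L : LinearMap V W) where
    private
      module V = LeftModule V
      module W = LeftModule W

    map-msum : ∀ {n} (f : Fin n → ∥ V ∥) → ⟦ L ⟧ (msum V f) W.≈ᴹ msum W (⟦ L ⟧ ∘ f)
    map-msum {zero}  f = LinearMap.0ᴹ-homo L
    map-msum {suc n} f = W.≈ᴹ-trans (LinearMap.+ᴹ-homo L _ _) (W.+ᴹ-congˡ (map-msum (f ∘ suc)))

    map-linearCombination : ∀ {n} (c : Fin n → Carrier) (b : Fin n → ∥ V ∥) →
      ⟦ L ⟧ (linearCombination V c b) W.≈ᴹ linearCombination W c (⟦ L ⟧ ∘ b)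
    map-linearCombination c b =
      W.≈ᴹ-trans (map-msum (λ i → c i V.*ₗ b i)) (msum-cong W λ i → LinearMap.*ₗ-homo L (c i) (b i))

  record Basis (V : VectorSpace K) (n : ℕ) : Set where
    constructor mkBasis
    field
      dimension : Dimension V n

  module _ {V : VectorSpace K} {n : ℕ} (D : Basis V n) where
    open LeftModule V
    open Basis D

    basis : Fin n → ∥ V ∥
    basis = proj₁ dimension

    private
      coefficients : ∥ V ∥ → Fin n → Carrier
      coefficients x = proj₁ (proj₂ (proj₂ (proj₂ dimension)) x tt)

    expand′ : ∀ x → x ≈ᴹ linearCombination V (coefficients x) basis
    expand′ x = proj₂ (proj₂ (proj₂ (proj₂ dimension)) x tt)

    linearCombination-unique : ∀ {c d : Fin n → Carrier} →
      linearCombination V c basis ≈ᴹ linearCombination V d basis → ∀ i → c i ≈ d i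
    linearCombination-unique {c} {d} e i = sym (difference-zero (trans (+-comm _ _)
      (trans (+-congʳ (solve 1 (λ x → :- x := (:- :1) :* x) refl (c i)))
        (proj₁ (proj₂ (proj₂ dimension)) (λ i → - 1# * c i + d i)
        (≈ᴹ-trans (linearCombination-+ V (λ i → - 1# * c i) d basis)
          (≈ᴹ-trans (+ᴹ-cong (linearCombination-* V (- 1#) c basis) (≈ᴹ-sym e)) (neg-*ₗ V _))) i))))

    -- The dual basis. Linearity comes from the uniqueness of coefficients.
    coordinate : Fin n → Covector V
    coordinate k = mkLinearMap (λ x → coefficients x k)
      (λ {x} {y} e → linearCombination-unique
        (≈ᴹ-trans (≈ᴹ-sym (expand′ x)) (≈ᴹ-trans e (expand′ y))) k)
      (λ x y → linearCombination-unique
        (≈ᴹ-trans (≈ᴹ-sym (expand′ (x +ᴹ y)))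
          (≈ᴹ-trans (+ᴹ-cong (expand′ x) (expand′ y))
                    (≈ᴹ-sym (linearCombination-+ V (coefficients x) (coefficients y) basis)))) k)
      (λ a x → linearCombination-unique
        (≈ᴹ-trans (≈ᴹ-sym (expand′ (a *ₗ x)))
          (≈ᴹ-trans (*ₗ-congˡ (expand′ x)) (≈ᴹ-sym (linearCombination-* V a (coefficients x) basis)))) k)

    expand : ∀ x → x ≈ᴹ linearCombination V (λ k → ⟦ coordinate k ⟧ x) basis
    expand = expand′

    coordinate-combination : ∀ c k → ⟦ coordinate k ⟧ (linearCombination V c basis) ≈ c k
    coordinate-combination c = linearCombination-unique (≈ᴹ-sym (expand _))

    coordinate-same : ∀ k → ⟦ coordinate k ⟧ (basis k) ≈ 1#
    coordinate-same k = trans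
      (cov-cong (coordinate k) (≈ᴹ-sym (msum-basis V k δ basis (reflexive (upd-at k 1# _)) λ l l≢k → reflexive (upd-off k 1# _ l≢k))))
      (trans (coordinate-combination δ k) (reflexive (upd-at k 1# _)))
      where
      δ : Fin n → Carrier
      δ = upd k 1# (λ _ → 0#)

    coordinate-other : ∀ {k l} → l ≢ k → ⟦ coordinate l ⟧ (basis k) ≈ 0#
    coordinate-other {k} {l} l≢k = trans
      (cov-cong (coordinate l) (≈ᴹ-sym (msum-basis V k δ basis (reflexive (upd-at k 1# _)) λ l l≢k → reflexive (upd-off k 1# _ l≢k))))
      (trans (coordinate-combination δ l) (reflexive (upd-off k 1# _ l≢k)))
      where
      δ : Fin n → Carrier
      δ = upd k 1# (λ _ → 0#)

    coordinates-separate : ∀ {x y} → (∀ k → ⟦ coordinate k ⟧ x ≈ ⟦ coordinate k ⟧ y) → x ≈ᴹ y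
    coordinates-separate {x} {y} e =
      ≈ᴹ-trans (expand x) (≈ᴹ-trans (linearCombination-cong V basis e) (≈ᴹ-sym (expand y)))

    coordinates-zero : ∀ {x} → (∀ k → ⟦ coordinate k ⟧ x ≈ 0#) → x ≈ᴹ 0ᴹ
    coordinates-zero e = coordinates-separate λ k → trans (e k) (sym (cov-0 (coordinate k)))

    nonzero-coordinate : ∀ {x} → NonZero V x → ∃[ k ] ¬ (⟦ coordinate k ⟧ x ≈ 0#)
    nonzero-coordinate {x} x≉0 = nonzero-member (λ k → ⟦ coordinate k ⟧ x) (x≉0 ∘ coordinates-zero)

    normalized-covector : ∀ {x} → NonZero V x → Σ (Covector V) λ μ → ⟦ μ ⟧ x ≈ 1#
    normalized-covector {x} x≉0 with nonzero-coordinate x≉0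
    ... | k , a≉0 with inverse (⟦ coordinate k ⟧ x) a≉0
    ...   | y , ay = LeftModule._*ₗ_ (Dual V) y (coordinate k) , trans (*-comm _ _) ay

    -- The factor is the quotient of the coordinates at an index where `y` is nonzero. Minors are
    -- used because their vanishing is a polynomial condition, which extends from generic points to
    -- all points.
    proportional : ∀ {x y} → NonZero V x → NonZero V y →
      (∀ k l → ⟦ coordinate k ⟧ x * ⟦ coordinate l ⟧ y ≈ ⟦ coordinate l ⟧ x * ⟦ coordinate k ⟧ y) →
      SameLine V x y
    proportional {x} {y} x≉0 y≉0 minors with nonzero-coordinate y≉0
    ... | l , y_l≉0 with inverse (⟦ coordinate l ⟧ y) y_l≉0
    ...   | z , yz = c , c≉0 , x≈cy
      where
      c = ⟦ coordinate l ⟧ x * z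
      x≈cy : x ≈ᴹ c *ₗ y
      x≈cy = coordinates-separate λ k → begin
        ⟦ coordinate k ⟧ x                                   ≈⟨ *-identityʳ _ ⟨
        ⟦ coordinate k ⟧ x * 1#                              ≈⟨ *-congˡ yz ⟨
        ⟦ coordinate k ⟧ x * (⟦ coordinate l ⟧ y * z)        ≈⟨ *-assoc _ _ _ ⟨
        (⟦ coordinate k ⟧ x * ⟦ coordinate l ⟧ y) * z        ≈⟨ *-congʳ (minors k l) ⟩
        (⟦ coordinate l ⟧ x * ⟦ coordinate k ⟧ y) * z
          ≈⟨ solve 3 (λ a b c → (a :* b) :* c := (a :* c) :* b) refl _ _ _ ⟩
        c * ⟦ coordinate k ⟧ y                               ≈⟨ cov-* (coordinate k) c y ⟨
        ⟦ coordinate k ⟧ (c *ₗ y) ∎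
      c≉0 : ¬ (c ≈ 0#)
      c≉0 c≈0 = x≉0 (≈ᴹ-trans x≈cy (≈ᴹ-trans (*ₗ-congʳ c≈0) (*ₗ-zeroˡ y)))

  module _ (V : VectorSpace K) where
    open LeftModule V

    sameLine-sym : ∀ {x y} → SameLine V x y → SameLine V y x
    sameLine-sym {x} {y} (c , c≉0 , e) with inverse c c≉0
    ... | d , cd = d , inverse-nonzero cd , ≈ᴹ-sym (≈ᴹ-trans (*ₗ-congˡ e)
      (≈ᴹ-trans (≈ᴹ-sym (*ₗ-assoc d c y)) (≈ᴹ-trans (*ₗ-congʳ (trans (*-comm d c) cd)) (*ₗ-identityˡ y))))

    sameLine-trans : ∀ {x y z} → SameLine V x y → SameLine V y z → SameLine V x z
    sameLine-trans {x} {y} {z} (c , c≉0 , e) (d , d≉0 , e′) =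
      c * d , *-nonzero c≉0 d≉0 , ≈ᴹ-trans e (≈ᴹ-trans (*ₗ-congˡ e′) (≈ᴹ-sym (*ₗ-assoc c d z)))

    sameLine-reflexive : ∀ {x y} → x ≈ᴹ y → SameLine V x y
    sameLine-reflexive e = 1# , 1≉0 , ≈ᴹ-trans e (≈ᴹ-sym (*ₗ-identityˡ _))

  module _ {V : VectorSpace K} (D : Basis V 2) where
    open LeftModule V

    expand₂ : ∀ x → x ≈ᴹ ⟦ coordinate D 0F ⟧ x *ₗ basis D 0F +ᴹ ⟦ coordinate D 1F ⟧ x *ₗ basis D 1F
    expand₂ x = ≈ᴹ-trans (expand D x) (+ᴹ-congˡ (+ᴹ-identityʳ _))

    covector-expand₂ : ∀ (α : Covector V) x →
      ⟦ α ⟧ x ≈ ⟦ α ⟧ (basis D 0F) * ⟦ coordinate D 0F ⟧ x + ⟦ α ⟧ (basis D 1F) * ⟦ coordinate D 1F ⟧ x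
    covector-expand₂ α x = trans (cov-cong α (expand₂ x)) (trans (cov-+ α _ _)
      (+-cong (trans (cov-* α _ _) (*-comm _ _)) (trans (cov-* α _ _) (*-comm _ _))))

    coordinate-combination₂ : ∀ a b → ⟦ coordinate D 0F ⟧ (a *ₗ basis D 0F +ᴹ b *ₗ basis D 1F) ≈ a ×
                                      ⟦ coordinate D 1F ⟧ (a *ₗ basis D 0F +ᴹ b *ₗ basis D 1F) ≈ b
    coordinate-combination₂ a b = at 0F , at 1F
      where
      c : Fin 2 → Carrier
      c 0F = a
      c 1F = b
      at : ∀ k → ⟦ coordinate D k ⟧ (a *ₗ basis D 0F +ᴹ b *ₗ basis D 1F) ≈ c k
      at k = trans (cov-cong (coordinate D k) (+ᴹ-congˡ (≈ᴹ-sym (+ᴹ-identityʳ _))))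
                   (coordinate-combination D c k)

    basis-nonzero : ∀ k → NonZero V (basis D k)
    basis-nonzero k e = 0≉1 (trans (sym (cov-0 (coordinate D k)))
      (trans (cov-cong (coordinate D k) (≈ᴹ-sym e)) (coordinate-same D k)))

    map₂ : ∀ {U} → Covector U → Covector U → LinearMap U V
    map₂ ξ η = mkLinearMap (λ u → ⟦ ξ ⟧ u *ₗ basis D 0F +ᴹ ⟦ η ⟧ u *ₗ basis D 1F)
      (λ e → +ᴹ-cong (*ₗ-congʳ (cov-cong ξ e)) (*ₗ-congʳ (cov-cong η e)))
      (λ x y → coordinates-separate D (both
        (trans (proj₁ (coordinate-combination₂ _ _)) (trans (cov-+ ξ x y) (sym (trans (cov-+ (coordinate D 0F) _ _)
          (+-cong (proj₁ (coordinate-combination₂ _ _)) (proj₁ (coordinate-combination₂ _ _)))))))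
        (trans (proj₂ (coordinate-combination₂ _ _)) (trans (cov-+ η x y) (sym (trans (cov-+ (coordinate D 1F) _ _)
          (+-cong (proj₂ (coordinate-combination₂ _ _)) (proj₂ (coordinate-combination₂ _ _)))))))))
      (λ c x → coordinates-separate D (both
        (trans (proj₁ (coordinate-combination₂ _ _)) (trans (cov-* ξ c x) (sym (trans (cov-* (coordinate D 0F) c _)
          (*-congˡ (proj₁ (coordinate-combination₂ _ _)))))))
        (trans (proj₂ (coordinate-combination₂ _ _)) (trans (cov-* η c x) (sym (trans (cov-* (coordinate D 1F) c _)
          (*-congˡ (proj₂ (coordinate-combination₂ _ _)))))))))
      where
      both : ∀ {P : Fin 2 → Set} → P 0F → P 1F → ∀ k → P k
      both p q 0F = p
      both p q 1F = q

-- Coordinates of tensors and the subspaces Σ⁰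

module Tensors (K : CommutativeRing 0ℓ 0ℓ) (F : IsInfiniteField K) (em : ExcludedMiddle 0ℓ) where

  open CommutativeRing K hiding (zero)
  open FieldProperties K F em
  open Solver K
  open Products K
  open LinearAlgebra K
  open LinearMap using (⟦_⟧)
  open VectorSpaces K F em
  open RawMonoidDefs +-rawMonoid using (sum)
  open SetoidReasoning setoid

  Index : ℕ → Set
  Index m = Vec (Fin 2) m

  module _ (W : VectorSpace K) where
    open LeftModule W

    indexSum : ∀ {m} → (Index m → ∥ W ∥) → ∥ W ∥
    indexSum {zero}  f = f []
    indexSum {suc m} f = indexSum (λ s → f (0F ∷ s)) +ᴹ indexSum (λ s → f (1F ∷ s))

    indexSum-cong : ∀ {m} {f g : Index m → ∥ W ∥} → (∀ s → f s ≈ᴹ g s) → indexSum f ≈ᴹ indexSum g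
    indexSum-cong {zero}  e = e []
    indexSum-cong {suc m} e = +ᴹ-cong (indexSum-cong λ s → e (0F ∷ s)) (indexSum-cong λ s → e (1F ∷ s))

    indexSum-+ : ∀ {m} (f g : Index m → ∥ W ∥) → indexSum (λ s → f s +ᴹ g s) ≈ᴹ indexSum f +ᴹ indexSum g
    indexSum-+ {zero}  f g = ≈ᴹ-refl
    indexSum-+ {suc m} f g = ≈ᴹ-trans
      (+ᴹ-cong (indexSum-+ (λ s → f (0F ∷ s)) (λ s → g (0F ∷ s))) (indexSum-+ (λ s → f (1F ∷ s)) (λ s → g (1F ∷ s))))
      (CommutativeSemigroupProperties.interchange
        (CommutativeMonoid.commutativeSemigroup +ᴹ-commutativeMonoid) _ _ _ _)

    indexSum-* : ∀ {m} a (f : Index m → ∥ W ∥) → indexSum (λ s → a *ₗ f s) ≈ᴹ a *ₗ indexSum f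
    indexSum-* {zero}  a f = ≈ᴹ-refl
    indexSum-* {suc m} a f = ≈ᴹ-trans
      (+ᴹ-cong (indexSum-* a (λ s → f (0F ∷ s))) (indexSum-* a (λ s → f (1F ∷ s)))) (≈ᴹ-sym (*ₗ-distribˡ a _ _))

    indexSum-0 : ∀ {m} → indexSum {m} (λ s → 0ᴹ) ≈ᴹ 0ᴹ
    indexSum-0 {zero}  = ≈ᴹ-refl
    indexSum-0 {suc m} = ≈ᴹ-trans (+ᴹ-cong (indexSum-0 {m}) (indexSum-0 {m})) (+ᴹ-identityˡ _)

  record IsMultilinear {m} (V : Fin m → VectorSpace K) (W : VectorSpace K)
                       (P : (∀ r → Covector (V r)) → ∥ W ∥) : Set where
    private
      module W = LeftModule W
      module D r = LeftModule (Dual (V r))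
    field
      cong   : ∀ {w u} → (∀ r → D._≈ᴹ_ r (w r) (u r)) → P w W.≈ᴹ P u
      additive : ∀ i {w u v} → D._≈ᴹ_ i (w i) (D._+ᴹ_ i (u i) (v i)) →
                 (∀ k → k ≢ i → D._≈ᴹ_ k (w k) (u k) × D._≈ᴹ_ k (w k) (v k)) → P w W.≈ᴹ P u W.+ᴹ P v
      homogeneous : ∀ i a {w u} → D._≈ᴹ_ i (w i) (D._*ₗ_ i a (u i)) →
                    (∀ k → k ≢ i → D._≈ᴹ_ k (w k) (u k)) → P w W.≈ᴹ a W.*ₗ P u

  private
    cons : ∀ {m} {A : Fin (suc m) → Set} → A zero → (∀ r → A (suc r)) → ∀ r → A r
    cons x f zero    = x
    cons x f (suc r) = f r

  multilinear-tail : ∀ {m} {V : Fin (suc m) → VectorSpace K} {W} {P} → IsMultilinear V W P →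
                     ∀ α → IsMultilinear (V ∘ suc) W (λ w → P (cons α w))
  multilinear-tail M α = record
    { cong = λ e → M.cong λ { zero v → refl ; (suc r) → e r }
    ; additive = λ i e o → M.additive (suc i) e
        λ { zero _ → (λ v → refl) , (λ v → refl) ; (suc k) k≢i → o k λ { ≡.refl → k≢i ≡.refl } }
    ; homogeneous = λ i a e o → M.homogeneous (suc i) a e
        λ { zero _ v → refl ; (suc k) k≢i → o k λ { ≡.refl → k≢i ≡.refl } }
    }
    where module M = IsMultilinear M

  dualBasis : ∀ {m} {V : Fin m → VectorSpace K} (D : ∀ r → Basis (V r) 2) → Index m → ∀ r → Covector (V r)
  dualBasis D s r = coordinate (D r) (lookup s r)

  -- Induction on the number of slots: the covector in slot zero is written in the dual basis, and
  -- the remaining slots are expanded with that basis covector held fixed.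
  multilinear-expand : ∀ {m} {V : Fin m → VectorSpace K} {W} (D : ∀ r → Basis (V r) 2) {P} →
    IsMultilinear V W P → ∀ α →
    LeftModule._≈ᴹ_ W (P α)
      (indexSum W λ s → LeftModule._*ₗ_ W (∏ λ r → ⟦ α r ⟧ (basis (D r) (lookup s r))) (P (dualBasis D s)))
  multilinear-expand {zero} {W = W} D M α =
    W.≈ᴹ-trans (M.cong {α} {dualBasis D []} λ ()) (W.≈ᴹ-sym (W.*ₗ-identityˡ _))
    where
    module W = LeftModule W
    module M = IsMultilinear M
  multilinear-expand {suc m} {V} {W} D {P} M α =
    W.≈ᴹ-trans (M.additive zero {w = α} {u = cons u (α ∘ suc)} {v = cons v (α ∘ suc)}
                 (covector-expand₂ (D zero) (α zero))
                 λ { zero 0≢0 → ⊥-elim (0≢0 ≡.refl) ; (suc k) _ → (λ x → refl) , (λ x → refl) })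
      (W.+ᴹ-cong (part 0F) (part 1F))
    where
    module W = LeftModule W
    module M = IsMultilinear M
    u v : Covector (V zero)
    u = LeftModule._*ₗ_ (Dual (V zero)) (⟦ α zero ⟧ (basis (D zero) 0F)) (coordinate (D zero) 0F)
    v = LeftModule._*ₗ_ (Dual (V zero)) (⟦ α zero ⟧ (basis (D zero) 1F)) (coordinate (D zero) 1F)
    part : ∀ c → P (cons (LeftModule._*ₗ_ (Dual (V zero)) (⟦ α zero ⟧ (basis (D zero) c)) (coordinate (D zero) c)) (α ∘ suc))
             W.≈ᴹ indexSum W (λ s → (∏ λ r → ⟦ α r ⟧ (basis (D r) (lookup (c ∷ s) r))) W.*ₗ P (dualBasis D (c ∷ s)))
    part c =
      W.≈ᴹ-trans (M.homogeneous zero x {w = cons (LeftModule._*ₗ_ (Dual (V zero)) x ξ) α′} {u = cons ξ α′}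
                   (λ _ → refl) λ { zero 0≢0 → ⊥-elim (0≢0 ≡.refl) ; (suc k) _ _ → refl })
      (W.≈ᴹ-trans (W.*ₗ-congˡ (multilinear-expand (D ∘ suc) (multilinear-tail M ξ) α′))
      (W.≈ᴹ-trans (W.≈ᴹ-sym (indexSum-* W x (λ s → y s W.*ₗ P (cons ξ (dualBasis (D ∘ suc) s)))))
      (indexSum-cong W λ s → W.≈ᴹ-trans (W.≈ᴹ-sym (W.*ₗ-assoc x (y s) _))
        (W.*ₗ-congˡ (M.cong {cons ξ (dualBasis (D ∘ suc) s)} {dualBasis D (c ∷ s)}
          λ { zero _ → refl ; (suc r) _ → refl })))))
      where
      x = ⟦ α zero ⟧ (basis (D zero) c)
      ξ = coordinate (D zero) c
      α′ = α ∘ suc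
      y : Index m → Carrier
      y s = ∏ λ r → ⟦ α′ r ⟧ (basis (D (suc r)) (lookup s r))

  module _ {m : ℕ} {V : Fin m → VectorSpace K} where
    private module T = LeftModule (V* V)

    -- The pairing with the vectors `x`, defined on representatives. It is the source of all linear
    -- functionals on tensors, and so the means to tell tensors apart.
    evaluate : (∀ r → ∥ V r ∥) → ∥ V* V ∥ → Carrier
    evaluate x (pure α) = ∏ λ r → ⟦ α r ⟧ (x r)
    evaluate x 𝟘        = 0#
    evaluate x (s ⊕ t)  = evaluate x s + evaluate x t
    evaluate x (a ⊙ t)  = a * evaluate x t

    evaluate-cong : ∀ x {s t} → s T.≈ᴹ t → evaluate x s ≈ evaluate x t
    evaluate-cong x ≋-refl             = refl
    evaluate-cong x (≋-sym p)          = sym (evaluate-cong x p)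
    evaluate-cong x (≋-trans p q)      = trans (evaluate-cong x p) (evaluate-cong x q)
    evaluate-cong x (⊕-cong p q)       = +-cong (evaluate-cong x p) (evaluate-cong x q)
    evaluate-cong x (⊕-assoc s t u)    = +-assoc _ _ _
    evaluate-cong x (⊕-comm s t)       = +-comm _ _
    evaluate-cong x (⊕-identityˡ s)    = +-identityˡ _
    evaluate-cong x (⊙-cong e p)       = *-cong e (evaluate-cong x p)
    evaluate-cong x (⊙-assoc a b s)    = *-assoc _ _ _
    evaluate-cong x (⊙-identityˡ s)    = *-identityˡ _
    evaluate-cong x (⊙-zeroˡ s)        = zeroˡ _
    evaluate-cong x (⊙-distribʳ s a b) = distribʳ _ _ _
    evaluate-cong x (⊙-distribˡ a s t) = distribˡ _ _ _
    evaluate-cong x (pure-cong e)      = ∏-cong λ r → e r (x r)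
    evaluate-cong x (pure-+ i e o)     =
      ∏-additive i (e (x i)) λ k k≢i → proj₁ (o k k≢i) (x k) , proj₂ (o k k≢i) (x k)
    evaluate-cong x (pure-* i a e o)   = ∏-homogeneous i (e (x i)) λ k k≢i → o k k≢i (x k)

  module Coordinates {m : ℕ} {V : Fin m → VectorSpace K} (D : ∀ r → Basis (V r) 2) where
    private module T = LeftModule (V* V)

    corner : Index m → ∀ r → ∥ V r ∥
    corner s r = basis (D r) (lookup s r)

    coord : Index m → Covector (V* V)
    coord s = mkLinearMap (evaluate (corner s)) (evaluate-cong (corner s)) (λ _ _ → refl) (λ _ _ → refl)

    tensor-expand : ∀ t → t T.≈ᴹ indexSum (V* V) (λ s → ⟦ coord s ⟧ t ⊙ pure (dualBasis D s))
    tensor-expand (pure α) = multilinear-expand {W = V* V} D {P = pure}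
      (record { cong = pure-cong ; additive = pure-+ ; homogeneous = pure-* }) α
    tensor-expand 𝟘 = ≋-sym (≋-trans (indexSum-cong (V* V) {m} λ s → ⊙-zeroˡ _) (indexSum-0 (V* V) {m}))
    tensor-expand (s ⊕ t) = ≋-trans (⊕-cong (tensor-expand s) (tensor-expand t))
      (≋-trans (≋-sym (indexSum-+ (V* V) (λ k → ⟦ coord k ⟧ s ⊙ pure (dualBasis D k)) (λ k → ⟦ coord k ⟧ t ⊙ pure (dualBasis D k))))
               (indexSum-cong (V* V) {m} λ k → ≋-sym (⊙-distribʳ (pure (dualBasis D k)) (⟦ coord k ⟧ s) (⟦ coord k ⟧ t))))
    tensor-expand (a ⊙ t) = ≋-trans (⊙-cong refl (tensor-expand t))
      (≋-trans (≋-sym (indexSum-* (V* V) a (λ k → ⟦ coord k ⟧ t ⊙ pure (dualBasis D k))))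
               (indexSum-cong (V* V) {m} λ k → ≋-sym (⊙-assoc a (⟦ coord k ⟧ t) (pure (dualBasis D k)))))

    -- Both tensors are, by `tensor-expand`, the same combination of pure dual basis tensors. This
    -- reduces the congruence `_≋_`, which is only generated by rules, to equality of numbers.
    tensor-ext : ∀ {s t} → (∀ i → ⟦ coord i ⟧ s ≈ ⟦ coord i ⟧ t) → s T.≈ᴹ t
    tensor-ext {s} {t} e = ≋-trans (tensor-expand s)
      (≋-trans (indexSum-cong (V* V) {m} λ i → ⊙-cong (e i) ≋-refl) (≋-sym (tensor-expand t)))

    -- The coordinates of the contraction of a tensor with v in slot j; they
    -- do not depend on the j-th entry of the index.
    contract : (j : Fin m) → ∥ V j ∥ → (Index m → Carrier) → Index m → Carrier
    contract j v a s = ⟦ coordinate (D j) 0F ⟧ v * a (s [ j ]≔ 0F) + ⟦ coordinate (D j) 1F ⟧ v * a (s [ j ]≔ 1F)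

    contract-cong : ∀ j v {a a′} → (∀ s → a s ≈ a′ s) → ∀ s → contract j v a s ≈ contract j v a′ s
    contract-cong j v e s = +-cong (*-congˡ (e _)) (*-congˡ (e _))

    contract-+ : ∀ j v a a′ s → contract j v (λ s → a s + a′ s) s ≈ contract j v a s + contract j v a′ s
    contract-+ j v a a′ s = solve 6 (λ x y p q r t → x :* (p :+ q) :+ y :* (r :+ t) := (x :* p :+ y :* r) :+ (x :* q :+ y :* t))
      refl (⟦ coordinate (D j) 0F ⟧ v) (⟦ coordinate (D j) 1F ⟧ v) (a (s [ j ]≔ 0F)) (a′ (s [ j ]≔ 0F)) (a (s [ j ]≔ 1F)) (a′ (s [ j ]≔ 1F))

    contract-* : ∀ j v c a s → contract j v (λ s → c * a s) s ≈ c * contract j v a s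
    contract-* j v c a s = solve 5 (λ x y c p r → x :* (c :* p) :+ y :* (c :* r) := c :* (x :* p :+ y :* r))
      refl (⟦ coordinate (D j) 0F ⟧ v) (⟦ coordinate (D j) 1F ⟧ v) c (a (s [ j ]≔ 0F)) (a (s [ j ]≔ 1F))

    contract-congᵛ : ∀ j {v w} → LeftModule._≈ᴹ_ (V j) v w → ∀ a s → contract j v a s ≈ contract j w a s
    contract-congᵛ j e a s = +-cong (*-congʳ (cov-cong (coordinate (D j) 0F) e)) (*-congʳ (cov-cong (coordinate (D j) 1F) e))

    coords : ∥ V* V ∥ → Index m → Carrier
    coords t s = ⟦ coord s ⟧ t

    private
      off : (α : ∀ r → Covector (V r)) → Fin m → Index m → Carrier
      off α j s = ∏ (except j λ r → ⟦ α r ⟧ (corner s r))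

      coord-pure : ∀ α j s → coords (pure α) s ≈ ⟦ α j ⟧ (corner s j) * off α j s
      coord-pure α j s = ∏-split j λ r → ⟦ α r ⟧ (corner s r)

      coord-pure-at : ∀ α j s c → coords (pure α) (s [ j ]≔ c) ≈ ⟦ α j ⟧ (basis (D j) c) * off α j s
      coord-pure-at α j s c = trans (coord-pure α j (s [ j ]≔ c)) (*-cong
        (cov-cong (α j) (LeftModule.≈ᴹ-reflexive (V j) (≡.cong (basis (D j)) (lookup∘update j s c))))
        (∏-except-cong j λ k k≢j → cov-cong (α k)
          (LeftModule.≈ᴹ-reflexive (V k) (≡.cong (basis (D k)) (lookup∘update′ k≢j s c)))))

    contract-pure : ∀ j v α s → contract j v (coords (pure α)) s ≈ ⟦ α j ⟧ v * off α j s
    contract-pure j v α s = begin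
      ⟦ coordinate (D j) 0F ⟧ v * coords (pure α) (s [ j ]≔ 0F) + ⟦ coordinate (D j) 1F ⟧ v * coords (pure α) (s [ j ]≔ 1F)
        ≈⟨ +-cong (*-congˡ (coord-pure-at α j s 0F)) (*-congˡ (coord-pure-at α j s 1F)) ⟩
      ⟦ coordinate (D j) 0F ⟧ v * (⟦ α j ⟧ (basis (D j) 0F) * off α j s) + ⟦ coordinate (D j) 1F ⟧ v * (⟦ α j ⟧ (basis (D j) 1F) * off α j s)
        ≈⟨ solve 5 (λ x a p y b → x :* (a :* p) :+ y :* (b :* p) := (a :* x :+ b :* y) :* p) refl
             (⟦ coordinate (D j) 0F ⟧ v) (⟦ α j ⟧ (basis (D j) 0F)) (off α j s) (⟦ coordinate (D j) 1F ⟧ v) (⟦ α j ⟧ (basis (D j) 1F)) ⟩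
      (⟦ α j ⟧ (basis (D j) 0F) * ⟦ coordinate (D j) 0F ⟧ v + ⟦ α j ⟧ (basis (D j) 1F) * ⟦ coordinate (D j) 1F ⟧ v) * off α j s
        ≈⟨ *-congʳ (covector-expand₂ (D j) (α j) v) ⟨
      ⟦ α j ⟧ v * off α j s ∎

    contract-Σ⁰ : ∀ {j v t} → Σ⁰ V j v t → ∀ s → contract j v (coords t) s ≈ 0#
    contract-Σ⁰ {j} {v} (n , α , α⊥v , t≋) s =
      trans (contract-cong j v (λ i → cov-cong (coord i) t≋) s) (sum-contract n α α⊥v)
      where
      sum-contract : ∀ n (α : Fin n → ∀ r → Covector (V r)) → (∀ k → ⟦ α k j ⟧ v ≈ 0#) →
        contract j v (coords (msum (V* V) (λ k → pure (α k)))) s ≈ 0#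
      sum-contract zero α z = solve 2 (λ x y → x :* :0 :+ y :* :0 := :0) refl (⟦ coordinate (D j) 0F ⟧ v) (⟦ coordinate (D j) 1F ⟧ v)
      sum-contract (suc n) α z = trans (contract-+ j v (coords (pure (α zero))) (coords (msum (V* V) (λ k → pure (α (suc k))))) s)
        (trans (+-cong (trans (contract-pure j v (α zero) s) (trans (*-congʳ (z zero)) (zeroˡ _)))
                       (sum-contract n (α ∘ suc) (z ∘ suc))) (+-identityˡ 0#))

    Σ⁰-resp : ∀ j v {s t} → s T.≈ᴹ t → Σ⁰ V j v s → Σ⁰ V j v t
    Σ⁰-resp j v e (n , α , z , p) = n , α , z , ≋-trans (≋-sym e) p

    pureSum : ∀ {n} → (Fin n → ∀ r → Covector (V r)) → ∥ V* V ∥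
    pureSum α = msum (V* V) (λ k → pure (α k))

    Σ⁰-pureSum-⊕ : ∀ j v t n (α : Fin n → ∀ r → Covector (V r)) → (∀ k → ⟦ α k j ⟧ v ≈ 0#) →
                   Σ⁰ V j v t → Σ⁰ V j v (pureSum α ⊕ t)
    Σ⁰-pureSum-⊕ j v t zero    α z q = Σ⁰-resp j v (≋-sym (⊕-identityˡ t)) q
    Σ⁰-pureSum-⊕ j v t (suc n) α z q = prepend (Σ⁰-pureSum-⊕ j v t n (α ∘ suc) (z ∘ suc) q)
      where
      prepend : Σ⁰ V j v (pureSum (α ∘ suc) ⊕ t) → Σ⁰ V j v (pureSum α ⊕ t)
      prepend (k , β , z′ , p) = suc k , α zero Vector.∷ β , (λ { zero → z zero ; (suc i) → z′ i }) ,
        ≋-trans (⊕-assoc (pure (α zero)) (pureSum (α ∘ suc)) t) (⊕-cong ≋-refl p)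

    Σ⁰-⊕ : ∀ j v s t → Σ⁰ V j v s → Σ⁰ V j v t → Σ⁰ V j v (s ⊕ t)
    Σ⁰-⊕ j v s t (n , α , z , p) q = Σ⁰-resp j v (⊕-cong (≋-sym p) ≋-refl) (Σ⁰-pureSum-⊕ j v t n α z q)

    Σ⁰-pure : ∀ j v α → ⟦ α j ⟧ v ≈ 0# → Σ⁰ V j v (pure α)
    Σ⁰-pure j v α z = 1 , (λ _ → α) , (λ _ → z) , ≋-sym (≋-trans (⊕-comm (pure α) 𝟘) (⊕-identityˡ (pure α)))

    -- The scalar is absorbed into slot `j` of every summand, where it preserves annihilation of
    -- `v`.
    Σ⁰-⊙ : ∀ j v t a → Σ⁰ V j v t → Σ⁰ V j v (a ⊙ t)
    Σ⁰-⊙ j v t a (n , α , z , p) = n , (λ k → scaled (α k)) ,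
      (λ k → trans (scaled-at (α k) v) (trans (*-congˡ (z k)) (zeroʳ a))) ,
      ≋-trans (⊙-cong refl p) (scale n α)
      where
      scaled : (∀ r → Covector (V r)) → ∀ r → Covector (V r)
      scaled β = upd j (LeftModule._*ₗ_ (Dual (V j)) a (β j)) β
      scaled-at : ∀ β x → ⟦ scaled β j ⟧ x ≈ a * ⟦ β j ⟧ x
      scaled-at β x = reflexive (≡.cong (λ ξ → ⟦ ξ ⟧ x) (upd-at j (LeftModule._*ₗ_ (Dual (V j)) a (β j)) β))
      scaled-off : ∀ β k → k ≢ j → ∀ x → ⟦ scaled β k ⟧ x ≈ ⟦ β k ⟧ x
      scaled-off β k k≢j x = reflexive (≡.cong (λ ξ → ⟦ ξ ⟧ x) (upd-off j (LeftModule._*ₗ_ (Dual (V j)) a (β j)) β k≢j))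
      scale : ∀ n (α : Fin n → ∀ r → Covector (V r)) → a ⊙ pureSum α T.≈ᴹ pureSum (λ k → scaled (α k))
      scale zero α = T.*ₗ-zeroʳ a
      scale (suc n) α = ≋-trans (⊙-distribˡ a (pure (α zero)) (pureSum (α ∘ suc)))
        (⊕-cong (≋-sym (pure-* j a {scaled (α zero)} {α zero} (scaled-at (α zero)) (scaled-off (α zero)))) (scale n (α ∘ suc)))

    -- With μ(v) = 1, the projection α ↦ α − α(v) μ in slot j maps every tensor
    -- into Σ⁰, and it fixes the tensors whose contraction with v is zero.
    module Projection (j : Fin m) (v : ∥ V j ∥) (μ : Covector (V j)) (μv≈1 : ⟦ μ ⟧ v ≈ 1#) where

      p : Covector (V j) → Covector (V j)
      p α = LeftModule._+ᴹ_ (Dual (V j)) α (LeftModule._*ₗ_ (Dual (V j)) (- ⟦ α ⟧ v) μ)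
      project : ∥ V* V ∥ → ∥ V* V ∥
      project (pure α) = pure (upd j (p (α j)) α)
      project 𝟘 = 𝟘
      project (s ⊕ t) = project s ⊕ project t
      project (a ⊙ t) = a ⊙ project t
      project-Σ⁰ : ∀ t → Σ⁰ V j v (project t)
      project-Σ⁰ (pure α) = Σ⁰-pure j v (upd j (p (α j)) α) (trans (reflexive (≡.cong (λ ξ → ⟦ ξ ⟧ v) (upd-at j (p (α j)) α)))
        (trans (+-congˡ (*-congˡ μv≈1)) (solve 1 (λ x → x :+ (:- x) :* :1 := :0) refl (⟦ α j ⟧ v))))
      project-Σ⁰ 𝟘 = 0 , (λ ()) , (λ ()) , ≋-refl
      project-Σ⁰ (s ⊕ t) = Σ⁰-⊕ j v (project s) (project t) (project-Σ⁰ s) (project-Σ⁰ t)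
      project-Σ⁰ (a ⊙ t) = Σ⁰-⊙ j v (project t) a (project-Σ⁰ t)
      -- The correction is the tensor with `μ` in slot `j` and the contraction of `t` with `v` in
      -- the others. Both sides are linear in `t`, so pure tensors decide.
      coords-project : ∀ t s → coords (project t) s ≈ coords t s + - (⟦ μ ⟧ (corner s j) * contract j v (coords t) s)
      coords-project (pure α) s = begin
        coords (pure (upd j (p (α j)) α)) s
          ≈⟨ coord-pure (upd j (p (α j)) α) j s ⟩
        ⟦ upd j (p (α j)) α j ⟧ (corner s j) * off (upd j (p (α j)) α) j s
          ≈⟨ *-cong (reflexive (≡.cong (λ ξ → ⟦ ξ ⟧ (corner s j)) (upd-at j (p (α j)) α)))
                    (∏-except-cong j λ k k≢j → reflexive (≡.cong (λ ξ → ⟦ ξ ⟧ (corner s k)) (upd-off j (p (α j)) α k≢j))) ⟩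
        (⟦ α j ⟧ (corner s j) + - ⟦ α j ⟧ v * ⟦ μ ⟧ (corner s j)) * off α j s
          ≈⟨ solve 4 (λ a x y o → (a :+ (:- x) :* y) :* o := a :* o :+ :- (y :* (x :* o))) refl
               (⟦ α j ⟧ (corner s j)) (⟦ α j ⟧ v) (⟦ μ ⟧ (corner s j)) (off α j s) ⟩
        ⟦ α j ⟧ (corner s j) * off α j s + - (⟦ μ ⟧ (corner s j) * (⟦ α j ⟧ v * off α j s))
          ≈⟨ +-cong (sym (coord-pure α j s)) (-‿cong (*-congˡ (sym (contract-pure j v α s)))) ⟩
        coords (pure α) s + - (⟦ μ ⟧ (corner s j) * contract j v (coords (pure α)) s) ∎
      coords-project 𝟘 s = solve 3 (λ y x x′ → :0 := :0 :+ :- (y :* (x :* :0 :+ x′ :* :0))) refl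
        (⟦ μ ⟧ (corner s j)) (⟦ coordinate (D j) 0F ⟧ v) (⟦ coordinate (D j) 1F ⟧ v)
      coords-project (t ⊕ u) s = begin
        coords (project t) s + coords (project u) s ≈⟨ +-cong (coords-project t s) (coords-project u s) ⟩
        (coords t s + - (y * contract j v (coords t) s)) + (coords u s + - (y * contract j v (coords u) s))
          ≈⟨ solve 5 (λ a b c d y → (a :+ :- (y :* c)) :+ (b :+ :- (y :* d)) := (a :+ b) :+ :- (y :* (c :+ d))) refl
               (coords t s) (coords u s) (contract j v (coords t) s) (contract j v (coords u) s) y ⟩
        (coords t s + coords u s) + - (y * (contract j v (coords t) s + contract j v (coords u) s))
          ≈⟨ +-congˡ (-‿cong (*-congˡ (contract-+ j v (coords t) (coords u) s))) ⟨
        coords (t ⊕ u) s + - (y * contract j v (coords (t ⊕ u)) s) ∎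
        where y = ⟦ μ ⟧ (corner s j)
      coords-project (a ⊙ t) s = begin
        a * coords (project t) s ≈⟨ *-congˡ (coords-project t s) ⟩
        a * (coords t s + - (y * contract j v (coords t) s))
          ≈⟨ solve 4 (λ a t y c → a :* (t :+ :- (y :* c)) := a :* t :+ :- (y :* (a :* c))) refl
               a (coords t s) y (contract j v (coords t) s) ⟩
        a * coords t s + - (y * (a * contract j v (coords t) s))
          ≈⟨ +-congˡ (-‿cong (*-congˡ (contract-* j v a (coords t) s))) ⟨
        coords (a ⊙ t) s + - (y * contract j v (coords (a ⊙ t)) s) ∎
        where y = ⟦ μ ⟧ (corner s j)

    -- Converse of `contract-Σ⁰`. When the contraction is zero, the projection leaves all
    -- coordinates unchanged, and its image consists of sums of pure tensors that annihilate `v` in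
    -- slot `j`.
    Σ⁰-contract : ∀ j v t → NonZero (V j) v → (∀ s → contract j v (coords t) s ≈ 0#) → Σ⁰ V j v t
    Σ⁰-contract j v t v≉0 z = Σ⁰-resp j v (tensor-ext {project t} {t} fixed) (project-Σ⁰ t)
      where
      μ = proj₁ (normalized-covector (D j) {v} v≉0)
      open Projection j v μ (proj₂ (normalized-covector (D j) {v} v≉0))
      fixed : ∀ s → coords (project t) s ≈ coords t s
      fixed s = trans (coords-project t s) (trans (+-congˡ (-‿cong (*-congˡ (z s))))
        (solve 2 (λ x y → x :+ :- (y :* :0) := x) refl (coords t s) (⟦ μ ⟧ (corner s j))))

    -- Choose an index with nonzero entry. The pair of entries obtained by varying its slot `j` is a
    -- nonzero solution of the two linear equations given by `v` and `w`, so their determinant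
    -- vanishes.
    contract-independent : ∀ j {v w} (a : Index m → Carrier) → (∃[ s ] ¬ (a s ≈ 0#)) →
      (∀ s → contract j v a s ≈ 0#) → (∀ s → contract j w a s ≈ 0#) →
      ⟦ coordinate (D j) 0F ⟧ v * ⟦ coordinate (D j) 1F ⟧ w ≈ ⟦ coordinate (D j) 1F ⟧ v * ⟦ coordinate (D j) 0F ⟧ w
    contract-independent j {v} {w} a (s , as≉0) cv cw = by-entry (lookup s j)
      (λ e → as≉0 (trans (reflexive (≡.cong a (≡.sym ([]≔-lookup s j)))) e))
      where
      v₀ = ⟦ coordinate (D j) 0F ⟧ v
      v₁ = ⟦ coordinate (D j) 1F ⟧ v
      w₀ = ⟦ coordinate (D j) 0F ⟧ w
      w₁ = ⟦ coordinate (D j) 1F ⟧ w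
      a₀ = a (s [ j ]≔ 0F)
      a₁ = a (s [ j ]≔ 1F)
      by-entry : ∀ c → ¬ (a (s [ j ]≔ c) ≈ 0#) → v₀ * w₁ ≈ v₁ * w₀
      by-entry 0F a₀≉0 = *-cancelˡ-nonzero a₀≉0 (difference-zero (begin
        a₀ * (v₀ * w₁) + - (a₀ * (v₁ * w₀))
          ≈⟨ solve 6 (λ a b v₀ v₁ w₀ w₁ → a :* (v₀ :* w₁) :+ :- (a :* (v₁ :* w₀)) :=
                w₁ :* (v₀ :* a :+ v₁ :* b) :+ :- (v₁ :* (w₀ :* a :+ w₁ :* b))) refl a₀ a₁ v₀ v₁ w₀ w₁ ⟩
        w₁ * contract j v a s + - (v₁ * contract j w a s) ≈⟨ +-cong (*-congˡ (cv s)) (-‿cong (*-congˡ (cw s))) ⟩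
        w₁ * 0# + - (v₁ * 0#) ≈⟨ solve 2 (λ x y → x :* :0 :+ :- (y :* :0) := :0) refl w₁ v₁ ⟩
        0# ∎))
      by-entry 1F a₁≉0 = *-cancelˡ-nonzero a₁≉0 (difference-zero (begin
        a₁ * (v₀ * w₁) + - (a₁ * (v₁ * w₀))
          ≈⟨ solve 6 (λ a b v₀ v₁ w₀ w₁ → b :* (v₀ :* w₁) :+ :- (b :* (v₁ :* w₀)) :=
                v₀ :* (w₀ :* a :+ w₁ :* b) :+ :- (w₀ :* (v₀ :* a :+ v₁ :* b))) refl a₀ a₁ v₀ v₁ w₀ w₁ ⟩
        v₀ * contract j w a s + - (w₀ * contract j v a s) ≈⟨ +-cong (*-congˡ (cw s)) (-‿cong (*-congˡ (cv s))) ⟩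
        v₀ * 0# + - (w₀ * 0#) ≈⟨ solve 2 (λ x y → x :* :0 :+ :- (y :* :0) := :0) refl v₀ w₀ ⟩
        0# ∎))

-- Forms: restriction to lines, vanishing, generic points

module Forms (K : CommutativeRing 0ℓ 0ℓ) (F : IsInfiniteField K) (em : ExcludedMiddle 0ℓ) where

  open CommutativeRing K hiding (zero)
  open FieldProperties K F em
  open Solver K
  open Polynomials K F em
  open LinearAlgebra K
  open LinearMap using (⟦_⟧)
  open VectorSpaces K F em
  open RawSemiringDefs (Semiring.rawSemiring semiring) using (_^_)

  module _ {V M : VectorSpace K} where
    private
      module V = LeftModule V
      module M = LeftModule M

    form-cong : ∀ {e f} → IsForm V M e f → ∀ {v w} → v V.≈ᴹ w → f v M.≈ᴹ f w
    form-cong (const a)   v≈w = M.≈ᴹ-refl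
    form-cong (times ξ p) v≈w = M.*ₗ-cong (cov-cong ξ v≈w) (form-cong p v≈w)
    form-cong (plus p q)  v≈w = M.+ᴹ-cong (form-cong p v≈w) (form-cong q v≈w)
    form-cong (equal e p) v≈w = M.≈ᴹ-trans (M.≈ᴹ-sym (e _)) (M.≈ᴹ-trans (form-cong p v≈w) (e _))

    form-scale : ∀ {e f} a → IsForm V M e f → IsForm V M e (λ v → a M.*ₗ f v)
    form-scale a (const b)   = const (a M.*ₗ b)
    form-scale a (times {f = f} ξ p) = equal (λ v → M.≈ᴹ-trans (M.≈ᴹ-sym (M.*ₗ-assoc _ _ _))
      (M.≈ᴹ-trans (M.*ₗ-congʳ (*-comm _ _)) (M.*ₗ-assoc _ _ _))) (times ξ (form-scale a p))
    form-scale a (plus p q)  = equal (λ v → M.≈ᴹ-sym (M.*ₗ-distribˡ a _ _)) (plus (form-scale a p) (form-scale a q))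
    form-scale a (equal e p) = equal (λ v → M.*ₗ-congˡ (e v)) (form-scale a p)

    form-zero : ∀ e → IsForm V M e (λ _ → M.0ᴹ)
    form-zero zero    = const M.0ᴹ
    form-zero (suc e) = equal (λ v → M.*ₗ-zeroʳ _) (times (LeftModule.0ᴹ (Dual V)) (form-zero e))

    form-* : ∀ {d e f g} → IsForm V ⟨K⟩ d f → IsForm V M e g → IsForm V M (d ℕ.+ e) (λ v → f v M.*ₗ g v)
    form-* (const a)   q = form-scale a q
    form-* (times ξ p) q = equal (λ v → M.≈ᴹ-sym (M.*ₗ-assoc _ _ _)) (times ξ (form-* p q))
    form-* (plus p p′) q = equal (λ v → M.≈ᴹ-sym (M.*ₗ-distribʳ _ _ _)) (plus (form-* p q) (form-* p′ q))
    form-* (equal e p) q = equal (λ v → M.*ₗ-congʳ (e v)) (form-* p q)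

    form-sum : ∀ {n e} {f : Fin n → ∥ V ∥ → ∥ M ∥} → (∀ i → IsForm V M e (f i)) → IsForm V M e (λ v → msum M (λ i → f i v))
    form-sum {zero}  {e} p = form-zero e
    form-sum {suc n} {e} p = plus (p zero) (form-sum (p ∘ suc))

    form-map : ∀ {N e f} (L : LinearMap M N) → IsForm V M e f → IsForm V N e (λ v → ⟦ L ⟧ (f v))
    form-map L (const a)   = const (⟦ L ⟧ a)
    form-map {N} L (times ξ p) = equal (λ v → LeftModule.≈ᴹ-sym N (LinearMap.*ₗ-homo L _ _)) (times ξ (form-map L p))
    form-map {N} L (plus p q)  = equal (λ v → LeftModule.≈ᴹ-sym N (LinearMap.+ᴹ-homo L _ _)) (plus (form-map L p) (form-map L q))
    form-map L (equal e p) = equal (λ v → LinearMap.⟦⟧-cong L (e v)) (form-map L p)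

    form-pullback : ∀ {U e f} (L : LinearMap U V) → IsForm V M e f → IsForm U M e (λ u → f (⟦ L ⟧ u))
    form-pullback L (const a)   = const a
    form-pullback L (times ξ p) = times (composite ξ L) (form-pullback L p)
    form-pullback L (plus p q)  = plus (form-pullback L p) (form-pullback L q)
    form-pullback L (equal e p) = equal (λ u → e (⟦ L ⟧ u)) (form-pullback L p)

  module _ {V : VectorSpace K} where
    private module V = LeftModule V

    form-covector : (ξ : Covector V) → IsForm V ⟨K⟩ 1 ⟦ ξ ⟧
    form-covector ξ = equal (λ v → *-identityʳ _) (times ξ (const 1#))

    form-^ : (ξ : Covector V) (n : ℕ) → IsForm V ⟨K⟩ n (λ v → ⟦ ξ ⟧ v ^ n)
    form-^ ξ zero    = const 1#
    form-^ ξ (suc n) = times ξ (form-^ ξ n)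

    form-minus : ∀ {e f g} → IsForm V ⟨K⟩ e f → IsForm V ⟨K⟩ e g → IsForm V ⟨K⟩ e (λ v → f v + - g v)
    form-minus {f = f} {g} p q =
      equal (λ v → solve 2 (λ x y → x :+ (:- :1) :* y := x :+ :- y) refl (f v) (g v)) (plus p (form-scale (- 1#) q))

    -- The coefficient of `t^e` is the value of the form at the point at infinity of the line, its
    -- direction `w`; it may be zero.
    form-line : ∀ {e f} → IsForm V ⟨K⟩ e f → ∀ v w → Poly e (f w) (λ t → f (v V.+ᴹ t V.*ₗ w))
    form-line (const a)   v w = constant λ t → refl
    form-line (times ξ p) v w = poly-cong (λ t → *-congʳ (trans (cov-+ ξ v (t V.*ₗ w)) (+-congˡ (cov-* ξ t w))))
      (poly-* (linear-poly (⟦ ξ ⟧ v) (⟦ ξ ⟧ w)) (form-line p v w))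
    form-line (plus p q)  v w = poly-+ (form-line p v w) (form-line q v w)
    form-line (equal e p) v w = lead-cong (e w) (poly-cong (λ t → sym (e _)) (form-line p v w))

    form-homogeneous : ∀ {e f} → IsForm V ⟨K⟩ e f → ∀ c v → f (c V.*ₗ v) ≈ c ^ e * f v
    form-homogeneous (const a)   c v = sym (*-identityˡ a)
    form-homogeneous (times {e} {f} ξ p) c v = trans (*-cong (cov-* ξ c v) (form-homogeneous p c v))
      (solve 4 (λ c x y z → (c :* x) :* (y :* z) := (c :* y) :* (x :* z)) refl c (⟦ ξ ⟧ v) (c ^ e) (f v))
    form-homogeneous (plus p q)  c v = trans (+-cong (form-homogeneous p c v) (form-homogeneous q c v)) (sym (distribˡ _ _ _))
    form-homogeneous (equal e p) c v = trans (sym (e _)) (trans (form-homogeneous p c v) (*-congˡ (e v)))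

    ^-nonzero : ∀ {c} → ¬ (c ≈ 0#) → ∀ n → ¬ (c ^ n ≈ 0#)
    ^-nonzero c≉0 zero    = 1≉0
    ^-nonzero c≉0 (suc n) = *-nonzero c≉0 (^-nonzero c≉0 n)

    -- On the line through a point where D does not vanish, in direction v, the
    -- leading coefficient of P is P(v).
    form-vanishes : ∀ {d e D P} → IsForm V ⟨K⟩ d D → (∃[ v ] ¬ (D v ≈ 0#)) → IsForm V ⟨K⟩ e P →
                    (∀ v → ¬ (D v ≈ 0#) → P v ≈ 0#) → ∀ v → P v ≈ 0#
    form-vanishes {D = D} {P} D-form (w , Dw≉0) P-form z v =
      lead-vanishes (form-line P-form w v) (no-zero-divisors (_ , _ , form-line P-form w v) (_ , _ , form-line D-form w v)
        PD≈0 λ D≈0 → Dw≉0 (trans (form-cong D-form (V.≈ᴹ-sym (V.≈ᴹ-trans (V.+ᴹ-congˡ (V.*ₗ-zeroˡ v)) (V.+ᴹ-identityʳ w)))) (D≈0 0#)))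
      where
      PD≈0 : ∀ t → P (w V.+ᴹ t V.*ₗ v) * D (w V.+ᴹ t V.*ₗ v) ≈ 0#
      PD≈0 t with D (w V.+ᴹ t V.*ₗ v) ≟0
      ... | yes D≈0 = trans (*-congˡ D≈0) (zeroʳ _)
      ... | no D≉0 = trans (*-congʳ (z _ D≉0)) (zeroˡ _)

  record GenericForm (V : VectorSpace K) (P : ∥ V ∥ → Set) : Set where
    field
      {degree} : ℕ
      form     : ∥ V ∥ → Carrier
      isForm   : IsForm V ⟨K⟩ degree form
      witness  : ∃[ v ] ¬ (form v ≈ 0#)
      nonzero  : ∀ v → ¬ (form v ≈ 0#) → NonZero V v
      generic  : ∀ v → ¬ (form v ≈ 0#) → P v

  -- One component of the open set that is nonzero at the witness suffices. Multiplication by a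
  -- coordinate that is also nonzero there excludes `v = 0`, where a component of degree 0 need not
  -- vanish.
  genericForm : ∀ {V n P} → Basis V n → Generic V P → GenericForm V P
  genericForm {V} B (U , (w , w≉0 , i , Uw≉0) , U⇒P) = record
    { form = λ v → ⟦ ξ ⟧ v * U.form i v
    ; isForm = times ξ (U.isForm i)
    ; witness = w , *-nonzero (proj₂ (nonzero-coordinate B {w} w≉0)) Uw≉0
    ; nonzero = nonzero
    ; generic = λ v ne → U⇒P v (nonzero v ne) (i , *-nonzeroʳ ne)
    }
    where
    module U = ZariskiOpen U
    ξ : Covector V
    ξ = coordinate B (proj₁ (nonzero-coordinate B {w} w≉0))
    nonzero : ∀ v → ¬ (⟦ ξ ⟧ v * U.form i v ≈ 0#) → NonZero V v
    nonzero v ne v≈0 = ne (trans (*-congʳ (trans (cov-cong ξ v≈0) (cov-0 ξ))) (zeroˡ _))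

-- Factorization curves as solutions of incidence equations

module Curves (K : CommutativeRing 0ℓ 0ℓ) (F : IsInfiniteField K) (em : ExcludedMiddle 0ℓ) where

  open CommutativeRing K hiding (zero)
  open FieldProperties K F em
  open Solver K
  open Polynomials K F em
  open LinearAlgebra K
  open LinearMap using (⟦_⟧)
  open VectorSpaces K F em
  open Tensors K F em
  open Forms K F em
  open RawSemiringDefs (Semiring.rawSemiring semiring) using (_^_)
  open RawMonoidDefs +-rawMonoid using (sum)
  open SetoidReasoning setoid

  -- The condition of the field `generates` of `RegularMap` for a single linear form.
  GeneratesPower : {V H : VectorSpace K} → ℕ → (∥ V ∥ → ∥ H ∥) → Covector V → Set
  GeneratesPower {V} {H} deg form ξ =
    Σ ℕ λ d → Σ ℕ λ n →
    Σ (Fin n → ∥ V ∥ → Carrier) λ p → Σ (Fin n → Covector H) λ η →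
      (∀ i → IsForm V ⟨K⟩ d (p i)) ×
      (∀ v → ⟦ ξ ⟧ v ^ (d ℕ.+ deg) ≈ sum (λ i → p i v * ⟦ η i ⟧ (form v)))

  1^ : ∀ n {x} → x ≈ 1# → x ^ n ≈ 1#
  1^ zero    e = refl
  1^ (suc n) e = trans (*-cong e (1^ n e)) (*-identityˡ 1#)

  module Incidence {m n : ℕ} {V : Fin m → VectorSpace K} {H : VectorSpace K}
                   (φ : LinearMap H (V* V)) (φ-injective : IsInjective φ)
                   (B : ∀ j → Basis (V j) 2) (C : Basis H n) where

    open Coordinates B
    private module H = LeftModule H

    Φ : Index m → Covector H
    Φ s = composite (coord s) φ

    values : ∥ H ∥ → Index m → Carrier
    values x s = ⟦ Φ s ⟧ x

    Φ-ext : ∀ {x y} → (∀ s → values x s ≈ values y s) → x H.≈ᴹ y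
    Φ-ext {x} {y} e = φ-injective (tensor-ext {⟦ φ ⟧ x} {⟦ φ ⟧ y} e)

    Φ-nonzero : ∀ x → NonZero H x → ∃[ s ] ¬ (values x s ≈ 0#)
    Φ-nonzero x x≉0 = nonzero-member (values x) λ z → x≉0 (Φ-ext λ s → trans (z s) (sym (cov-0 (Φ s))))

    -- For `v` nonzero this says that `⟦ φ ⟧ x` lies in Σ⁰ of `v`, now as equations linear in `v`
    -- and in `x`. At `v = 0` it holds for every `x`.
    Incident : (j : Fin m) → ∥ V j ∥ → ∥ H ∥ → Set
    Incident j v x = ∀ s → contract j v (values x) s ≈ 0#

    contraction : (j : Fin m) → ∥ V j ∥ → Index m → Covector H
    contraction j v s = mkLinearMap (λ x → contract j v (values x) s)
      (λ e → contract-cong j v (λ s → cov-cong (Φ s) e) s)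
      (λ x y → trans (contract-cong j v (λ s → cov-+ (Φ s) x y) s) (contract-+ j v (values x) (values y) s))
      (λ c x → trans (contract-cong j v (λ s → cov-* (Φ s) c x) s) (contract-* j v c (values x) s))

    incident-sameLine : ∀ j v {x y} → SameLine H x y → Incident j v x → Incident j v y
    incident-sameLine j v {x} {y} (c , c≉0 , x≈cy) z s = *-zero-cancelˡ c≉0 (begin
      c * contract j v (values y) s            ≈⟨ contract-* j v c (values y) s ⟨
      contract j v (λ s → c * values y s) s
        ≈⟨ contract-cong j v (λ s → trans (cov-cong (Φ s) x≈cy) (cov-* (Φ s) c y)) s ⟨
      contract j v (values x) s                ≈⟨ z s ⟩
      0# ∎)

    incident-zero : ∀ j {v} x → LeftModule._≈ᴹ_ (V j) v (LeftModule.0ᴹ (V j)) → Incident j v x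
    incident-zero j {v} x v≈0 s = trans (+-cong (*-congʳ (zero-of 0F)) (*-congʳ (zero-of 1F)))
      (solve 2 (λ a b → :0 :* a :+ :0 :* b := :0) refl (values x (s [ j ]≔ 0F)) (values x (s [ j ]≔ 1F)))
      where
      zero-of : ∀ k → ⟦ coordinate (B j) k ⟧ v ≈ 0#
      zero-of k = trans (cov-cong (coordinate (B j) k) v≈0) (cov-0 (coordinate (B j) k))

    incident-Σ⁰ : ∀ j v x → NonZero (V j) v → Incident j v x → Σ⁰ V j v (⟦ φ ⟧ x)
    incident-Σ⁰ j v x = Σ⁰-contract j v (⟦ φ ⟧ x)

    Σ⁰-incident : ∀ j v x → Σ⁰ V j v (⟦ φ ⟧ x) → Incident j v x
    Σ⁰-incident j v x = contract-Σ⁰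

    minor : (j : Fin m) → ∥ V j ∥ → ∥ V j ∥ → Carrier
    minor j v w = ⟦ coordinate (B j) 0F ⟧ v * ⟦ coordinate (B j) 1F ⟧ w + - (⟦ coordinate (B j) 1F ⟧ v * ⟦ coordinate (B j) 0F ⟧ w)

    incident-unique : ∀ j {v w} x → NonZero H x → Incident j v x → Incident j w x → minor j v w ≈ 0#
    incident-unique j {v} {w} x x≉0 p q =
      zero-difference (contract-independent j {v} {w} (values x) (Φ-nonzero x x≉0) p q)

    minor-sameLine : ∀ j {v w} → NonZero (V j) v → NonZero (V j) w → minor j v w ≈ 0# → SameLine (V j) v w
    minor-sameLine j {v} {w} v≉0 w≉0 e = proportional (B j) v≉0 w≉0 λ
      { 0F 0F → refl
      ; 0F 1F → difference-zero e
      ; 1F 0F → sym (difference-zero e)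
      ; 1F 1F → refl }

    -- Both pairs of entries are orthogonal to the nonzero coordinate pair of `v`, hence parallel.
    -- The conclusion no longer mentions `v`.
    incident-minors : ∀ i v x → NonZero (V i) v → Incident i v x → ∀ s s′ →
      values x (s [ i ]≔ 0F) * values x (s′ [ i ]≔ 1F) ≈ values x (s′ [ i ]≔ 0F) * values x (s [ i ]≔ 1F)
    incident-minors i v x v≉0 p s s′ = by-coordinate (nonzero-coordinate (B i) {v} v≉0)
      where
      v₀ = ⟦ coordinate (B i) 0F ⟧ v
      v₁ = ⟦ coordinate (B i) 1F ⟧ v
      y₀ = values x (s [ i ]≔ 0F)
      y₁ = values x (s [ i ]≔ 1F)
      z₀ = values x (s′ [ i ]≔ 0F)
      z₁ = values x (s′ [ i ]≔ 1F)
      zeros : ∀ a b → a * contract i v (values x) s + - (b * contract i v (values x) s′) ≈ 0#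
      zeros a b = trans (+-cong (*-congˡ (p s)) (-‿cong (*-congˡ (p s′)))) (solve 2 (λ a b → a :* :0 :+ :- (b :* :0) := :0) refl a b)
      by-coordinate : ∃[ k ] ¬ (⟦ coordinate (B i) k ⟧ v ≈ 0#) → y₀ * z₁ ≈ z₀ * y₁
      by-coordinate (0F , v₀≉0) = *-cancelˡ-nonzero v₀≉0 (difference-zero (trans
        (solve 6 (λ v₀ v₁ y₀ y₁ z₀ z₁ → v₀ :* (y₀ :* z₁) :+ :- (v₀ :* (z₀ :* y₁)) := z₁ :* (v₀ :* y₀ :+ v₁ :* y₁) :+ :- (y₁ :* (v₀ :* z₀ :+ v₁ :* z₁)))
          refl v₀ v₁ y₀ y₁ z₀ z₁) (zeros z₁ y₁)))
      by-coordinate (1F , v₁≉0) = *-cancelˡ-nonzero v₁≉0 (difference-zero (trans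
        (solve 6 (λ v₀ v₁ y₀ y₁ z₀ z₁ → v₁ :* (y₀ :* z₁) :+ :- (v₁ :* (z₀ :* y₁)) := (:- z₀) :* (v₀ :* y₀ :+ v₁ :* y₁) :+ :- ((:- y₀) :* (v₀ :* z₀ :+ v₁ :* z₁)))
          refl v₀ v₁ y₀ y₁ z₀ z₁) (zeros (- z₀) (- y₀))))

    contract-form : ∀ j {e f} → IsForm (V j) H e f → ∀ s → IsForm (V j) ⟨K⟩ (suc e) (λ v → contract j v (values (f v)) s)
    contract-form j p s = plus (times (coordinate (B j) 0F) (form-map (Φ (s [ j ]≔ 0F)) p))
                               (times (coordinate (B j) 1F) (form-map (Φ (s [ j ]≔ 1F)) p))

    -- A regular map whose values lie on the j-th factorization curve; the
    -- condition on generators is only kept for the coordinates of V j.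
    record IncidentCurve (j : Fin m) : Set where
      field
        {degree}  : ℕ
        form      : ∥ V j ∥ → ∥ H ∥
        isForm    : IsForm (V j) H degree form
        generates : ∀ c → GeneratesPower {V j} {H} degree form (coordinate (B j) c)
        incident  : ∀ v → Incident j v (form v)

      -- Evaluate the certificate for a coordinate that is nonzero at `v`: its left side is a power
      -- of a nonzero number, while a zero of `form` would make the right side vanish.
      form-nonzero : ∀ v → NonZero (V j) v → NonZero H (form v)
      form-nonzero v v≉0 fv≈0 = vanish (generates c)
        where
        c = proj₁ (nonzero-coordinate (B j) {v} v≉0)
        vanish : GeneratesPower {V j} {H} degree form (coordinate (B j) c) → ⊥
        vanish (d , n , p , η , _ , e) = ^-nonzero {V j} (proj₂ (nonzero-coordinate (B j) {v} v≉0)) (d ℕ.+ degree)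
          (trans (e v) (zero-sum n λ i → trans (*-congˡ (trans (cov-cong (η i) fv≈0) (cov-0 (η i)))) (zeroʳ _)))
          where
          zero-sum : ∀ n {f : Fin n → Carrier} → (∀ i → f i ≈ 0#) → sum f ≈ 0#
          zero-sum zero    z = refl
          zero-sum (suc n) z = trans (+-cong (z zero) (zero-sum n (z ∘ suc))) (+-identityˡ 0#)

    open IncidentCurve

    sameLine-form : ∀ {i} (f : IncidentCurve i) v v′ → SameLine (V i) v v′ → SameLine H (form f v) (form f v′)
    sameLine-form {i} f v v′ (c , c≉0 , e) = c ^ degree f , ^-nonzero {V i} c≉0 (degree f) ,
      H.≈ᴹ-trans (form-cong (isForm f) e)
        (coordinates-separate C λ k → trans
          (form-homogeneous {V i} (form-map (coordinate C k) (isForm f)) c v′)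
          (sym (cov-* (coordinate C k) _ (form f v′))))

    module _ {j : Fin m} (ψ : FactorizationCurve φ j) where
      private
        module ψ = FactorizationCurve ψ
        module R = RegularMap ψ.curve
        G : GenericForm (V j) _
        G = genericForm (B j) ψ.extends
        module G = GenericForm G

      incident-multiple : ∀ v → ¬ (G.form v ≈ 0#) → ∀ x → Incident j v x → ∃[ c ] x H.≈ᴹ c H.*ₗ R.form v
      incident-multiple v ne x z = Equivalence.from (G.generic v ne x) (incident-Σ⁰ j v x (G.nonzero v ne) z)

      incidentCurve : IncidentCurve j
      incidentCurve = record
        { form = R.form
        ; isForm = R.isForm
        ; generates = λ c → R.generates (coordinate (B j) c)
        -- Generically, incidence is the defining property of the curve applied to its own value;
        -- being the vanishing of a form in `v`, it then holds everywhere.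
        ; incident = λ v s → form-vanishes {V j} G.isForm G.witness (contract-form j R.isForm s)
            (λ v ne → Σ⁰-incident j v (R.form v)
              (Equivalence.to (G.generic v ne (R.form v)) (1# , H.≈ᴹ-sym (H.*ₗ-identityˡ _))) s) v
        }

      -- If the values of f are incident with L(u), they lie on ψ: this holds
      -- generically, and proportionality is a closed condition.
      incident-cross : ∀ {U e f} (L : LinearMap U (V j)) → (∃[ u ] ¬ (G.form (⟦ L ⟧ u) ≈ 0#)) →
        IsForm U H e f → (∀ u → Incident j (⟦ L ⟧ u) (f u)) →
        ∀ (η η′ : Covector H) u → ⟦ η ⟧ (f u) * ⟦ η′ ⟧ (R.form (⟦ L ⟧ u)) ≈ ⟦ η′ ⟧ (f u) * ⟦ η ⟧ (R.form (⟦ L ⟧ u))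
      incident-cross {U} {f = f} L witness f-form f-incident η η′ u = difference-zero
        (form-vanishes {U} (form-pullback L G.isForm) witness
          (form-minus {U} (form-* {U} {⟨K⟩} (form-map η f-form) (form-map η′ (form-pullback L R.isForm)))
                      (form-* {U} {⟨K⟩} (form-map η′ f-form) (form-map η (form-pullback L R.isForm))))
          generically u)
        where
        generically : ∀ u → ¬ (G.form (⟦ L ⟧ u) ≈ 0#) →
          ⟦ η ⟧ (f u) * ⟦ η′ ⟧ (R.form (⟦ L ⟧ u)) + - (⟦ η′ ⟧ (f u) * ⟦ η ⟧ (R.form (⟦ L ⟧ u))) ≈ 0#
        generically u ne = multiple (incident-multiple (⟦ L ⟧ u) ne (f u) (f-incident u))
          where
          χ = R.form (⟦ L ⟧ u)
          multiple : ∃[ c ] f u H.≈ᴹ c H.*ₗ χ → _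
          multiple (c , e) = trans
            (+-cong (*-congʳ (trans (cov-cong η e) (cov-* η c χ)))
                    (-‿cong (*-congʳ (trans (cov-cong η′ e) (cov-* η′ c χ)))))
            (solve 3 (λ c x y → (c :* x) :* y :+ :- ((c :* y) :* x) := :0) refl c (⟦ η ⟧ χ) (⟦ η′ ⟧ χ))

      incident-sameLine-curve : ∀ {U e f} (L : LinearMap U (V j)) → (∃[ u ] ¬ (G.form (⟦ L ⟧ u) ≈ 0#)) →
        IsForm U H e f → (∀ u → Incident j (⟦ L ⟧ u) (f u)) →
        ∀ u → NonZero H (f u) → NonZero (V j) (⟦ L ⟧ u) → SameLine H (f u) (R.form (⟦ L ⟧ u))
      incident-sameLine-curve L witness f-form f-incident u fu≉0 Lu≉0 =
        proportional C fu≉0 (form-nonzero incidentCurve (⟦ L ⟧ u) Lu≉0) λ k l →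
          incident-cross L witness f-form f-incident (coordinate C k) (coordinate C l) u

      private
        identity : LinearMap (V j) (V j)
        identity = mkLinearMap (λ v → v) (λ e → e) (λ _ _ → LeftModule.≈ᴹ-refl (V j)) (λ _ _ → LeftModule.≈ᴹ-refl (V j))

      unique-cross : (f : IncidentCurve j) → ∀ (η η′ : Covector H) v →
        ⟦ η ⟧ (form f v) * ⟦ η′ ⟧ (R.form v) ≈ ⟦ η′ ⟧ (form f v) * ⟦ η ⟧ (R.form v)
      unique-cross f = incident-cross identity G.witness (isForm f) (incident f)

      unique-sameLine : (f : IncidentCurve j) → ∀ v → NonZero (V j) v → SameLine H (form f v) (R.form v)
      unique-sameLine f v v≉0 = incident-sameLine-curve identity G.witness (isForm f) (incident f) v
        (form-nonzero f v v≉0) v≉0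

    -- On the line b₀ + t b₁ the coordinate ξ equals 1, so there the values of χ
    -- are polynomial multiples P f, and f has exact degree deg f.
    degree-mono : ∀ {j} (f χ : IncidentCurve j) →
      (∀ (η η′ : Covector H) v → ⟦ η ⟧ (form f v) * ⟦ η′ ⟧ (form χ v) ≈ ⟦ η′ ⟧ (form f v) * ⟦ η ⟧ (form χ v)) →
      degree f ℕ.≤ degree χ
    degree-mono {j} f χ cross = conclude (generates f 0F)
      where
      module V = LeftModule (V j)
      ξ = coordinate (B j) 0F
      b₀ = basis (B j) 0F
      b₁ = basis (B j) 1F
      line : Carrier → ∥ V j ∥
      line t = b₀ V.+ᴹ t V.*ₗ b₁
      ξ-line : ∀ t → ⟦ ξ ⟧ (line t) ≈ 1#
      ξ-line t = trans (cov-+ ξ b₀ (t V.*ₗ b₁)) (trans (+-cong (coordinate-same (B j) 0F)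
        (trans (cov-* ξ t b₁) (trans (*-congˡ (coordinate-other (B j) λ ())) (zeroʳ t)))) (+-identityʳ 1#))
      conclude : GeneratesPower {V j} {H} (degree f) (form f) ξ → degree f ℕ.≤ degree χ
      conclude (d , n , p , η , p-form , e) = ℕₚ.≤-trans (ℕₚ.m≤n+m _ k) (degree-≤
        (form-line {V j} (form-map κ (isForm χ)) b₀ b₁)
        (poly-cong (λ t → multiple κ t) (poly-* P̂-exact (form-line {V j} (form-map κ (isForm f)) b₀ b₁)))
        (*-nonzero c≉0 (proj₂ fb₁)))
        where
        P : ∥ V j ∥ → Carrier
        P v = sum (λ i → p i v * ⟦ η i ⟧ (form χ v))
        P-form : IsForm (V j) ⟨K⟩ (d ℕ.+ degree χ) P
        P-form = form-sum {V j} {⟨K⟩} λ i → form-* {V j} {⟨K⟩} (p-form i) (form-map (η i) (isForm χ))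
        -- `b₁` is the point at infinity of the line, so a coordinate of `f` that is nonzero there
        -- restricts to a polynomial of exact degree `degree f`.
        fb₁ = nonzero-coordinate C {form f b₁} (form-nonzero f b₁ (basis-nonzero (B j) 1F))
        κ = coordinate C (proj₁ fb₁)
        sum-swap : ∀ n (x y z : Fin n → Carrier) a b → (∀ i → y i * a ≈ b * z i) →
                   sum (λ i → x i * y i) * a ≈ sum (λ i → x i * z i) * b
        sum-swap zero    x y z a b s = trans (zeroˡ a) (sym (zeroˡ b))
        sum-swap (suc n) x y z a b s = trans (distribʳ a _ _) (trans (+-cong
            (trans (*-assoc _ _ _) (trans (*-congˡ (s zero)) (solve 3 (λ x b z → x :* (b :* z) := (x :* z) :* b) refl (x zero) b (z zero))))
            (sum-swap n (x ∘ suc) (y ∘ suc) (z ∘ suc) a b (s ∘ suc)))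
          (sym (distribʳ b _ _)))
        multiple : ∀ κ t → ⟦ κ ⟧ (form χ (line t)) ≈ P (line t) * ⟦ κ ⟧ (form f (line t))
        multiple κ t = begin
          ⟦ κ ⟧ (form χ (line t))                                        ≈⟨ *-identityˡ _ ⟨
          1# * ⟦ κ ⟧ (form χ (line t))                                   ≈⟨ *-congʳ (1^ (d ℕ.+ degree f) (ξ-line t)) ⟨
          ⟦ ξ ⟧ (line t) ^ (d ℕ.+ degree f) * ⟦ κ ⟧ (form χ (line t))    ≈⟨ *-congʳ (e (line t)) ⟩
          sum (λ i → p i (line t) * ⟦ η i ⟧ (form f (line t))) * ⟦ κ ⟧ (form χ (line t))
            ≈⟨ sum-swap n (λ i → p i (line t)) (λ i → ⟦ η i ⟧ (form f (line t))) (λ i → ⟦ η i ⟧ (form χ (line t)))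
                 (⟦ κ ⟧ (form χ (line t))) (⟦ κ ⟧ (form f (line t))) (λ i → cross (η i) κ (line t)) ⟩
          P (line t) * ⟦ κ ⟧ (form f (line t)) ∎
        P̂≉0 : ¬ Vanishes (λ t → P (line t))
        P̂≉0 z = form-nonzero χ (line 0#)
          (λ line≈0 → 0≉1 (trans (sym (trans (cov-cong ξ line≈0) (cov-0 ξ))) (ξ-line 0#)))
          (coordinates-zero C λ l → trans (multiple (coordinate C l) 0#) (trans (*-congʳ (z 0#)) (zeroˡ _)))
        exact = exact-degree (form-line {V j} P-form b₀ b₁) P̂≉0
        k = proj₁ exact
        c≉0 = proj₁ (proj₂ (proj₂ (proj₂ exact)))
        P̂-exact = proj₂ (proj₂ (proj₂ (proj₂ exact)))

    degree-unique : ∀ {j} (ψ : FactorizationCurve φ j) (f : IncidentCurve j) →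
                    degree f ≡ RegularMap.deg (FactorizationCurve.curve ψ)
    degree-unique ψ f = ℕₚ.≤-antisym (degree-mono f (incidentCurve ψ) (unique-cross ψ f))
      (degree-mono (incidentCurve ψ) f λ η η′ v →
        trans (*-comm _ _) (trans (unique-cross ψ f η′ η v) (*-comm _ _)))

    module _ {i j : Fin m} (ψᵢ : FactorizationCurve φ i) (ψⱼ : FactorizationCurve φ j) where
      private
        module Vᵢ = LeftModule (V i)
        module Vⱼ = LeftModule (V j)
        fᵢ = form (incidentCurve ψᵢ)
        fⱼ = form (incidentCurve ψⱼ)

      -- Incidence with `⟦ g ⟧ v` puts the j-th curve at `v` on the i-th curve at `⟦ g ⟧ v`.
      -- Surjectivity of `g` supplies both the preimages and a vector whose image is generic for the
      -- i-th curve.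
      sameImage-from-linear : (g : LinearMap (V j) (V i)) → (∀ w → ∃[ v ] ⟦ g ⟧ v Vᵢ.≈ᴹ w) →
        (∀ v → ⟦ g ⟧ v Vᵢ.≈ᴹ Vᵢ.0ᴹ → v Vⱼ.≈ᴹ Vⱼ.0ᴹ) → (∀ v → Incident i (⟦ g ⟧ v) (fⱼ v)) →
        SameImage (FactorizationCurve.curve ψᵢ) (FactorizationCurve.curve ψⱼ)
      sameImage-from-linear g surjective injective g-incident =
        (λ w w≉0 → preimage w w≉0 (surjective w)) ,
        (λ v v≉0 → ⟦ g ⟧ v , (λ e → v≉0 (injective v e)) , sameLine-sym H (line v v≉0))
        where
        G = genericForm (B i) (FactorizationCurve.extends ψᵢ)
        module G = GenericForm G
        witness : ∃[ v ] ¬ (G.form (⟦ g ⟧ v) ≈ 0#)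
        witness = proj₁ (surjective (proj₁ G.witness)) , λ e → proj₂ G.witness
          (trans (form-cong G.isForm (Vᵢ.≈ᴹ-sym (proj₂ (surjective (proj₁ G.witness))))) e)
        line : ∀ v → NonZero (V j) v → SameLine H (fⱼ v) (fᵢ (⟦ g ⟧ v))
        line v v≉0 = incident-sameLine-curve ψᵢ g witness (isForm (incidentCurve ψⱼ)) g-incident v
          (form-nonzero (incidentCurve ψⱼ) v v≉0) (λ e → v≉0 (injective v e))
        preimage : ∀ w → NonZero (V i) w → ∃[ v ] ⟦ g ⟧ v Vᵢ.≈ᴹ w → ∃[ v ] NonZero (V j) v × SameLine H (fᵢ w) (fⱼ v)
        preimage w w≉0 (v , gv≈w) = v , v≉0 , sameLine-trans H
          (sameLine-reflexive H (form-cong (isForm (incidentCurve ψᵢ)) (Vᵢ.≈ᴹ-sym gv≈w))) (sameLine-sym H (line v v≉0))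
          where
          v≉0 : NonZero (V j) v
          v≉0 v≈0 = w≉0 (Vᵢ.≈ᴹ-trans (Vᵢ.≈ᴹ-sym gv≈w) (Vᵢ.≈ᴹ-trans (LinearMap.⟦⟧-cong g v≈0) (LinearMap.0ᴹ-homo g)))

      module _ (same : SameImage (FactorizationCurve.curve ψᵢ) (FactorizationCurve.curve ψⱼ)) where

        sameImage-incident : ∀ w → NonZero (V j) w → ∃[ v ] NonZero (V i) v × Incident i v (fⱼ w)
        sameImage-incident w w≉0 with proj₂ same w w≉0
        ... | v , v≉0 , line = v , v≉0 , incident-sameLine i v line (incident (incidentCurve ψᵢ) v)

        -- ψᵢ(v) determines the line through v, so a point of V i incident with
        -- two points of ψⱼ forces these to coincide.
        sameImage-nonconstant : ∀ w w′ v → ¬ (minor j w w′ ≈ 0#) → NonZero (V j) w → NonZero (V j) w′ → NonZero (V i) v →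
                                Incident i v (fⱼ w) → Incident i v (fⱼ w′) → ⊥
        sameImage-nonconstant w w′ v minor≉0 w≉0 w′≉0 v≉0 p p′ = minor≉0
          (incident-unique j (fⱼ w) (form-nonzero (incidentCurve ψⱼ) w w≉0) (incident (incidentCurve ψⱼ) w)
            (incident-sameLine j w′ (sameLine-trans H (to-v w′ w′≉0 p′) (sameLine-sym H (to-v w w≉0 p)))
              (incident (incidentCurve ψⱼ) w′)))
          where
          to-v : ∀ w → NonZero (V j) w → Incident i v (fⱼ w) → SameLine H (fⱼ w) (fᵢ v)
          to-v w w≉0 p = from (proj₂ same w w≉0)
            where
            from : ∃[ u ] NonZero (V i) u × SameLine H (fᵢ u) (fⱼ w) → SameLine H (fⱼ w) (fᵢ v)
            from (u , u≉0 , line) = sameLine-trans H (sameLine-sym H line) (sameLine-form (incidentCurve ψᵢ) u v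
              (minor-sameLine i u≉0 v≉0 (incident-unique i (fⱼ w) (form-nonzero (incidentCurve ψⱼ) w w≉0)
                (incident-sameLine i u line (incident (incidentCurve ψᵢ) u)) p)))

-- Fraction-free elimination for matrices of forms

module Elimination (K : CommutativeRing 0ℓ 0ℓ) (F : IsInfiniteField K) (em : ExcludedMiddle 0ℓ) where

  open CommutativeRing K hiding (zero)
  open FieldProperties K F em
  open Solver K
  open LinearAlgebra K
  open Forms K F em
  open RawMonoidDefs +-rawMonoid using (sum)
  open CommutativeMonoidSum +-commutativeMonoid using (sum-remove)
  open SetoidReasoning setoid

  dot : ∀ {n} → (Fin n → Carrier) → (Fin n → Carrier) → Carrier
  dot a x = sum (λ k → a k * x k)

  dot-congʳ : ∀ {n} (a : Fin n → Carrier) {x y} → (∀ k → x k ≈ y k) → dot a x ≈ dot a y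
  dot-congʳ {zero}  a e = refl
  dot-congʳ {suc n} a e = +-cong (*-congˡ (e zero)) (dot-congʳ (a ∘ suc) (e ∘ suc))

  dot-scaleʳ : ∀ {n} c (a x : Fin n → Carrier) → dot a (λ k → c * x k) ≈ c * dot a x
  dot-scaleʳ {zero}  c a x = sym (zeroʳ c)
  dot-scaleʳ {suc n} c a x = trans (+-cong (solve 3 (λ c a x → a :* (c :* x) := c :* (a :* x)) refl c (a zero) (x zero))
    (dot-scaleʳ c (a ∘ suc) (x ∘ suc))) (sym (distribˡ c _ _))

  dot-minus : ∀ {n} c d (a b x : Fin n → Carrier) →
              dot (λ k → c * a k + - (d * b k)) x ≈ c * dot a x + - (d * dot b x)
  dot-minus {zero}  c d a b x = solve 2 (λ c d → :0 := c :* :0 :+ :- (d :* :0)) refl c d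
  dot-minus {suc n} c d a b x = trans (+-congˡ (dot-minus c d (a ∘ suc) (b ∘ suc) (x ∘ suc)))
    (solve 7 (λ c d a b x y z → (c :* a :+ :- (d :* b)) :* x :+ (c :* y :+ :- (d :* z)) :=
                c :* (a :* x :+ y) :+ :- (d :* (b :* x :+ z)))
       refl c d (a zero) (b zero) (x zero) (dot (a ∘ suc) (x ∘ suc)) (dot (b ∘ suc) (x ∘ suc)))

  dot-zeroˡ : ∀ {n} {a : Fin n → Carrier} x → (∀ k → a k ≈ 0#) → dot a x ≈ 0#
  dot-zeroˡ {zero}  x z = refl
  dot-zeroˡ {suc n} x z = trans (+-cong (trans (*-congʳ (z zero)) (zeroˡ _)) (dot-zeroˡ (x ∘ suc) (z ∘ suc))) (+-identityˡ 0#)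

  dot-comm : ∀ {n} (a x : Fin n → Carrier) → dot a x ≈ dot x a
  dot-comm {zero}  a x = refl
  dot-comm {suc n} a x = +-cong (*-comm _ _) (dot-comm (a ∘ suc) (x ∘ suc))

  dot-remove : ∀ {n} p (a x : Fin (suc n) → Carrier) → dot a x ≈ a p * x p + dot (a ∘ punchIn p) (x ∘ punchIn p)
  dot-remove p a x = sum-remove {i = p} (λ k → a k * x k)

  punchIn-cases : ∀ {n} (p : Fin (suc n)) (P : Fin (suc n) → Set) → P p → (∀ q → P (punchIn p q)) → ∀ k → P k
  punchIn-cases p P base step k with p ≟ k
  ... | yes ≡.refl = base
  ... | no p≢k = ≡.subst P (punchIn-punchOut p≢k) (step (punchOut p≢k))

  module _ {V : VectorSpace K} {R : Set} where

    Matrix : ℕ → Set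
    Matrix n = R → Fin n → ∥ V ∥ → Carrier

    InKernel : ∀ {n} → Matrix n → ∥ V ∥ → (Fin n → Carrier) → Set
    InKernel ρ v x = ∀ r → dot (λ k → ρ r k v) x ≈ 0#

    -- Only an upper bound on the kernel: where `D` is nonzero, every kernel vector is a multiple of
    -- `c`. The hypothesis available at `v₀` says no more. That `c` solves the equations comes
    -- later, from points where the kernel is known to be nonzero.
    record PolynomialKernel {n} (ρ : Matrix n) (v₀ : ∥ V ∥) : Set where
      field
        {degree-D degree-c} : ℕ
        D       : ∥ V ∥ → Carrier
        c       : Fin n → ∥ V ∥ → Carrier
        D-form  : IsForm V ⟨K⟩ degree-D D
        c-form  : ∀ k → IsForm V ⟨K⟩ degree-c (c k)
        D≉0     : ¬ (D v₀ ≈ 0#)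
        nonzero : ∀ v → ¬ (D v ≈ 0#) → ∃[ k ] ¬ (c k v ≈ 0#)
        spans   : ∀ v → ¬ (D v ≈ 0#) → ∀ x → InKernel ρ v x → ∃[ a ] ∀ k → x k ≈ a * c k v

    KernelAtMostLine : ∀ {n} → Matrix n → ∥ V ∥ → Set
    KernelAtMostLine ρ v = ∀ x y → InKernel ρ v x → InKernel ρ v y → ∀ k l → x k * y l ≈ x l * y k

    module Pivot {n d} (ρ : Matrix (suc n)) (ρ-form : ∀ r k → IsForm V ⟨K⟩ d (ρ r k)) (s : R) (p : Fin (suc n)) where

      -- Each row is multiplied by the pivot before its multiple of row `s` is subtracted, so
      -- entries stay forms, of twice the degree. Row `s` becomes zero instead of being removed.
      reduced : Matrix n
      reduced r q v = ρ s p v * ρ r (punchIn p q) v + - (ρ r p v * ρ s (punchIn p q) v)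

      reduced-form : ∀ r q → IsForm V ⟨K⟩ (d ℕ.+ d) (reduced r q)
      reduced-form r q = form-minus {V} (form-* {V} {⟨K⟩} (ρ-form s p) (ρ-form r (punchIn p q)))
                                        (form-* {V} {⟨K⟩} (ρ-form r p) (ρ-form s (punchIn p q)))

      row rest : R → ∥ V ∥ → (Fin n → Carrier) → Carrier
      row r v x = dot (λ q → reduced r q v) x
      rest r v x = dot (λ q → ρ r (punchIn p q) v) x

      row≈ : ∀ r v x → row r v x ≈ ρ s p v * rest r v x + - (ρ r p v * rest s v x)
      row≈ r v x = dot-minus (ρ s p v) (ρ r p v) (λ q → ρ r (punchIn p q) v) (λ q → ρ s (punchIn p q) v) x

      restrict : ∀ v x → InKernel ρ v x → InKernel reduced v (x ∘ punchIn p)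
      restrict v x z r = begin
        row r v x′                                              ≈⟨ row≈ r v x′ ⟩
        ρ s p v * rest r v x′ + - (ρ r p v * rest s v x′)
          ≈⟨ solve 5 (λ a b y z t → a :* y :+ :- (b :* z) := a :* (b :* t :+ y) :+ :- (b :* (a :* t :+ z)))
               refl (ρ s p v) (ρ r p v) (rest r v x′) (rest s v x′) (x p) ⟩
        ρ s p v * (ρ r p v * x p + rest r v x′) + - (ρ r p v * (ρ s p v * x p + rest s v x′))
          ≈⟨ +-cong (*-congˡ (zero-row r)) (-‿cong (*-congˡ (zero-row s))) ⟩
        ρ s p v * 0# + - (ρ r p v * 0#)                         ≈⟨ solve 2 (λ a b → a :* :0 :+ :- (b :* :0) := :0) refl _ _ ⟩
        0# ∎
        where
        x′ = x ∘ punchIn p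
        zero-row : ∀ r → ρ r p v * x p + rest r v x′ ≈ 0#
        zero-row r = trans (sym (dot-remove p (λ k → ρ r k v) x)) (z r)

      lift : ∥ V ∥ → Carrier → (Fin n → Carrier) → Fin (suc n) → Carrier
      lift v b x = insertAt x p (- (b * rest s v x))

      -- The missing entry is solved from row `s`, with `b` the inverse of the pivot. The other
      -- equations follow after multiplication by the pivot.
      lift-kernel : ∀ v b x → ρ s p v * b ≈ 1# → InKernel reduced v x → InKernel ρ v (lift v b x)
      lift-kernel v b x ab≈1 z r = *-zero-cancelˡ (λ a≈0 → 0≉1 (trans (sym (trans (*-congʳ a≈0) (zeroˡ b))) ab≈1)) (begin
        a * dot (λ k → ρ r k v) (lift v b x)
          ≈⟨ *-congˡ (trans (dot-remove p (λ k → ρ r k v) (lift v b x))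
               (+-cong (*-congˡ (reflexive (insertAt-lookup x p _)))
                       (dot-congʳ (λ q → ρ r (punchIn p q) v) λ q → reflexive (insertAt-punchIn x p _ q)))) ⟩
        a * (ρ r p v * - (b * rest s v x) + rest r v x)
          ≈⟨ solve 5 (λ a b c y z → a :* (c :* (:- (b :* z)) :+ y) := (a :* y :+ :- (c :* z)) :+ c :* z :* (:1 :+ :- (a :* b)))
               refl a b (ρ r p v) (rest r v x) (rest s v x) ⟩
        (a * rest r v x + - (ρ r p v * rest s v x)) + ρ r p v * rest s v x * (1# + - (a * b))
          ≈⟨ +-cong (trans (sym (row≈ r v x)) (z r)) (*-congˡ (zero-difference (sym ab≈1))) ⟩
        0# + ρ r p v * rest s v x * 0#  ≈⟨ trans (+-identityˡ _) (zeroʳ _) ⟩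
        0# ∎)
        where a = ρ s p v

      reduced-atMostLine : ∀ v → ¬ (ρ s p v ≈ 0#) → KernelAtMostLine ρ v → KernelAtMostLine reduced v
      reduced-atMostLine v a≉0 line x y x∈ y∈ k l = begin
        x k * y l                                                                 ≈⟨ *-cong (at x k) (at y l) ⟨
        lift v b x (punchIn p k) * lift v b y (punchIn p l)
          ≈⟨ line (lift v b x) (lift v b y) (lift-kernel v b x ab x∈) (lift-kernel v b y ab y∈) (punchIn p k) (punchIn p l) ⟩
        lift v b x (punchIn p l) * lift v b y (punchIn p k)                       ≈⟨ *-cong (at x l) (at y k) ⟩
        x l * y k ∎
        where
        b = proj₁ (inverse (ρ s p v) a≉0)
        ab = proj₂ (inverse (ρ s p v) a≉0)
        at : ∀ x k → lift v b x (punchIn p k) ≈ x k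
        at x k = reflexive (insertAt-punchIn x p (- (b * rest s v x)) k)

      module Extend {v₀} (P : PolynomialKernel reduced v₀) (a≉0 : ¬ (ρ s p v₀ ≈ 0#)) where
        open PolynomialKernel P

        -- Row `s` determines the pivot entry up to division by `ρ s p`. The denominator is cleared
        -- by scaling all other entries with `ρ s p` instead.
        at-p : ∥ V ∥ → Carrier
        at-p v = - 1# * rest s v (λ q → c q v)

        scaled : Fin n → ∥ V ∥ → Carrier
        scaled q v = ρ s p v * c q v

        extended : Fin (suc n) → ∥ V ∥ → Carrier
        extended = insertAt scaled p at-p

        extended-p : ∀ v → extended p v ≈ at-p v
        extended-p v = reflexive (≡.cong (λ f → f v) (insertAt-lookup scaled p at-p))

        extended-q : ∀ q v → extended (punchIn p q) v ≈ ρ s p v * c q v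
        extended-q q v = reflexive (≡.cong (λ f → f v) (insertAt-punchIn scaled p at-p q))

        extended-form : ∀ k → IsForm V ⟨K⟩ (d ℕ.+ degree-c) (extended k)
        extended-form = punchIn-cases p (λ k → IsForm V ⟨K⟩ (d ℕ.+ degree-c) (extended k))
          (equal (λ v → sym (extended-p v)) (form-scale {V} {⟨K⟩} (- 1#)
            (form-sum {V} {⟨K⟩} λ q → form-* {V} {⟨K⟩} (ρ-form s (punchIn p q)) (c-form q))))
          (λ q → equal (λ v → sym (extended-q q v)) (form-* {V} {⟨K⟩} (ρ-form s p) (c-form q)))

        extended-spans : ∀ v → ¬ (ρ s p v * D v ≈ 0#) → ∀ x → InKernel ρ v x → ∃[ a ] ∀ k → x k ≈ a * extended k v
        extended-spans v ne x x∈ = a * b , punchIn-cases p (λ k → x k ≈ (a * b) * extended k v)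
          (*-cancelˡ-nonzero (*-nonzeroˡ ne) (begin
            e * x p                             ≈⟨ solve 2 (λ y z → y := :- z :+ (y :+ z)) refl (e * x p) (rest s v x′) ⟩
            - rest s v x′ + (e * x p + rest s v x′)
              ≈⟨ +-cong (-‿cong (dot-congʳ (λ q → ρ s (punchIn p q) v) x′≈)) (trans (sym (dot-remove p (λ k → ρ s k v) x)) (x∈ s)) ⟩
            - rest s v (λ q → a * c q v) + 0#   ≈⟨ +-congʳ (-‿cong (dot-scaleʳ a (λ q → ρ s (punchIn p q) v) (λ q → c q v))) ⟩
            - (a * S) + 0#                      ≈⟨ +-congʳ (-‿cong (*-congʳ (sym (trans (*-congˡ eb≈1) (*-identityʳ a))))) ⟩
            - (a * (e * b) * S) + 0#            ≈⟨ solve 4 (λ a e b s → :- (a :* (e :* b) :* s) :+ :0 := e :* ((a :* b) :* ((:- :1) :* s))) refl a e b S ⟩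
            e * ((a * b) * at-p v)              ≈⟨ *-congˡ (*-congˡ (extended-p v)) ⟨
            e * ((a * b) * extended p v) ∎))
          (λ q → begin
            x (punchIn p q)                     ≈⟨ x′≈ q ⟩
            a * c q v                           ≈⟨ *-identityʳ _ ⟨
            a * c q v * 1#                      ≈⟨ *-congˡ eb≈1 ⟨
            a * c q v * (e * b)                 ≈⟨ solve 4 (λ a c e b → a :* c :* (e :* b) := (a :* b) :* (e :* c)) refl a (c q v) e b ⟩
            (a * b) * (e * c q v)               ≈⟨ *-congˡ (extended-q q v) ⟨
            (a * b) * extended (punchIn p q) v ∎)
          where
          e = ρ s p v
          b = proj₁ (inverse e (*-nonzeroˡ ne))
          eb≈1 = proj₂ (inverse e (*-nonzeroˡ ne))
          x′ = x ∘ punchIn p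
          S = rest s v (λ q → c q v)
          spanned = spans v (*-nonzeroʳ ne) x′ (restrict v x x∈)
          a = proj₁ spanned
          x′≈ : ∀ q → x′ q ≈ a * c q v
          x′≈ = proj₂ spanned

        kernel : PolynomialKernel ρ v₀
        kernel = record
          { D = λ v → ρ s p v * D v
          ; c = extended
          ; D-form = form-* {V} {⟨K⟩} (ρ-form s p) D-form
          ; c-form = extended-form
          ; D≉0 = *-nonzero a≉0 D≉0
          ; nonzero = λ v ne → let (q , cq≉0) = nonzero v (*-nonzeroʳ ne) in
              punchIn p q , λ e → *-nonzero (*-nonzeroˡ ne) cq≉0 (trans (sym (extended-q q v)) e)
          ; spans = extended-spans
          }

    polynomialKernel : ∀ n {d} (ρ : Matrix (suc n)) → (∀ r k → IsForm V ⟨K⟩ d (ρ r k)) →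
                       ∀ v₀ → KernelAtMostLine ρ v₀ → PolynomialKernel ρ v₀
    polynomialKernel zero ρ ρ-form v₀ line = record
      { D = λ _ → 1# ; c = λ _ _ → 1# ; D-form = const 1# ; c-form = λ _ → const 1#
      ; D≉0 = 1≉0 ; nonzero = λ _ _ → zero , 1≉0
      ; spans = λ v _ x _ → x zero , λ { zero → sym (*-identityʳ _) }
      }
    polynomialKernel (suc n) ρ ρ-form v₀ line = pivot
      -- A pivot exists: were all entries zero at `v₀`, two different unit vectors would lie in the
      -- kernel, contradicting `line`.
      (nonzero-member (λ (r , k) → ρ r k v₀) λ z → 0≉1 (begin
        0#                        ≈⟨ zeroˡ 0# ⟨
        0# * 0#                   ≈⟨ line (δ zero) (δ (suc zero)) (λ r → dot-zeroˡ (δ zero) λ k → z (r , k))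
                                       (λ r → dot-zeroˡ (δ (suc zero)) λ k → z (r , k)) (suc zero) zero ⟩
        1# * 1#                   ≈⟨ *-identityˡ 1# ⟩
        1# ∎))
      where
      δ : Fin (suc (suc n)) → Fin (suc (suc n)) → Carrier
      δ k = upd k 1# (λ _ → 0#)
      pivot : ∃[ (r , k) ] ¬ (ρ r k v₀ ≈ 0#) → PolynomialKernel ρ v₀
      pivot ((s , p) , a≉0) = Pivot.Extend.kernel ρ ρ-form s p
        (polynomialKernel n (Pivot.reduced ρ ρ-form s p) (Pivot.reduced-form ρ ρ-form s p) v₀
          (Pivot.reduced-atMostLine ρ ρ-form s p v₀ a≉0 line)) a≉0

-- The real numbers and ℝ[i] as infinite fields

module RealAndComplexFields (reals : Reals) where

  open Reals reals using (0≉1; inverse; _≤_; isTotalOrder; +-monoˡ-≤; *-nonNeg)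
  ℝ : CommutativeRing 0ℓ 0ℓ
  ℝ = Reals.commutativeRing reals

  open CommutativeRing ℝ hiding (zero)
  open Solver ℝ
  open IsTotalOrder isTotalOrder using (total; antisym) renaming (trans to ≤-trans; reflexive to ≤-reflexive)
  module ℂ = CommutativeRing (Complexification.ℂ ℝ)

  square-nonneg : ∀ x → 0# ≤ x * x
  square-nonneg x with total 0# x
  ... | inj₁ 0≤x = *-nonNeg 0≤x 0≤x
  ... | inj₂ x≤0 = ≤-trans (*-nonNeg 0≤-x 0≤-x) (≤-reflexive (solve 1 (λ x → (:- x) :* (:- x) := x :* x) refl x))
    where
    0≤-x : 0# ≤ - x
    0≤-x = ≤-trans (≤-reflexive (sym (-‿inverseʳ x))) (≤-trans (+-monoˡ-≤ (- x) x≤0) (≤-reflexive (+-identityˡ _)))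

  +-nonneg : ∀ {x y} → 0# ≤ x → 0# ≤ y → 0# ≤ x + y
  +-nonneg {x} {y} 0≤x 0≤y = ≤-trans 0≤y (≤-trans (≤-reflexive (sym (+-identityˡ y))) (+-monoˡ-≤ y 0≤x))

  nonneg-sum-zero : ∀ {x y} → 0# ≤ x → 0# ≤ y → x + y ≈ 0# → x ≈ 0#
  nonneg-sum-zero {x} {y} 0≤x 0≤y e = antisym
    (≤-trans (≤-reflexive (sym (+-identityˡ x))) (≤-trans (+-monoˡ-≤ x 0≤y) (≤-reflexive (trans (+-comm y x) e)))) 0≤x

  natural : ℕ → Carrier
  natural zero    = 0#
  natural (suc n) = 1# + natural n

  0≤1 : 0# ≤ 1#
  0≤1 = ≤-trans (square-nonneg 1#) (≤-reflexive (*-identityˡ 1#))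

  natural-nonneg : ∀ n → 0# ≤ natural n
  natural-nonneg zero    = ≤-reflexive refl
  natural-nonneg (suc n) = +-nonneg 0≤1 (natural-nonneg n)

  natural-suc-nonzero : ∀ n → ¬ (natural (suc n) ≈ 0#)
  natural-suc-nonzero n e = 0≉1 (sym (nonneg-sum-zero 0≤1 (natural-nonneg n) e))

  natural-injective : ∀ i j → natural i ≈ natural j → i ≡ j
  natural-injective zero    zero    e = ≡.refl
  natural-injective zero    (suc j) e = ⊥-elim (natural-suc-nonzero j (sym e))
  natural-injective (suc i) zero    e = ⊥-elim (natural-suc-nonzero i e)
  natural-injective (suc i) (suc j) e = ≡.cong suc (natural-injective i j (difference-zero (trans
    (solve 2 (λ x y → x :+ :- y := (:1 :+ x) :+ :- (:1 :+ y)) refl (natural i) (natural j)) (zero-difference e))))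

  ℝ-field : IsInfiniteField ℝ
  ℝ-field = record { 0≉1 = 0≉1 ; inverse = inverse ; point = natural ; point-injective = natural-injective }

  module _ (em : ExcludedMiddle 0ℓ) where
    open FieldProperties ℝ ℝ-field em using (*-nonzero)

    -- Squares are nonnegative, so neither summand can cancel the other. This makes `a² + b²`
    -- available as the denominator of a complex inverse.
    norm-nonzero : ∀ a b → ¬ (a ≈ 0# × b ≈ 0#) → ¬ (a * a + b * b ≈ 0#)
    norm-nonzero a b ne e = ne (zero-of a (nonneg-sum-zero (square-nonneg a) (square-nonneg b) e)
      , zero-of b (nonneg-sum-zero (square-nonneg b) (square-nonneg a) (trans (+-comm _ _) e)))
      where
      zero-of : ∀ x → x * x ≈ 0# → x ≈ 0#
      zero-of x x²≈0 with em {x ≈ 0#}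
      ... | yes x≈0 = x≈0
      ... | no x≉0 = ⊥-elim (*-nonzero x≉0 x≉0 x²≈0)

    ℂ-inverse : ∀ x → ¬ (x ℂ.≈ ℂ.0#) → ∃[ y ] x ℂ.* y ℂ.≈ ℂ.1#
    ℂ-inverse (a , b) ne with inverse (a * a + b * b) (norm-nonzero a b ne)
    ... | y , e = (a * y , - (b * y)) ,
      trans (solve 3 (λ a b y → a :* (a :* y) :+ (:- b) :* (:- (b :* y)) := (a :* a :+ b :* b) :* y) refl a b y) e ,
      solve 3 (λ a b y → a :* (:- (b :* y)) :+ b :* (a :* y) := :0) refl a b y

    ℂ-field : IsInfiniteField (Complexification.ℂ ℝ)
    ℂ-field = record
      { 0≉1 = λ e → 0≉1 (proj₁ e)
      ; inverse = ℂ-inverse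
      -- The test points of ℂ are chosen real: a complex polynomial that vanishes at real arguments
      -- is then zero.
      ; point = λ n → natural n , 0#
      ; point-injective = λ i j e → natural-injective i j (proj₁ e)
      }

-- Complexified vectors and forms

module ComplexScalars (R : CommutativeRing 0ℓ 0ℓ) where

  open CommutativeRing R hiding (zero)
  open Solver R
  open Complexification R using (fromReal; 𝕚)
  module ℂ = CommutativeRing (complexNumbers R)

  real-* : ∀ {z a x y} → z ℂ.≈ fromReal a → (z ℂ.* (x , y)) ℂ.≈ (a * x , a * y)
  real-* {z} {a} {x} {y} e = ℂ.trans (ℂ.*-congʳ {x , y} {z} {fromReal a} e)
    ( solve 3 (λ a x y → a :* x :+ (:- :0) :* y := a :* x) refl a x y
    , solve 3 (λ a x y → a :* y :+ :0 :* x := a :* y) refl a x y )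

  real+𝕚 : ∀ {z w x y} → z ℂ.≈ fromReal x → w ℂ.≈ fromReal y → (z ℂ.+ 𝕚 ℂ.* w) ℂ.≈ (x , y)
  real+𝕚 {z} {w} {x} {y} e e′ = ℂ.trans (ℂ.+-cong {z} {fromReal x} {𝕚 ℂ.* w} {𝕚 ℂ.* fromReal y} e (ℂ.*-congˡ {𝕚} {w} {fromReal y} e′))
    ( solve 2 (λ x y → x :+ (:0 :* y :+ (:- :1) :* :0) := x) refl x y
    , solve 1 (λ y → :0 :+ (:0 :* :0 :+ :1 :* y) := y) refl y )

module ComplexVectors (R : CommutativeRing 0ℓ 0ℓ) (FR : IsInfiniteField R)
                      (Fℂ : IsInfiniteField (complexNumbers R)) (em : ExcludedMiddle 0ℓ) where

  open CommutativeRing R hiding (zero)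
  open RingProperties ring using (-0#≈0#)
  open Complexification R using (fromReal; 𝕚; dual⊗ℂ; tensor⊗ℂ; fromReal-*; fromReal-+)
  module ℂ = CommutativeRing (complexNumbers R)
  module Lℂ = LinearAlgebra (complexNumbers R)
  open ComplexScalars R public hiding (module ℂ)
  module LR = LinearAlgebra R
  open LR using (Covector; LinearMap; ∥_∥; Dual; V*; IsForm; ⟨K⟩; const; times; plus; equal)
  open LR.LinearMap using (⟦_⟧)
  open Lℂ.LinearMap using () renaming (⟦_⟧ to ⟦_⟧ᶜ)
  module VR = VectorSpaces R FR em
  module VC = VectorSpaces (complexNumbers R) Fℂ em

  module _ (V : VectorSpace R) where
    open LeftModule V
    private module Vᶜ = LeftModule (complexSpace R V)

    real : ∥ V ∥ → Lℂ.∥ complexSpace R V ∥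
    real v = v , 0ᴹ

    *-real : ∀ a b v → (a , b) Vᶜ.*ₗ real v Vᶜ.≈ᴹ (a *ₗ v , b *ₗ v)
    *-real a b v =
      ≈ᴹ-trans (+ᴹ-congˡ (*ₗ-zeroʳ (- b))) (+ᴹ-identityʳ _) ,
      ≈ᴹ-trans (+ᴹ-congʳ (*ₗ-zeroʳ a)) (+ᴹ-identityˡ _)

    real-*-real : ∀ a v → fromReal a Vᶜ.*ₗ real v Vᶜ.≈ᴹ real (a *ₗ v)
    real-*-real a v = proj₁ (*-real a 0# v) , ≈ᴹ-trans (proj₂ (*-real a 0# v)) (*ₗ-zeroˡ v)

    combination-real : ∀ {n} (c : Fin n → ℂ.Carrier) (b : Fin n → ∥ V ∥) →
      Lℂ.linearCombination (complexSpace R V) c (λ k → real (b k)) Vᶜ.≈ᴹ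
      (LR.linearCombination V (proj₁ ∘ c) b , LR.linearCombination V (proj₂ ∘ c) b)
    combination-real {zero}  c b = Vᶜ.≈ᴹ-refl
    combination-real {suc n} c b = Vᶜ.+ᴹ-cong {c zero Vᶜ.*ₗ real (b zero)} (*-real (proj₁ (c zero)) (proj₂ (c zero)) (b zero))
      (combination-real (c ∘ suc) (b ∘ suc))

  -- A complex combination of real vectors splits into two real combinations, one for the real and
  -- one for the imaginary parts of the coefficients.
  basisℂ : ∀ {V n} → VR.Basis V n → VC.Basis (complexSpace R V) n
  basisℂ {V} {n} B = VC.mkBasis
    ( (λ k → real V (VR.basis B k)) , (λ _ → tt)
    , (λ c e i → let e′ = Vᶜ.≈ᴹ-trans (Vᶜ.≈ᴹ-sym (combination-real V c (VR.basis B))) e in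
        independent (proj₁ ∘ c) (proj₁ e′) i , independent (proj₂ ∘ c) (proj₂ e′) i)
    , λ (x , y) _ → (λ k → ⟦ VR.coordinate B k ⟧ x , ⟦ VR.coordinate B k ⟧ y) ,
        Vᶜ.≈ᴹ-trans {x , y} (VR.expand B x , VR.expand B y)
          (Vᶜ.≈ᴹ-sym (combination-real V (λ k → ⟦ VR.coordinate B k ⟧ x , ⟦ VR.coordinate B k ⟧ y) (VR.basis B))) )
    where
    module Vᶜ = LeftModule (complexSpace R V)
    independent : ∀ (c : Fin n → Carrier) → LeftModule._≈ᴹ_ V (LR.linearCombination V c (VR.basis B)) (LeftModule.0ᴹ V) → ∀ i → c i ≈ 0#
    independent = proj₁ (proj₂ (proj₂ (VR.Basis.dimension B)))

  dual⊗ℂ-apply : ∀ {V} (ξ : Covector V) x y → ⟦ dual⊗ℂ {V} ξ ⟧ᶜ (x , y) ℂ.≈ (⟦ ξ ⟧ x , ⟦ ξ ⟧ y)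
  dual⊗ℂ-apply ξ x y = real+𝕚 {fromReal (⟦ ξ ⟧ x)} {fromReal (⟦ ξ ⟧ y)} ℂ.refl ℂ.refl

  dual⊗ℂ-real : ∀ {V} (ξ : Covector V) v → ⟦ dual⊗ℂ {V} ξ ⟧ᶜ (real V v) ℂ.≈ fromReal (⟦ ξ ⟧ v)
  dual⊗ℂ-real {V} ξ v = ℂ.trans {⟦ dual⊗ℂ {V} ξ ⟧ᶜ (real V v)} (dual⊗ℂ-apply {V} ξ v _) (refl , VR.cov-0 ξ)

  record ComplexForm {V M : VectorSpace R} (e : ℕ) (f : ∥ V ∥ → ∥ M ∥) : Set where
    field
      form    : Lℂ.∥ complexSpace R V ∥ → Lℂ.∥ complexSpace R M ∥
      isForm  : Lℂ.IsForm (complexSpace R V) (complexSpace R M) e form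
      at-real : ∀ v → LeftModule._≈ᴹ_ (complexSpace R M) (form (real V v)) (real M (f v))

  -- The extension is read off from the derivation of `IsForm`; the function `f` itself cannot be
  -- evaluated at complex vectors.
  complexForm : ∀ {V M e f} → IsForm V M e f → ComplexForm {V} {M} e f
  complexForm {M = M} (const a) = record { form = λ _ → real M a ; isForm = Lℂ.const _ ; at-real = λ v → LeftModule.≈ᴹ-refl (complexSpace R M) }
  complexForm {V} {M} (times {f = f} ξ p) = record
    { form = λ z → ⟦ dual⊗ℂ {V} ξ ⟧ᶜ z Mᶜ.*ₗ P.form z
    ; isForm = Lℂ.times (dual⊗ℂ {V} ξ) P.isForm
    ; at-real = λ v → Mᶜ.≈ᴹ-trans (Mᶜ.*ₗ-cong {⟦ dual⊗ℂ {V} ξ ⟧ᶜ (real V v)} {fromReal (⟦ ξ ⟧ v)} (dual⊗ℂ-real {V} ξ v) (P.at-real v))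
                                  (real-*-real M (⟦ ξ ⟧ v) (f v))
    }
    where
    module Mᶜ = LeftModule (complexSpace R M)
    module P = ComplexForm (complexForm p)
  complexForm {V} {M} (plus p q) = record
    { form = λ z → P.form z Mᶜ.+ᴹ Q.form z
    ; isForm = Lℂ.plus P.isForm Q.isForm
    ; at-real = λ v → Mᶜ.≈ᴹ-trans (Mᶜ.+ᴹ-cong (P.at-real v) (Q.at-real v))
                                  (LeftModule.≈ᴹ-refl M , LeftModule.+ᴹ-identityˡ M _)
    }
    where
    module Mᶜ = LeftModule (complexSpace R M)
    module P = ComplexForm (complexForm p)
    module Q = ComplexForm (complexForm q)
  complexForm {V} {M} (equal e p) = record
    { form = P.form ; isForm = P.isForm
    ; at-real = λ v → LeftModule.≈ᴹ-trans (complexSpace R M) (P.at-real v) (e v , LeftModule.≈ᴹ-refl M) }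
    where module P = ComplexForm (complexForm p)

  record ComplexScalarForm {V : VectorSpace R} (e : ℕ) (f : ∥ V ∥ → Carrier) : Set where
    field
      form    : Lℂ.∥ complexSpace R V ∥ → ℂ.Carrier
      isForm  : Lℂ.IsForm (complexSpace R V) Lℂ.⟨K⟩ e form
      at-real : ∀ v → form (real V v) ℂ.≈ fromReal (f v)

  complexScalarForm : ∀ {V e f} → IsForm V ⟨K⟩ e f → ComplexScalarForm {V} e f
  complexScalarForm {V} p = record
    { form = P.form
    ; isForm = Forms.form-map (complexNumbers R) Fℂ em {complexSpace R V} {complexSpace R ⟨K⟩} identification P.isForm
    ; at-real = P.at-real
    }
    where
    module P = ComplexForm (complexForm {V} {⟨K⟩} p)
    -- The identity on carriers, between the complexified real line and ℂ as a module over itself,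
    -- which are different module records.
    identification : Lℂ.LinearMap (complexSpace R ⟨K⟩) Lℂ.⟨K⟩
    identification = Lℂ.mkLinearMap (λ z → z) (λ e → e) (λ x y → ℂ.refl {x ℂ.+ y}) (λ c x → ℂ.refl {c ℂ.* x})

  -- A complex form is a polynomial along x + z y, with x and y real vectors;
  -- if it vanishes at real vectors, it vanishes for infinitely many z, hence
  -- for z = i.
  module _ (real-points : ∀ n → IsInfiniteField.point Fℂ n ℂ.≈ fromReal (IsInfiniteField.point FR n)) where

    vanishes-at-real : ∀ {V e g} → Lℂ.IsForm (complexSpace R V) Lℂ.⟨K⟩ e g → (∀ v → g (real V v) ℂ.≈ ℂ.0#) → ∀ z → g z ℂ.≈ ℂ.0#
    vanishes-at-real {V} {g = g} p vanish (x , y) =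
      ℂ.trans {g (x , y)} {g (real V x Vᶜ.+ᴹ 𝕚 Vᶜ.*ₗ real V y)}
        (form-cong p ( V.≈ᴹ-sym (V.≈ᴹ-trans (V.+ᴹ-congˡ (V.≈ᴹ-trans (proj₁ (*-real V 0# 1# y)) (V.*ₗ-zeroˡ y))) (V.+ᴹ-identityʳ x))
                     , V.≈ᴹ-sym (V.≈ᴹ-trans (V.+ᴹ-congˡ (V.≈ᴹ-trans (proj₂ (*-real V 0# 1# y)) (V.*ₗ-identityˡ y))) (V.+ᴹ-identityˡ y)) ))
        (Polynomials.poly-vanishes (complexNumbers R) Fℂ em (form-line {complexSpace R V} p (real V x) (real V y)) at-point 𝕚)
      where
      module V = LeftModule V
      module Vᶜ = LeftModule (complexSpace R V)
      open Forms (complexNumbers R) Fℂ em using (form-cong; form-line)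
      at-point : ∀ n → g (real V x Vᶜ.+ᴹ IsInfiniteField.point Fℂ n Vᶜ.*ₗ real V y) ℂ.≈ ℂ.0#
      at-point n = ℂ.trans {g (real V x Vᶜ.+ᴹ IsInfiniteField.point Fℂ n Vᶜ.*ₗ real V y)} {g (real V (x V.+ᴹ r V.*ₗ y))} (form-cong p
        (Vᶜ.≈ᴹ-trans (Vᶜ.+ᴹ-congˡ {real V x} (Vᶜ.≈ᴹ-trans (Vᶜ.*ₗ-congʳ {real V y} {IsInfiniteField.point Fℂ n} {fromReal r} (real-points n)) (real-*-real V r y)))
          (V.≈ᴹ-refl , V.+ᴹ-identityˡ V.0ᴹ))) (vanish (x V.+ᴹ r V.*ₗ y))
        where r = IsInfiniteField.point FR n

-- Counting a subset by weights

natSum : ∀ {n} → (Fin n → ℕ) → ℕ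
natSum {zero}  w = 0
natSum {suc n} w = w zero ℕ.+ natSum (w ∘ suc)

maskℕ : Bool → ℕ → ℕ
maskℕ true  n = n
maskℕ false n = 0

size-≤-sum : ∀ {n} (T : Subset n) (w : Fin n → ℕ) → (∀ i → lookup T i ≡ true → 1 ℕ.≤ w i) → ∣ T ∣ ℕ.≤ natSum w
size-≤-sum []          w w≥1 = z≤n
size-≤-sum (true ∷ T)  w w≥1 = ℕₚ.+-mono-≤ (w≥1 zero ≡.refl) (size-≤-sum T (w ∘ suc) (w≥1 ∘ suc))
size-≤-sum (false ∷ T) w w≥1 = ℕₚ.m≤n⇒m≤o+n (w zero) (size-≤-sum T (w ∘ suc) (w≥1 ∘ suc))

-- Every member of `T` already accounts for one unit of the sum, so the bound leaves no room for a
-- larger weight.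
sum-minimal : ∀ {n} (T : Subset n) (w : Fin n → ℕ) → (∀ i → lookup T i ≡ true → 1 ℕ.≤ w i) →
              natSum w ℕ.≤ ∣ T ∣ → ∀ i → lookup T i ≡ true → w i ≡ 1
sum-minimal (true ∷ T) w w≥1 bound zero _ = ℕₚ.≤-antisym
  (ℕₚ.+-cancelʳ-≤ ∣ T ∣ (w zero) 1 (ℕₚ.≤-trans (ℕₚ.+-monoʳ-≤ (w zero) (size-≤-sum T (w ∘ suc) (w≥1 ∘ suc))) bound))
  (w≥1 zero ≡.refl)
sum-minimal (true ∷ T) w w≥1 bound (suc i) i∈T = sum-minimal T (w ∘ suc) (w≥1 ∘ suc)
  (ℕₚ.≤-pred (ℕₚ.≤-trans (ℕₚ.+-monoˡ-≤ (natSum (w ∘ suc)) (w≥1 zero ≡.refl)) bound)) i i∈T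
sum-minimal (false ∷ T) w w≥1 bound (suc i) i∈T = sum-minimal T (w ∘ suc) (w≥1 ∘ suc)
  (ℕₚ.m+n≤o⇒n≤o (w zero) bound) i i∈T

-- Dividing a family of polynomials by the ratios of its slots

module Splitting (K : CommutativeRing 0ℓ 0ℓ) (F : IsInfiniteField K) (em : ExcludedMiddle 0ℓ) {m : ℕ} where

  open CommutativeRing K hiding (zero)
  open FieldProperties K F em
  open Solver K
  open Polynomials K F em
  open Products K
  open SetoidReasoning setoid

  -- The coordinates of a tensor that depends on one affine parameter.
  Family : Set
  Family = Vec (Fin 2) m → Carrier → Carrier

  -- A map from the projective line to itself, in lowest terms and of degree `degree`. `top` names a
  -- component in which this degree is attained, so that degrees can be read off from leading
  -- coefficients.
  record PrimitivePair : Set where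
    field
      R u      : Fin 2 → Carrier → Carrier
      u-poly   : ∀ c → IsPoly (u c)
      bezout   : ∀ t → u 0F t * R 0F t + u 1F t * R 1F t ≈ 1#
      degree   : ℕ
      R-poly   : ∀ c → ∃[ a ] Poly degree a (R c)
      top      : Fin 2
      lead     : Carrier
      lead≉0   : ¬ (lead ≈ 0#)
      top-poly : Poly degree lead (R top)

  -- The two halves of `f` in slot `i` have the ratio of the two components of `R`, written by
  -- cross-multiplication.
  Splits : Fin m → Family → (Fin 2 → Carrier → Carrier) → Set
  Splits i f R = ∀ s c t → f s t * R c t ≈ f (s [ i ]≔ c) t * R (lookup s i) t

  Independent : Fin m → Family → Set
  Independent i f = ∀ s c t → f (s [ i ]≔ c) t ≈ f s t

  HasDegree≤ : ℕ → Family → Set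
  HasDegree≤ e f = ∀ s → ∃[ a ] Poly e a (f s)

  Nonzero : Family → Set
  Nonzero f = ∃[ s ] ¬ Vanishes (f s)

  zero-poly : ∀ {f} n → Vanishes f → ∃[ a ] Poly n a f
  zero-poly n z = raise-to z≤n (constant z)

  primitivePair : ∀ {a b} (c : CoprimeFactorization a b) → Σ PrimitivePair λ P →
    (∀ t → PrimitivePair.R P 0F t ≈ CoprimeFactorization.p c t) × (∀ t → PrimitivePair.R P 1F t ≈ CoprimeFactorization.q c t)
  primitivePair c = build em em
    where
    open CoprimeFactorization c
    R u′ : Fin 2 → Carrier → Carrier
    R 0F = p
    R 1F = q
    u′ 0F = u
    u′ 1F = v
    u′-poly : ∀ c → IsPoly (u′ c)
    u′-poly 0F = u-poly
    u′-poly 1F = v-poly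
    both : ∀ {n a b} → Poly n a p → Poly n b q → ∀ c → ∃[ a ] Poly n a (R c)
    both P Q 0F = _ , P
    both P Q 1F = _ , Q
    pair : ∀ n → (∀ c → ∃[ a ] Poly n a (R c)) → ∀ top lead → ¬ (lead ≈ 0#) → Poly n lead (R top) →
           Σ PrimitivePair λ P → (∀ t → PrimitivePair.R P 0F t ≈ p t) × (∀ t → PrimitivePair.R P 1F t ≈ q t)
    pair n R-poly top lead lead≉0 top-poly = record
      { R = R ; u = u′ ; u-poly = u′-poly ; bezout = bezout ; degree = n ; R-poly = R-poly
      ; top = top ; lead = lead ; lead≉0 = lead≉0 ; top-poly = top-poly } , (λ _ → refl) , (λ _ → refl)
    build : Dec (Vanishes p) → Dec (Vanishes q) →
            Σ PrimitivePair λ P → (∀ t → PrimitivePair.R P 0F t ≈ p t) × (∀ t → PrimitivePair.R P 1F t ≈ q t)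
    build (yes p≈0) (yes q≈0) = ⊥-elim (0≉1 (trans (solve 2 (λ u v → :0 := u :* :0 :+ v :* :0) refl (u 0#) (v 0#))
      (trans (sym (+-cong (*-congˡ (p≈0 0#)) (*-congˡ (q≈0 0#)))) (bezout 0#))))
    build (yes p≈0) (no q≉0) with exact-degree (proj₂ (proj₂ q-poly)) q≉0
    ... | n , l , _ , l≉0 , Q = pair n (both (proj₂ (zero-poly n p≈0)) Q) 1F l l≉0 Q
    build (no p≉0) (yes q≈0) with exact-degree (proj₂ (proj₂ p-poly)) p≉0
    ... | n , l , _ , l≉0 , P = pair n (both P (proj₂ (zero-poly n q≈0))) 0F l l≉0 P
    build (no p≉0) (no q≉0) with exact-degree (proj₂ (proj₂ p-poly)) p≉0 | exact-degree (proj₂ (proj₂ q-poly)) q≉0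
    ... | n , l , _ , l≉0 , P | k , l′ , _ , l′≉0 , Q with ℕₚ.≤-total n k
    ...   | inj₁ n≤k = pair k (both (proj₂ (raise-to n≤k P)) Q) 1F l′ l′≉0 Q
    ...   | inj₂ k≤n = pair n (both P (proj₂ (raise-to k≤n Q))) 0F l l≉0 P

  Minors : Fin m → Family → Set
  Minors i f = ∀ s s′ t → f (s [ i ]≔ 0F) t * f (s′ [ i ]≔ 1F) t ≈ f (s′ [ i ]≔ 0F) t * f (s [ i ]≔ 1F) t

  -- The common ratio of the two halves of f in slot i, in lowest terms.
  split-from-minors : ∀ {e f} i → HasDegree≤ e f → Nonzero f → Minors i f →
                      Σ PrimitivePair λ P → Splits i f (PrimitivePair.R P)
  split-from-minors {e} {f} i f-poly (s₀ , fs₀≉0) minors = proj₁ P , splits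
    where
    a b : Carrier → Carrier
    a = f (s₀ [ i ]≔ 0F)
    b = f (s₀ [ i ]≔ 1F)
    poly : ∀ s → IsPoly (f s)
    poly s = e , f-poly s
    c = coprimeFactorization (poly (s₀ [ i ]≔ 0F)) (poly (s₀ [ i ]≔ 1F))
    open CoprimeFactorization c
    P = primitivePair c
    R = PrimitivePair.R (proj₁ P)
    -- The obstruction to splitting at the index `s`. The minor of `s₀` and `s` only shows that `g`
    -- times it vanishes.
    D : Vec (Fin 2) m → Carrier → Carrier
    D s t = p t * f (s [ i ]≔ 1F) t + - (q t * f (s [ i ]≔ 0F) t)
    gD : ∀ s t → g t * D s t ≈ 0#
    gD s t = trans
      (solve 5 (λ g p q x y → g :* (p :* x :+ :- (q :* y)) := (g :* p) :* x :+ :- (y :* (g :* q))) refl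
             (g t) (p t) (q t) (f (s [ i ]≔ 1F) t) (f (s [ i ]≔ 0F) t))
      (zero-difference (trans (*-congʳ (sym (a≈gp t))) (trans (minors s₀ s t) (*-congˡ (b≈gq t)))))
    D-poly : ∀ s → IsPoly (D s)
    D-poly s = isPoly-+ (isPoly-* p-poly (poly _)) (isPoly-neg (isPoly-* q-poly (poly _)))
    D-kills : ∀ s {x h} → (∀ t → x t ≈ g t * h t) → ∀ t → D s t * x t ≈ 0#
    D-kills s {x} {h} e t = trans (*-congˡ (e t)) (trans (solve 3 (λ d g h → d :* (g :* h) := (g :* d) :* h) refl (D s t) (g t) (h t))
      (trans (*-congʳ (gD s t)) (zeroˡ _)))
    D≈0 : ∀ s → Vanishes (D s)
    -- Of the two halves at `s₀`, the one containing `f s₀` is a nonzero polynomial. It is a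
    -- multiple of `g`, so the obstruction times it vanishes and can be cancelled.
    D≈0 s = by-entry (lookup s₀ i) (λ z → fs₀≉0 (≡.subst (λ s → Vanishes (f s)) ([]≔-lookup s₀ i) z))
      where
      by-entry : ∀ c → ¬ Vanishes (f (s₀ [ i ]≔ c)) → Vanishes (D s)
      by-entry 0F ne = no-zero-divisors {g = a} (D-poly s) (poly (s₀ [ i ]≔ 0F)) (D-kills s {a} {p} a≈gp) ne
      by-entry 1F ne = no-zero-divisors {g = b} (D-poly s) (poly (s₀ [ i ]≔ 1F)) (D-kills s {b} {q} b≈gq) ne
    pF₁≈qF₀ : ∀ s t → f (s [ i ]≔ 1F) t * R 0F t ≈ f (s [ i ]≔ 0F) t * R 1F t
    pF₁≈qF₀ s t = trans (*-congˡ (proj₁ (proj₂ P) t)) (trans (*-comm _ _)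
      (trans (difference-zero (D≈0 s t)) (trans (*-comm _ _) (*-congˡ (sym (proj₂ (proj₂ P) t))))))
    entries : ∀ s l c t → f (s [ i ]≔ l) t * R c t ≈ f (s [ i ]≔ c) t * R l t
    entries s 0F 0F t = refl
    entries s 0F 1F t = sym (pF₁≈qF₀ s t)
    entries s 1F 0F t = pF₁≈qF₀ s t
    entries s 1F 1F t = refl
    splits : Splits i f R
    splits s c t = trans (*-congʳ (reflexive (≡.cong (λ s → f s t) (≡.sym ([]≔-lookup s i))))) (entries s (lookup s i) c t)

  module Quotient (P : PrimitivePair) (i : Fin m) (f : Family) (splits : Splits i f (PrimitivePair.R P)) where
    open PrimitivePair P

    -- Division by `R` through Bezout: if `f s t` is `R (lookup s i) t` times `h t`, then
    -- `u₀ R₀ h + u₁ R₁ h = h`. The result is visibly polynomial and independent of slot `i`.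
    quotient : Family
    quotient s t = u 0F t * f (s [ i ]≔ 0F) t + u 1F t * f (s [ i ]≔ 1F) t

    factors : ∀ s t → f s t ≈ R (lookup s i) t * quotient s t
    factors s t = begin
      f s t                                                             ≈⟨ *-identityʳ _ ⟨
      f s t * 1#                                                        ≈⟨ *-congˡ (bezout t) ⟨
      f s t * (u 0F t * R 0F t + u 1F t * R 1F t)
        ≈⟨ solve 5 (λ x a b c d → x :* (a :* b :+ c :* d) := a :* (x :* b) :+ c :* (x :* d)) refl (f s t) (u 0F t) (R 0F t) (u 1F t) (R 1F t) ⟩
      u 0F t * (f s t * R 0F t) + u 1F t * (f s t * R 1F t)
        ≈⟨ +-cong (*-congˡ (splits s 0F t)) (*-congˡ (splits s 1F t)) ⟩
      u 0F t * (f (s [ i ]≔ 0F) t * R (lookup s i) t) + u 1F t * (f (s [ i ]≔ 1F) t * R (lookup s i) t)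
        ≈⟨ solve 5 (λ a x b y r → a :* (x :* r) :+ b :* (y :* r) := r :* (a :* x :+ b :* y)) refl
             (u 0F t) (f (s [ i ]≔ 0F) t) (u 1F t) (f (s [ i ]≔ 1F) t) (R (lookup s i) t) ⟩
      R (lookup s i) t * quotient s t ∎

    quotient-cong : ∀ {s s′} t → (∀ c → f (s [ i ]≔ c) t ≈ f (s′ [ i ]≔ c) t) → quotient s t ≈ quotient s′ t
    quotient-cong t e = +-cong (*-congˡ (e 0F)) (*-congˡ (e 1F))

    independent : Independent i quotient
    independent s c t = quotient-cong t λ c′ → reflexive (≡.cong (λ s → f s t) ([]≔-idempotent s i))

    independent-other : ∀ k → k ≢ i → Independent k f → Independent k quotient
    independent-other k k≢i ind s c t = quotient-cong t λ c′ →
      trans (reflexive (≡.cong (λ s → f s t) ([]≔-commutes s k i k≢i))) (ind (s [ i ]≔ c′) c t)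

    -- The quotient combines entries that differ only in slot `i`, with coefficients that do not see
    -- slot `k`. This is what allows the divisions to be iterated.
    splits-other : ∀ k → k ≢ i → ∀ {R′} → Splits k f R′ → Splits k quotient R′
    splits-other k k≢i {R′} sp s c t = begin
      quotient s t * R′ c t
        ≈⟨ solve 5 (λ a x b y r → (a :* x :+ b :* y) :* r := a :* (x :* r) :+ b :* (y :* r)) refl
             (u 0F t) (f (s [ i ]≔ 0F) t) (u 1F t) (f (s [ i ]≔ 1F) t) (R′ c t) ⟩
      u 0F t * (f (s [ i ]≔ 0F) t * R′ c t) + u 1F t * (f (s [ i ]≔ 1F) t * R′ c t)
        ≈⟨ +-cong (*-congˡ (at 0F)) (*-congˡ (at 1F)) ⟩
      u 0F t * (f (s′ [ i ]≔ 0F) t * R′ (lookup s k) t) + u 1F t * (f (s′ [ i ]≔ 1F) t * R′ (lookup s k) t)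
        ≈⟨ solve 5 (λ a x b y r → a :* (x :* r) :+ b :* (y :* r) := (a :* x :+ b :* y) :* r) refl
             (u 0F t) (f (s′ [ i ]≔ 0F) t) (u 1F t) (f (s′ [ i ]≔ 1F) t) (R′ (lookup s k) t) ⟩
      quotient s′ t * R′ (lookup s k) t ∎
      where
      s′ = s [ k ]≔ c
      at : ∀ c′ → f (s [ i ]≔ c′) t * R′ c t ≈ f (s′ [ i ]≔ c′) t * R′ (lookup s k) t
      at c′ = trans (sp (s [ i ]≔ c′) c t) (*-cong
        (reflexive (≡.cong (λ s → f s t) ([]≔-commutes s i k (k≢i ∘ ≡.sym))))
        (reflexive (≡.cong (λ c → R′ c t) (lookup∘update′ k≢i s c′))))

    quotient-nonvanishing : ∀ s → ¬ Vanishes (f s) → ¬ Vanishes (quotient s)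
    quotient-nonvanishing s ne z = ne λ t → trans (factors s t) (trans (*-congˡ (z t)) (zeroʳ _))

    module _ {e} (f-poly : HasDegree≤ e f) where

      quotient-poly : ∀ s → IsPoly (quotient s)
      quotient-poly s = isPoly-+ (isPoly-* (u-poly 0F) (e , f-poly _)) (isPoly-* (u-poly 1F) (e , f-poly _))

      -- The entry of f at the top index of R has degree deg R + deg quotient.
      exact-quotient : ∀ s → ¬ Vanishes (quotient s) → ∃[ k ] degree ℕ.+ k ℕ.≤ e × ∃[ a ] Poly k a (quotient s)
      exact-quotient s ne = conclude (exact-degree (proj₂ (proj₂ (quotient-poly s))) ne)
        where
        top-product : ∀ t → f (s [ i ]≔ top) t ≈ R top t * quotient s t
        top-product t = trans (factors (s [ i ]≔ top) t) (*-cong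
          (reflexive (≡.cong (λ c → R c t) (lookup∘update i s top))) (independent s top t))
        conclude : (∃[ k ] ∃[ a ] k ℕ.≤ _ × ¬ (a ≈ 0#) × Poly k a (quotient s)) →
                   ∃[ k ] degree ℕ.+ k ℕ.≤ e × ∃[ a ] Poly k a (quotient s)
        conclude (k , a , _ , a≉0 , Q) = k ,
          degree-≤ (proj₂ (f-poly (s [ i ]≔ top))) (poly-cong top-product (poly-* top-poly Q)) (*-nonzero lead≉0 a≉0) , a , Q

      degree-bound : Nonzero f → degree ℕ.≤ e
      degree-bound (s , ne) = ℕₚ.m+n≤o⇒m≤o degree (proj₁ (proj₂ (exact-quotient s (quotient-nonvanishing s ne))))

      quotient-degree : HasDegree≤ (e ℕ.∸ degree) quotient
      quotient-degree s = by-case em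
        where
        raised : (∃[ k ] degree ℕ.+ k ℕ.≤ e × ∃[ a ] Poly k a (quotient s)) → ∃[ a ] Poly (e ℕ.∸ degree) a (quotient s)
        raised (k , bound , _ , Q) = raise-to (ℕₚ.m+n≤o⇒m≤o∸n k (ℕₚ.≤-trans (ℕₚ.≤-reflexive (ℕₚ.+-comm k degree)) bound)) Q
        by-case : Dec (Vanishes (quotient s)) → ∃[ a ] Poly (e ℕ.∸ degree) a (quotient s)
        by-case (yes z) = zero-poly (e ℕ.∸ degree) z
        by-case (no ne) = raised (exact-quotient s ne)

  module _ (T : Subset m) (P : Fin m → PrimitivePair) where
    private module P i = PrimitivePair (P i)

    ratio : Fin m → Vec (Fin 2) m → Carrier → Carrier
    ratio i s t = mask (lookup T i) (P.R i (lookup s i) t)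

    weight : Fin m → ℕ
    weight i = maskℕ (lookup T i) (P.degree i)

    -- Stated along an injection `ι` of `n` slots to allow induction on `n`. `preserves` keeps the
    -- independence gained in one slot through the divisions in the others.
    record FullFactorization {n} (ι : Fin n → Fin m) (e : ℕ) (f : Family) : Set where
      field
        g           : Family
        factors     : ∀ s t → f s t ≈ ∏ (λ k → ratio (ι k) s t) * g s t
        bound       : natSum (weight ∘ ι) ℕ.≤ e
        g-degree    : HasDegree≤ (e ℕ.∸ natSum (weight ∘ ι)) g
        independent : ∀ k → lookup T (ι k) ≡ true → Independent (ι k) g
        preserves   : ∀ i → (∀ k → i ≢ ι k) → Independent i f → Independent i g

    fullFactorization : ∀ n (ι : Fin n → Fin m) → (∀ {k l} → ι k ≡ ι l → k ≡ l) → ∀ {e f} → HasDegree≤ e f → Nonzero f →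
      (∀ k → lookup T (ι k) ≡ true → Splits (ι k) f (P.R (ι k))) → FullFactorization ι e f
    fullFactorization zero ι ι-inj {f = f} f-poly f≉0 splits = record
      { g = f ; factors = λ s t → sym (*-identityˡ _) ; bound = z≤n ; g-degree = f-poly
      ; independent = λ () ; preserves = λ _ _ ind → ind }
    fullFactorization (suc n) ι ι-inj {e} {f} f-poly f≉0 splits = step (lookup T (ι zero)) ≡.refl
      where
      step : ∀ b → lookup T (ι zero) ≡ b → FullFactorization ι e f
      step false eq = record
        { g = Rec.g
        ; factors = λ s t → trans (Rec.factors s t) (*-congʳ (sym (trans (*-congʳ (reflexive (≡.cong (λ b → mask b _) eq))) (*-identityˡ _))))
        ; bound = ≡.subst (ℕ._≤ e) (≡.sym weight≡) Rec.bound
        ; g-degree = ≡.subst (λ n → HasDegree≤ (e ℕ.∸ n) Rec.g) (≡.sym weight≡) Rec.g-degree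
        ; independent = λ { zero in-T → ⊥-elim (false≢true (≡.trans (≡.sym eq) in-T)) ; (suc k) → Rec.independent k }
        ; preserves = λ i i∉ → Rec.preserves i (i∉ ∘ suc)
        }
        where
        false≢true : false ≢ true
        false≢true ()
        module Rec = FullFactorization (fullFactorization n (ι ∘ suc) (λ e → suc-injective (ι-inj e)) f-poly f≉0 (splits ∘ suc))
        weight≡ : natSum (weight ∘ ι) ≡ natSum (weight ∘ ι ∘ suc)
        weight≡ = ≡.cong (λ b → maskℕ b (P.degree (ι zero)) ℕ.+ natSum (weight ∘ ι ∘ suc)) eq
      step true eq = record
        { g = Rec.g
        ; factors = λ s t → trans (Q.factors s t) (trans (*-congˡ (Rec.factors s t)) (trans (sym (*-assoc _ _ _))
            (*-congʳ (*-congʳ (reflexive (≡.cong (λ b → mask b _) (≡.sym eq)))))))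
        ; bound = ≡.subst (ℕ._≤ e) (≡.sym weight≡)
            (ℕₚ.≤-trans (ℕₚ.+-monoʳ-≤ d Rec.bound) (ℕₚ.≤-reflexive (ℕₚ.m+[n∸m]≡n (Q.degree-bound f-poly f≉0))))
        ; g-degree = ≡.subst (λ n → HasDegree≤ n Rec.g)
            (≡.trans (ℕₚ.∸-+-assoc e d _) (≡.cong (e ℕ.∸_) (≡.sym weight≡))) Rec.g-degree
        ; independent = λ
            -- The first division makes the quotient independent of its slot, and the later ones
            -- concern different slots because `ι` is injective.
            { zero _ → Rec.preserves (ι zero) (λ k e → zero≢suc (ι-inj e)) Q.independent
            ; (suc k) → Rec.independent k }
        ; preserves = λ i i∉ ind → Rec.preserves i (i∉ ∘ suc) (Q.independent-other i (i∉ zero) ind)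
        }
        where
        d = P.degree (ι zero)
        zero≢suc : ∀ {k : Fin n} → zero ≢ suc k
        zero≢suc ()
        module Q = Quotient (P (ι zero)) (ι zero) f (splits zero eq)
        module Rec = FullFactorization (fullFactorization n (ι ∘ suc) (λ e → suc-injective (ι-inj e))
          (Q.quotient-degree f-poly) (proj₁ f≉0 , Q.quotient-nonvanishing (proj₁ f≉0) (proj₂ f≉0))
          (λ k in-T → Q.splits-other (ι (suc k)) (λ e → zero≢suc (ι-inj (≡.sym e))) (splits (suc k) in-T)))
        weight≡ : natSum (weight ∘ ι) ≡ d ℕ.+ natSum (weight ∘ ι ∘ suc)
        weight≡ = ≡.cong (λ b → maskℕ b d ℕ.+ natSum (weight ∘ ι ∘ suc)) eq

  linear-coefficients : ∀ {b f} → Poly 1 b f → ∃[ a ] ∀ t → f t ≈ a + t * b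
  linear-coefficients (horner a (constant p) e) = a , λ t → trans (e t) (+-congˡ (*-congˡ (p t)))

  -- A coprime pair of linear polynomials, not both constant, is independent:
  -- otherwise the two would have a common root.
  linear-independent : ∀ (P : PrimitivePair) (a b : Fin 2 → Carrier) → (∀ c t → PrimitivePair.R P c t ≈ a c + t * b c) →
    ∀ c₀ → ¬ (b c₀ ≈ 0#) → ¬ (a 0F * b 1F ≈ a 1F * b 0F)
  linear-independent P a b R≈ c₀ b≉0 det≈0 = root c₀ b≉0
    where
    open PrimitivePair P
    no-common-root : ∀ t → R 0F t ≈ 0# → R 1F t ≈ 0# → ⊥
    no-common-root t z z′ = 0≉1 (trans (solve 2 (λ x y → :0 := x :* :0 :+ y :* :0) refl (u 0F t) (u 1F t))
      (trans (sym (+-cong (*-congˡ z) (*-congˡ z′))) (bezout t)))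
    root : ∀ c → ¬ (b c ≈ 0#) → ⊥
    root c b≉0 with inverse (b c) b≉0
    root 0F b≉0 | y , by = no-common-root (- (a 0F * y))
      (trans (R≈ 0F _) (trans (solve 3 (λ a b y → a :+ (:- (a :* y)) :* b := a :+ :- (a :* (b :* y))) refl (a 0F) (b 0F) y)
        (trans (+-congˡ (-‿cong (trans (*-congˡ by) (*-identityʳ _)))) (-‿inverseʳ _))))
      (trans (R≈ 1F _) (trans (solve 4 (λ a d b y → a :+ (:- (d :* y)) :* b := a :+ :- ((d :* b) :* y)) refl (a 1F) (a 0F) (b 1F) y)
        (trans (+-congˡ (-‿cong (trans (*-congʳ det≈0) (trans (*-assoc _ _ _) (trans (*-congˡ by) (*-identityʳ _)))))) (-‿inverseʳ _))))
    root 1F b≉0 | y , by = no-common-root (- (a 1F * y))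
      (trans (R≈ 0F _) (trans (solve 4 (λ a d b y → a :+ (:- (d :* y)) :* b := a :+ :- ((d :* b) :* y)) refl (a 0F) (a 1F) (b 0F) y)
        (trans (+-congˡ (-‿cong (trans (*-congʳ (sym det≈0)) (trans (*-assoc _ _ _) (trans (*-congˡ by) (*-identityʳ _)))))) (-‿inverseʳ _))))
      (trans (R≈ 1F _) (trans (solve 3 (λ a b y → a :+ (:- (a :* y)) :* b := a :+ :- (a :* (b :* y))) refl (a 1F) (b 1F) y)
        (trans (+-congˡ (-‿cong (trans (*-congˡ by) (*-identityʳ _)))) (-‿inverseʳ _))))

-- Linear ratios as linear maps between planes

module LinearSplittings (K : CommutativeRing 0ℓ 0ℓ) (F : IsInfiniteField K) (em : ExcludedMiddle 0ℓ) where

  open CommutativeRing K hiding (zero)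
  open FieldProperties K F em
  open Solver K
  open Products K
  open LinearAlgebra K
  open LinearMap using (⟦_⟧)
  open VectorSpaces K F em
  open SetoidReasoning setoid

  covector₂ : ∀ {U} → Basis U 2 → Carrier → Carrier → Covector U
  covector₂ {U} B a b = LeftModule._+ᴹ_ (Dual U) (LeftModule._*ₗ_ (Dual U) a (coordinate B 0F)) (LeftModule._*ₗ_ (Dual U) b (coordinate B 1F))

  covector₂-basis : ∀ {U} (B : Basis U 2) (x : Fin 2 → Carrier) c → ⟦ covector₂ B (x 0F) (x 1F) ⟧ (basis B c) ≈ x c
  covector₂-basis B x 0F = trans (+-cong (*-congˡ (coordinate-same B 0F)) (*-congˡ (coordinate-other B λ ())))
    (solve 2 (λ x y → x :* :1 :+ y :* :0 := x) refl (x 0F) (x 1F))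
  covector₂-basis B x 1F = trans (+-cong (*-congˡ (coordinate-other B λ ())) (*-congˡ (coordinate-same B 1F)))
    (solve 2 (λ x y → x :* :0 :+ y :* :1 := y) refl (x 0F) (x 1F))

  -- The map sending v to the vector annihilated by the covector with
  -- coordinates a c · v₀ + b c · v₁.
  module MatrixMap {U W : VectorSpace K} (B : Basis U 2) (D : Basis W 2) (a b : Fin 2 → Carrier) where
    private
      module U = LeftModule U
      module W = LeftModule W

    row : Fin 2 → Covector U
    row c = covector₂ B (a c) (b c)

    matrixMap : LinearMap U W
    matrixMap = map₂ D (LeftModule._*ₗ_ (Dual U) (- 1#) (row 1F)) (row 0F)

    module Invertible (det≉0 : ¬ (a 0F * b 1F + - (a 1F * b 0F) ≈ 0#)) where
      private
        δ = proj₁ (inverse _ det≉0)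
        det-δ : (a 0F * b 1F + - (a 1F * b 0F)) * δ ≈ 1#
        det-δ = proj₂ (inverse _ det≉0)

      matrixMap-surjective : ∀ w → ∃[ v ] ⟦ matrixMap ⟧ v W.≈ᴹ w
      matrixMap-surjective w = v , coordinates-separate D λ
        { 0F → trans (proj₁ (coordinate-combination₂ D _ _)) (begin
            - 1# * (a 1F * ⟦ coordinate B 0F ⟧ v + b 1F * ⟦ coordinate B 1F ⟧ v)
              ≈⟨ *-congˡ (+-cong (*-congˡ (proj₁ (coordinate-combination₂ B x y))) (*-congˡ (proj₂ (coordinate-combination₂ B x y)))) ⟩
            - 1# * (a 1F * x + b 1F * y)
              ≈⟨ solve 7 (λ a₀ a₁ b₀ b₁ d w₀ w₁ → (:- :1) :* (a₁ :* (d :* (b₁ :* w₁ :+ b₀ :* w₀)) :+ b₁ :* (:- (d :* (a₁ :* w₁ :+ a₀ :* w₀))))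
                   := ((a₀ :* b₁ :+ :- (a₁ :* b₀)) :* d) :* w₀) refl (a 0F) (a 1F) (b 0F) (b 1F) δ w₀ w₁ ⟩
            ((a 0F * b 1F + - (a 1F * b 0F)) * δ) * w₀  ≈⟨ trans (*-congʳ det-δ) (*-identityˡ w₀) ⟩
            w₀ ∎)
        ; 1F → trans (proj₂ (coordinate-combination₂ D _ _)) (begin
            a 0F * ⟦ coordinate B 0F ⟧ v + b 0F * ⟦ coordinate B 1F ⟧ v
              ≈⟨ +-cong (*-congˡ (proj₁ (coordinate-combination₂ B x y))) (*-congˡ (proj₂ (coordinate-combination₂ B x y))) ⟩
            a 0F * x + b 0F * y
              ≈⟨ solve 7 (λ a₀ a₁ b₀ b₁ d w₀ w₁ → a₀ :* (d :* (b₁ :* w₁ :+ b₀ :* w₀)) :+ b₀ :* (:- (d :* (a₁ :* w₁ :+ a₀ :* w₀)))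
                   := ((a₀ :* b₁ :+ :- (a₁ :* b₀)) :* d) :* w₁) refl (a 0F) (a 1F) (b 0F) (b 1F) δ w₀ w₁ ⟩
            ((a 0F * b 1F + - (a 1F * b 0F)) * δ) * w₁  ≈⟨ trans (*-congʳ det-δ) (*-identityˡ w₁) ⟩
            w₁ ∎) }
        where
        w₀ = ⟦ coordinate D 0F ⟧ w
        w₁ = ⟦ coordinate D 1F ⟧ w
        -- Cramer's rule, with `δ` the inverse of the determinant.
        x = δ * (b 1F * w₁ + b 0F * w₀)
        y = - (δ * (a 1F * w₁ + a 0F * w₀))
        v = x U.*ₗ basis B 0F U.+ᴹ y U.*ₗ basis B 1F

      matrixMap-injective : ∀ v → ⟦ matrixMap ⟧ v W.≈ᴹ W.0ᴹ → v U.≈ᴹ U.0ᴹ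
      matrixMap-injective v e = coordinates-zero B λ
        { 0F → *-zero-cancelˡ det≉0 (trans
            (solve 6 (λ a₀ a₁ b₀ b₁ x y → (a₀ :* b₁ :+ :- (a₁ :* b₀)) :* x := b₁ :* (a₀ :* x :+ b₀ :* y) :+ b₀ :* ((:- :1) :* (a₁ :* x :+ b₁ :* y)))
               refl (a 0F) (a 1F) (b 0F) (b 1F) (⟦ coordinate B 0F ⟧ v) (⟦ coordinate B 1F ⟧ v))
            (zeros (b 1F) (b 0F)))
        ; 1F → *-zero-cancelˡ det≉0 (trans
            (solve 6 (λ a₀ a₁ b₀ b₁ x y → (a₀ :* b₁ :+ :- (a₁ :* b₀)) :* y := (:- a₁) :* (a₀ :* x :+ b₀ :* y) :+ (:- a₀) :* ((:- :1) :* (a₁ :* x :+ b₁ :* y)))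
               refl (a 0F) (a 1F) (b 0F) (b 1F) (⟦ coordinate B 0F ⟧ v) (⟦ coordinate B 1F ⟧ v))
            (zeros (- a 1F) (- a 0F))) }
        where
        row₀ : ⟦ row 0F ⟧ v ≈ 0#
        row₀ = trans (sym (proj₂ (coordinate-combination₂ D _ _))) (trans (cov-cong (coordinate D 1F) e) (cov-0 (coordinate D 1F)))
        row₁ : - 1# * ⟦ row 1F ⟧ v ≈ 0#
        row₁ = trans (sym (proj₁ (coordinate-combination₂ D _ _))) (trans (cov-cong (coordinate D 0F) e) (cov-0 (coordinate D 0F)))
        zeros : ∀ p q → p * ⟦ row 0F ⟧ v + q * (- 1# * ⟦ row 1F ⟧ v) ≈ 0#
        zeros p q = trans (+-cong (*-congˡ row₀) (*-congˡ row₁)) (solve 2 (λ p q → p :* :0 :+ q :* :0 := :0) refl p q)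

  masked-form : ∀ {U n} (T : Subset n) (ξ : Fin n → Covector U) →
                IsForm U ⟨K⟩ ∣ T ∣ (λ v → ∏ λ i → mask (lookup T i) (⟦ ξ i ⟧ v))
  masked-form []          ξ = const 1#
  masked-form (true ∷ T)  ξ = times (ξ zero) (masked-form T (ξ ∘ suc))
  masked-form (false ∷ T) ξ = equal (λ v → sym (*-identityˡ _)) (masked-form T (ξ ∘ suc))

-- Filling and contracting slots

lookup-∉ : ∀ {n} {S : Subset n} {r} → r ∉ S → lookup S r ≡ false
lookup-∉ {S = S} {r} r∉S = go (lookup S r) ≡.refl
  where
  go : ∀ b → lookup S r ≡ b → b ≡ false
  go true  e = ⊥-elim (r∉S (lookup⇒[]= r S e))
  go false e = ≡.refl

module Decompositions (K : CommutativeRing 0ℓ 0ℓ) (F : IsInfiniteField K) (em : ExcludedMiddle 0ℓ) where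

  open CommutativeRing K hiding (zero)
  open FieldProperties K F em
  open Solver K
  open Products K
  open LinearAlgebra K
  open LinearMap using (⟦_⟧)
  open VectorSpaces K F em
  open Tensors K F em
  open LinearSplittings K F em
  open SetoidReasoning setoid

  -- The index `s` is turned into `s′` one slot at a time: slots in `T` may be changed freely, the
  -- others already agree.
  independent-all : ∀ {n} (T : Subset n) (g : Index n → Carrier) →
    (∀ i → lookup T i ≡ true → ∀ s c → g (s [ i ]≔ c) ≈ g s) →
    ∀ s s′ → (∀ i → lookup T i ≡ false → lookup s i ≡ lookup s′ i) → g s ≈ g s′
  independent-all []          g ind []      []        agree = refl
  independent-all (true ∷ T)  g ind (a ∷ s) (a′ ∷ s′) agree = trans (sym (ind zero ≡.refl (a ∷ s) a′))
    (independent-all T (λ s → g (a′ ∷ s)) (λ i i∈T s c → ind (suc i) i∈T (a′ ∷ s) c) s s′ (agree ∘ suc))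
  independent-all (false ∷ T) g ind (a ∷ s) (a′ ∷ s′) agree = trans
    (reflexive (≡.cong (λ a → g (a ∷ s)) (agree zero ≡.refl)))
    (independent-all T (λ s → g (a′ ∷ s)) (λ i i∈T s c → ind (suc i) i∈T (a′ ∷ s) c) s s′ (agree ∘ suc))

  module _ {m : ℕ} {W : Fin m → VectorSpace K} (S : Subset m) (w : ∀ r → ∥ W r ∥) where
    private
      module W r = LeftModule (W r)

      Rest : (∃[ r ] r ∉ S) → VectorSpace K
      Rest = W ∘ proj₁

      fillW : Tensor {I = ∃[ r ] r ∉ S} Rest → Tensor W
      fillW = fill {W = W} S (λ r _ → w r)

    -- A named copy of the local function of `fill`, for vectors that do not depend on the proof of
    -- membership.
    fillSlot : (∀ i → ∥ Rest i ∥) → ∀ r → ∥ W r ∥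
    fillSlot u r with r ∈? S
    ... | yes _   = w r
    ... | no  r∉S = u (r , r∉S)

    fill-pure : ∀ u → _≋_ W (fill {W = W} S (λ r _ → w r) (pure u)) (pure (fillSlot u))
    fill-pure u = pure-cong (same ≡.refl)
      where
      -- The equation names the local function in the definition of fill.
      same : ∀ {f} → fill {W = W} S (λ r _ → w r) (pure u) ≡ pure f → ∀ r → W._≈ᴹ_ r (f r) (fillSlot u r)
      same ≡.refl r with r ∈? S
      ... | yes _ = W.≈ᴹ-refl r
      ... | no  _ = W.≈ᴹ-refl r

    -- `fill` acts on representatives. Compatibility with the congruence is what later turns a
    -- vanishing `γ` into a vanishing point of the curve, a contradiction.
    fill-cong : ∀ {s t : Tensor Rest} → _≋_ Rest s t → _≋_ W (fillW s) (fillW t)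
    fill-cong ≋-refl             = ≋-refl
    fill-cong (≋-sym p)          = ≋-sym (fill-cong p)
    fill-cong (≋-trans p q)      = ≋-trans (fill-cong p) (fill-cong q)
    fill-cong (⊕-cong p q)       = ⊕-cong (fill-cong p) (fill-cong q)
    fill-cong (⊕-assoc s t u)    = ⊕-assoc (fillW s) (fillW t) (fillW u)
    fill-cong (⊕-comm s t)       = ⊕-comm (fillW s) (fillW t)
    fill-cong (⊕-identityˡ s)    = ⊕-identityˡ (fillW s)
    fill-cong (⊙-cong e p)       = ⊙-cong e (fill-cong p)
    fill-cong (⊙-assoc a b s)    = ⊙-assoc a b (fillW s)
    fill-cong (⊙-identityˡ s)    = ⊙-identityˡ (fillW s)
    fill-cong (⊙-zeroˡ s)        = ⊙-zeroˡ (fillW s)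
    fill-cong (⊙-distribʳ s a b) = ⊙-distribʳ (fillW s) a b
    fill-cong (⊙-distribˡ a s t) = ⊙-distribˡ a (fillW s) (fillW t)
    fill-cong (pure-cong {u} {u′} e) = ≋-trans (fill-pure u) (≋-trans (pure-cong same) (≋-sym (fill-pure u′)))
      where
      same : ∀ r → W._≈ᴹ_ r (fillSlot u r) (fillSlot u′ r)
      same r with r ∈? S
      ... | yes _   = W.≈ᴹ-refl r
      ... | no  r∉S = e (r , r∉S)
    fill-cong (pure-+ (i , i∉S) {x} {u} {v} e o) = ≋-trans (fill-pure x) (≋-trans (pure-+ i at off)
        (⊕-cong (≋-sym (fill-pure u)) (≋-sym (fill-pure v))))
      where
      at : W._≈ᴹ_ i (fillSlot x i) (W._+ᴹ_ i (fillSlot u i) (fillSlot v i))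
      at with i ∈? S
      ... | yes i∈S = ⊥-elim (i∉S i∈S)
      -- The proof found by the decision procedure replaces the given `i∉S`; proofs of a negation
      -- are definitionally equal.
      ... | no  _   = e
      off : ∀ k → k ≢ i → W._≈ᴹ_ k (fillSlot x k) (fillSlot u k) × W._≈ᴹ_ k (fillSlot x k) (fillSlot v k)
      off k k≢i with k ∈? S
      ... | yes _   = W.≈ᴹ-refl k , W.≈ᴹ-refl k
      ... | no  k∉S = o (k , k∉S) λ e → k≢i (≡.cong proj₁ e)
    fill-cong (pure-* (i , i∉S) a {x} {u} e o) = ≋-trans (fill-pure x) (≋-trans (pure-* i a at off)
        (⊙-cong refl (≋-sym (fill-pure u))))
      where
      at : W._≈ᴹ_ i (fillSlot x i) (W._*ₗ_ i a (fillSlot u i))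
      at with i ∈? S
      ... | yes i∈S = ⊥-elim (i∉S i∈S)
      ... | no  _   = e
      off : ∀ k → k ≢ i → W._≈ᴹ_ k (fillSlot x k) (fillSlot u k)
      off k k≢i with k ∈? S
      ... | yes _   = W.≈ᴹ-refl k
      ... | no  k∉S = o (k , k∉S) λ e → k≢i (≡.cong proj₁ e)

  -- Contraction of the slots in S with chosen basis vectors; fill S w puts
  -- covectors back into these slots.
  module _ {m : ℕ} {V : Fin m → VectorSpace K} (B : ∀ r → Basis (V r) 2) (S : Subset m) (c : Fin m → Fin 2) where
    open Coordinates B

    contractSlots : ∥ V* V ∥ → Tensor {I = ∃[ r ] r ∉ S} (λ r → Dual (V (proj₁ r)))
    contractSlots (pure α) = (∏ λ r → mask (lookup S r) (⟦ α r ⟧ (basis (B r) (c r)))) ⊙ pure (λ r → α (proj₁ r))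
    contractSlots 𝟘        = 𝟘
    contractSlots (s ⊕ t)  = contractSlots s ⊕ contractSlots t
    contractSlots (a ⊙ t)  = a ⊙ contractSlots t

    pick : Bool → Fin 2 → Fin 2 → Fin 2
    pick true  x y = x
    pick false x y = y

    replace : Index m → Index m
    replace s = tabulate λ r → pick (lookup S r) (c r) (lookup s r)

    -- For a pure tensor the two products agree slot by slot: in `S` the new covector is read at `s`
    -- and the old one at the chosen entry `c r`, elsewhere the old one is read at `s`. Linearity
    -- does the rest.
    coords-fill : ∀ (w : ∀ r → Covector (V r)) t s →
      coords (fill {W = λ r → Dual (V r)} S (λ r _ → w r) (contractSlots t)) s ≈
      (∏ λ r → mask (lookup S r) (⟦ w r ⟧ (corner s r))) * coords t (replace s)
    coords-fill w (pure α) s = begin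
      x * coords (fill {W = λ r → Dual (V r)} S (λ r _ → w r) (pure α′)) s
        ≈⟨ *-congˡ (cov-cong (coord s) (fill-pure {W = λ r → Dual (V r)} S w α′)) ⟩
      x * ∏ (λ r → ⟦ fillSlot {W = λ r → Dual (V r)} S w α′ r ⟧ (corner s r))
        ≈⟨ ∏-* (λ r → mask (lookup S r) (⟦ α r ⟧ (basis (B r) (c r)))) (λ r → ⟦ fillSlot {W = λ r → Dual (V r)} S w α′ r ⟧ (corner s r)) ⟨
      ∏ (λ r → mask (lookup S r) (⟦ α r ⟧ (basis (B r) (c r))) * ⟦ fillSlot {W = λ r → Dual (V r)} S w α′ r ⟧ (corner s r))
        ≈⟨ ∏-cong entry ⟩
      ∏ (λ r → mask (lookup S r) (⟦ w r ⟧ (corner s r)) * ⟦ α r ⟧ (corner (replace s) r))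
        ≈⟨ ∏-* (λ r → mask (lookup S r) (⟦ w r ⟧ (corner s r))) (λ r → ⟦ α r ⟧ (corner (replace s) r)) ⟩
      (∏ λ r → mask (lookup S r) (⟦ w r ⟧ (corner s r))) * coords (pure α) (replace s) ∎
      where
      α′ : ∀ (r : ∃[ r ] r ∉ S) → Covector (V (proj₁ r))
      α′ r = α (proj₁ r)
      x = ∏ λ r → mask (lookup S r) (⟦ α r ⟧ (basis (B r) (c r)))
      replaced : ∀ r b → lookup S r ≡ b → ⟦ α r ⟧ (basis (B r) (pick b (c r) (lookup s r))) ≈ ⟦ α r ⟧ (corner (replace s) r)
      replaced r b e = reflexive (≡.cong (λ k → ⟦ α r ⟧ (basis (B r) k))
        (≡.trans (≡.cong (λ b → pick b (c r) (lookup s r)) (≡.sym e)) (≡.sym (lookup∘tabulate _ r))))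
      masked : ∀ r {b} y → lookup S r ≡ b → mask (lookup S r) y ≈ mask b y
      masked r y e = reflexive (≡.cong (λ b → mask b y) e)
      entry : ∀ r → mask (lookup S r) (⟦ α r ⟧ (basis (B r) (c r))) * ⟦ fillSlot {W = λ r → Dual (V r)} S w α′ r ⟧ (corner s r) ≈
                    mask (lookup S r) (⟦ w r ⟧ (corner s r)) * ⟦ α r ⟧ (corner (replace s) r)
      entry r with r ∈? S
      ... | yes r∈S = trans (*-cong (trans (masked r _ ([]=⇒lookup r∈S)) (replaced r true ([]=⇒lookup r∈S)))
                              (sym (masked r _ ([]=⇒lookup r∈S)))) (*-comm _ _)
      ... | no  r∉S = *-cong (trans (masked r _ (lookup-∉ r∉S)) (sym (masked r _ (lookup-∉ r∉S)))) (replaced r false (lookup-∉ r∉S))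
    coords-fill w 𝟘 s = sym (zeroʳ _)
    coords-fill w (t ⊕ u) s = trans (+-cong (coords-fill w t s) (coords-fill w u s)) (sym (distribˡ _ _ _))
    coords-fill w (a ⊙ t) s = trans (*-congˡ (coords-fill w t s))
      (solve 3 (λ a x y → a :* (x :* y) := x :* (a :* y)) refl a _ (coords t (replace s)))

  module _ {U W : VectorSpace K} (B : Basis U 2) (D : Basis W 2) (a b : Fin 2 → Carrier) where

    -- The linear ratio `a c · v₀ + b c · v₁` evaluated at the vector with coordinates
    -- `(- α₁ , α₀)`, which α annihilates. Thus `dualMap` is the ratio of a slot regarded as a map
    -- on annihilators.
    entry : Fin 2 → Covector U → Carrier
    entry c α = b c * ⟦ α ⟧ (basis B 0F) + - (a c * ⟦ α ⟧ (basis B 1F))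

    dualMap : LinearMap (Dual U) (Dual W)
    dualMap = mkLinearMap (λ α → covector₂ D (entry 0F α) (entry 1F α))
      (λ {α} {β} e w → +-cong (*-congʳ (entry-cong 0F α β e)) (*-congʳ (entry-cong 1F α β e)))
      (λ α β w → solve 10 (λ b₀ a₀ x x′ y y′ b₁ a₁ p q →
          (b₀ :* (x :+ x′) :+ :- (a₀ :* (y :+ y′))) :* p :+ (b₁ :* (x :+ x′) :+ :- (a₁ :* (y :+ y′))) :* q :=
          ((b₀ :* x :+ :- (a₀ :* y)) :* p :+ (b₁ :* x :+ :- (a₁ :* y)) :* q) :+ ((b₀ :* x′ :+ :- (a₀ :* y′)) :* p :+ (b₁ :* x′ :+ :- (a₁ :* y′)) :* q))
        refl (b 0F) (a 0F) (⟦ α ⟧ (basis B 0F)) (⟦ β ⟧ (basis B 0F)) (⟦ α ⟧ (basis B 1F)) (⟦ β ⟧ (basis B 1F)) (b 1F) (a 1F)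
        (⟦ coordinate D 0F ⟧ w) (⟦ coordinate D 1F ⟧ w))
      (λ k α w → solve 9 (λ b₀ a₀ x k y b₁ a₁ p q →
          (b₀ :* (k :* x) :+ :- (a₀ :* (k :* y))) :* p :+ (b₁ :* (k :* x) :+ :- (a₁ :* (k :* y))) :* q :=
          k :* ((b₀ :* x :+ :- (a₀ :* y)) :* p :+ (b₁ :* x :+ :- (a₁ :* y)) :* q))
        refl (b 0F) (a 0F) (⟦ α ⟧ (basis B 0F)) k (⟦ α ⟧ (basis B 1F)) (b 1F) (a 1F)
        (⟦ coordinate D 0F ⟧ w) (⟦ coordinate D 1F ⟧ w))
      where
      entry-cong : ∀ c (α β : Covector U) → (∀ v → ⟦ α ⟧ v ≈ ⟦ β ⟧ v) → entry c α ≈ entry c β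
      entry-cong c α β e = +-cong (*-congˡ (e _)) (-‿cong (*-congˡ (e _)))

    covector-ext : ∀ {U} (B : Basis U 2) (α β : Covector U) → (∀ c → ⟦ α ⟧ (basis B c) ≈ ⟦ β ⟧ (basis B c)) → ∀ v → ⟦ α ⟧ v ≈ ⟦ β ⟧ v
    covector-ext B α β e v = trans (covector-expand₂ B α v)
      (trans (+-cong (*-congʳ (e 0F)) (*-congʳ (e 1F))) (sym (covector-expand₂ B β v)))

    entries : Covector U → Fin 2 → Carrier
    entries α c = entry c α

    dualMap-basis : ∀ α c → ⟦ ⟦ dualMap ⟧ α ⟧ (basis D c) ≈ entry c α
    dualMap-basis α c = covector₂-basis D (entries α) c

    dualMap-isIsomorphism : ¬ (a 0F * b 1F + - (a 1F * b 0F) ≈ 0#) → IsIsomorphism dualMap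
    dualMap-isIsomorphism det≉0 = record
      { isLeftModuleMonomorphism = record { isLeftModuleHomomorphism = LinearMap.isHomomorphism dualMap ; injective = λ {α} {β} → injective α β }
      ; surjective = λ β → preimage β , λ {α} e → LeftModule.≈ᴹ-trans (Dual W) {⟦ dualMap ⟧ α} {⟦ dualMap ⟧ (preimage β)} {β}
          (LinearMap.⟦⟧-cong dualMap {α} {preimage β} e) (covector-ext D (⟦ dualMap ⟧ (preimage β)) β (image β))
      }
      where
      δ = proj₁ (inverse _ det≉0)
      det-δ : (a 0F * b 1F + - (a 1F * b 0F)) * δ ≈ 1#
      det-δ = proj₂ (inverse _ det≉0)
      injective : ∀ α β → (∀ w → ⟦ ⟦ dualMap ⟧ α ⟧ w ≈ ⟦ ⟦ dualMap ⟧ β ⟧ w) → ∀ v → ⟦ α ⟧ v ≈ ⟦ β ⟧ v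
      injective α β e = covector-ext B α β λ
        { 0F → *-cancelˡ-nonzero det≉0 (trans (solve₀ α) (trans (+-cong (*-congˡ (same 1F)) (-‿cong (*-congˡ (same 0F)))) (sym (solve₀ β))))
        ; 1F → *-cancelˡ-nonzero det≉0 (trans (solve₁ α) (trans (+-cong (*-congˡ (same 1F)) (-‿cong (*-congˡ (same 0F)))) (sym (solve₁ β)))) }
        where
        same : ∀ c → entry c α ≈ entry c β
        same c = trans (sym (dualMap-basis α c)) (trans (e (basis D c)) (dualMap-basis β c))
        solve₀ : ∀ γ → (a 0F * b 1F + - (a 1F * b 0F)) * ⟦ γ ⟧ (basis B 0F) ≈ a 0F * entry 1F γ + - (a 1F * entry 0F γ)
        solve₀ γ = solve 6 (λ a₀ a₁ b₀ b₁ x y → (a₀ :* b₁ :+ :- (a₁ :* b₀)) :* x := a₀ :* (b₁ :* x :+ :- (a₁ :* y)) :+ :- (a₁ :* (b₀ :* x :+ :- (a₀ :* y))))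
          refl (a 0F) (a 1F) (b 0F) (b 1F) (⟦ γ ⟧ (basis B 0F)) (⟦ γ ⟧ (basis B 1F))
        solve₁ : ∀ γ → (a 0F * b 1F + - (a 1F * b 0F)) * ⟦ γ ⟧ (basis B 1F) ≈ b 0F * entry 1F γ + - (b 1F * entry 0F γ)
        solve₁ γ = solve 6 (λ a₀ a₁ b₀ b₁ x y → (a₀ :* b₁ :+ :- (a₁ :* b₀)) :* y := b₀ :* (b₁ :* x :+ :- (a₁ :* y)) :+ :- (b₁ :* (b₀ :* x :+ :- (a₀ :* y))))
          refl (a 0F) (a 1F) (b 0F) (b 1F) (⟦ γ ⟧ (basis B 0F)) (⟦ γ ⟧ (basis B 1F))
      module _ (β : Covector W) where
        β₀ = ⟦ β ⟧ (basis D 0F)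
        β₁ = ⟦ β ⟧ (basis D 1F)
        x : Fin 2 → Carrier
        -- Cramer's rule for the two equations `entry c α = β c`.
        x 0F = δ * (a 0F * β₁ + - (a 1F * β₀))
        x 1F = δ * (b 0F * β₁ + - (b 1F * β₀))
        preimage : Covector U
        preimage = covector₂ B (x 0F) (x 1F)
        entry-preimage : ∀ c → entry c preimage ≈ b c * x 0F + - (a c * x 1F)
        entry-preimage c = +-cong (*-congˡ (covector₂-basis B x 0F)) (-‿cong (*-congˡ (covector₂-basis B x 1F)))
        unit : ∀ z → ((a 0F * b 1F + - (a 1F * b 0F)) * δ) * z ≈ z
        unit z = trans (*-congʳ det-δ) (*-identityˡ z)
        image : ∀ c → ⟦ ⟦ dualMap ⟧ preimage ⟧ (basis D c) ≈ ⟦ β ⟧ (basis D c)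
        image 0F = trans (dualMap-basis preimage 0F) (trans (entry-preimage 0F) (trans
          (solve 7 (λ a₀ a₁ b₀ b₁ d y z → b₀ :* (d :* (a₀ :* z :+ :- (a₁ :* y))) :+ :- (a₀ :* (d :* (b₀ :* z :+ :- (b₁ :* y)))) := ((a₀ :* b₁ :+ :- (a₁ :* b₀)) :* d) :* y)
            refl (a 0F) (a 1F) (b 0F) (b 1F) δ β₀ β₁) (unit β₀)))
        image 1F = trans (dualMap-basis preimage 1F) (trans (entry-preimage 1F) (trans
          (solve 7 (λ a₀ a₁ b₀ b₁ d y z → b₁ :* (d :* (a₀ :* z :+ :- (a₁ :* y))) :+ :- (a₁ :* (d :* (b₀ :* z :+ :- (b₁ :* y)))) := ((a₀ :* b₁ :+ :- (a₁ :* b₀)) :* d) :* z)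
            refl (a 0F) (a 1F) (b 0F) (b 1F) δ β₀ β₁) (unit β₁)))

-- A class of `e` elements lies in `T`, which has at most `e`, so `T` has exactly `e`; conversely, a
-- `T` with `e` elements is itself the class. Applied with the same `T` to the real and to the
-- complex relation.
class-size : ∀ {m e} (P : Fin m → Set) (T : Subset m) → (∀ i → P i → i ∈ T) → ∣ T ∣ ℕ.≤ e →
             (∣ T ∣ ≡ e → ∀ i → i ∈ T → P i) →
             (Σ (Subset m) λ S → (∀ i → i ∈ S ⇔ P i) × ∣ S ∣ ≡ e) ⇔ (∣ T ∣ ≡ e)
class-size P T P⇒T bound T⇒P = mk⇔
  (λ (S , S⇔P , size) → ℕₚ.≤-antisym bound
    (ℕₚ.≤-trans (ℕₚ.≤-reflexive (≡.sym size)) (p⊆q⇒∣p∣≤∣q∣ λ {i} i∈S → P⇒T i (Equivalence.to (S⇔P i) i∈S))))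
  (λ size → T , (λ i → mk⇔ (T⇒P size i) (P⇒T i)) , size)

-- The split slots of a factorization curve and its decomposition

module Geometry (K : CommutativeRing 0ℓ 0ℓ) (F : IsInfiniteField K) (em : ExcludedMiddle 0ℓ)
  {m n : ℕ} {V : Fin m → VectorSpace K} {H : VectorSpace K}
  (φ : LinearAlgebra.LinearMap K H (LinearAlgebra.V* K V)) (φ-injective : LinearAlgebra.IsInjective K φ)
  (B : ∀ j → VectorSpaces.Basis K F em (V j) 2) (C : VectorSpaces.Basis K F em H n) where

  open CommutativeRing K hiding (zero)
  open FieldProperties K F em
  open Solver K
  open Polynomials K F em
  open Products K
  open LinearAlgebra K
  open LinearMap using (⟦_⟧)
  open VectorSpaces K F em
  open Tensors K F em
  open Forms K F em
  open Splitting K F em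
  open LinearSplittings K F em
  open Decompositions K F em hiding (entry; entries)
  open Curves.Incidence K F em {V = V} {H = H} φ φ-injective B C public
  open Coordinates B
  open SetoidReasoning setoid

  module CurveSplitting {j : Fin m} (ψ : IncidentCurve j) where

    open IncidentCurve ψ
    private
      module V j = LeftModule (V j)
      κ₀ κ₁ : Covector (V j)
      κ₀ = coordinate (B j) 0F
      κ₁ = coordinate (B j) 1F

    line : Carrier → ∥ V j ∥
    line t = V._+ᴹ_ j (basis (B j) 0F) (V._*ₗ_ j t (basis (B j) 1F))

    line-coordinates : ∀ t → ⟦ κ₀ ⟧ (line t) ≈ 1# × ⟦ κ₁ ⟧ (line t) ≈ t
    line-coordinates t =
      trans (cov-+ κ₀ _ _) (trans (+-cong (coordinate-same (B j) 0F) (trans (cov-* κ₀ t _) (trans (*-congˡ (coordinate-other (B j) λ ())) (zeroʳ t)))) (+-identityʳ 1#)) ,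
      trans (cov-+ κ₁ _ _) (trans (+-cong (coordinate-other (B j) λ ()) (trans (cov-* κ₁ t _) (trans (*-congˡ (coordinate-same (B j) 1F)) (*-identityʳ t)))) (+-identityˡ t))

    line-nonzero : ∀ t → NonZero (V j) (line t)
    line-nonzero t e = 0≉1 (trans (sym (trans (cov-cong κ₀ e) (cov-0 κ₀))) (proj₁ (line-coordinates t)))

    family : Family {m}
    family s t = values (form (line t)) s

    family-degree : HasDegree≤ degree family
    family-degree s = _ , form-line {V j} (form-map (Φ s) isForm) (basis (B j) 0F) (basis (B j) 1F)

    family-nonzero : Nonzero family
    family-nonzero = proj₁ nz , λ z → proj₂ nz (z 0#)
      where nz = Φ-nonzero (form (line 0#)) (form-nonzero (line 0#) (line-nonzero 0#))

    -- A constant ratio in slot `i` amounts to one vector incident with all points of the curve. Put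
    -- this way, the condition can be refuted from points of the curve without knowing the ratio.
    NonConstant : Fin m → Set
    NonConstant i = ∀ v → NonZero (V i) v → ¬ (∀ t → Incident i v (form (line t)))

    SplitSlot : Fin m → Set
    SplitSlot i = Minors i family × NonConstant i

    -- A placeholder for slots that do not split; `mask` removes it from every product.
    trivialPair : PrimitivePair {m}
    trivialPair = record
      { R = λ { 0F _ → 1# ; 1F _ → 0# } ; u = λ { 0F _ → 1# ; 1F _ → 0# }
      ; u-poly = λ { 0F → isPoly-const 1# ; 1F → isPoly-const 0# }
      ; bezout = λ t → solve 0 (:1 :* :1 :+ :0 :* :0 := :1) refl
      ; degree = 0 ; R-poly = λ { 0F → 1# , constant (λ _ → refl) ; 1F → 0# , constant (λ _ → refl) }
      ; top = 0F ; lead = 1# ; lead≉0 = 1≉0 ; top-poly = constant λ _ → refl }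

    pairs : ∀ i → Σ (PrimitivePair {m}) λ P → SplitSlot i → Splits i family (PrimitivePair.R P)
    pairs i = choose em
      where
      choose : Dec (SplitSlot i) → Σ (PrimitivePair {m}) λ P → SplitSlot i → Splits i family (PrimitivePair.R P)
      choose (yes (minors , _)) = let (P , sp) = split-from-minors i family-degree family-nonzero minors in P , λ _ → sp
      choose (no ¬split) = trivialPair , λ split → ⊥-elim (¬split split)

    P : Fin m → PrimitivePair
    P i = proj₁ (pairs i)
    module P i = PrimitivePair (P i)

    -- A constant ratio (a₀ : a₁) would be annihilated by − a₁ b₀ + a₀ b₁.
    degree≥1 : ∀ i → SplitSlot i → 1 ℕ.≤ P.degree i
    degree≥1 i split = nonconstant (P.degree i) (P.R-poly i)
      where
      module Vi = LeftModule (V i)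
      nonconstant : ∀ d → (∀ c → ∃[ a ] Poly d a (P.R i c)) → 1 ℕ.≤ d
      nonconstant (suc d) _ = s≤s z≤n
      nonconstant zero R-poly = ⊥-elim (proj₂ split v v≉0 λ t s → begin
        ⟦ coordinate (B i) 0F ⟧ v * family (s [ i ]≔ 0F) t + ⟦ coordinate (B i) 1F ⟧ v * family (s [ i ]≔ 1F) t
          ≈⟨ +-cong (*-congʳ (proj₁ (coordinate-combination₂ (B i) _ _))) (*-congʳ (proj₂ (coordinate-combination₂ (B i) _ _))) ⟩
        - a 1F * family (s [ i ]≔ 0F) t + a 0F * family (s [ i ]≔ 1F) t
          ≈⟨ solve 4 (λ a₀ a₁ x y → (:- a₁) :* x :+ a₀ :* y := y :* a₀ :+ :- (x :* a₁)) refl (a 0F) (a 1F) (family (s [ i ]≔ 0F) t) (family (s [ i ]≔ 1F) t) ⟩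
        family (s [ i ]≔ 1F) t * a 0F + - (family (s [ i ]≔ 0F) t * a 1F)
          ≈⟨ zero-difference (trans (*-congˡ (sym (R≈ 0F t))) (trans (cross s t) (*-congˡ (R≈ 1F t)))) ⟩
        0# ∎)
        where
        a : Fin 2 → Carrier
        a c = proj₁ (R-poly c)
        R≈ : ∀ c t → P.R i c t ≈ a c
        R≈ c t = at (proj₂ (R-poly c))
          where
          at : Poly 0 (a c) (P.R i c) → P.R i c t ≈ a c
          at (constant p) = p t
        v : ∥ V i ∥
        v = (- a 1F) Vi.*ₗ basis (B i) 0F Vi.+ᴹ a 0F Vi.*ₗ basis (B i) 1F
        cross : ∀ s t → family (s [ i ]≔ 1F) t * P.R i 0F t ≈ family (s [ i ]≔ 0F) t * P.R i 1F t
        cross s t = trans (proj₂ (pairs i) split (s [ i ]≔ 1F) 0F t) (*-cong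
          (reflexive (≡.cong (λ s → family s t) ([]≔-idempotent s i)))
          (reflexive (≡.cong (λ c → P.R i c t) (lookup∘update i s 1F))))
        v≉0 : NonZero (V i) v
        v≉0 e = 0≉1 (trans (solve 2 (λ x y → :0 := x :* :0 :+ y :* :0) refl (P.u i 0F 0#) (P.u i 1F 0#))
          (trans (sym (+-cong (*-congˡ (trans (R≈ 0F 0#) a₀≈0)) (*-congˡ (trans (R≈ 1F 0#) a₁≈0)))) (P.bezout i 0#)))
          where
          a₀≈0 : a 0F ≈ 0#
          a₀≈0 = trans (sym (proj₂ (coordinate-combination₂ (B i) _ _))) (trans (cov-cong (coordinate (B i) 1F) e) (cov-0 (coordinate (B i) 1F)))
          a₁≈0 : a 1F ≈ 0#
          a₁≈0 = trans (solve 1 (λ x → x := :- (:- x)) refl (a 1F)) (trans (-‿cong (trans (sym (proj₁ (coordinate-combination₂ (B i) _ _)))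
            (trans (cov-cong (coordinate (B i) 0F) e) (cov-0 (coordinate (B i) 0F))))) (solve 0 (:- :0 := :0) refl))

    -- The extreme case, in homogeneous coordinates: `row i` holds the two linear components of the
    -- ratio in slot `i`, and `g` the coordinates of the constant factor, which spans Γⱼ.
    record LinearSplitting (T : Subset m) : Set where
      field
        a b         : Fin m → Fin 2 → Carrier
        det≉0       : ∀ i → lookup T i ≡ true → ¬ (a i 0F * b i 1F + - (a i 1F * b i 0F) ≈ 0#)
        g           : Index m → Carrier
        independent : ∀ i → lookup T i ≡ true → ∀ s c → g (s [ i ]≔ c) ≈ g s

      row : ∀ i → Fin 2 → Covector (V j)
      row i c = covector₂ (B j) (a i c) (b i c)

      field
        factors     : ∀ v s → values (form v) s ≈ ∏ (λ i → mask (lookup T i) (⟦ row i (lookup s i) ⟧ v)) * g s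

    module FromSubset (T : Subset m) (T-split : ∀ i → lookup T i ≡ true → SplitSlot i) where

      full : FullFactorization T P (λ i → i) degree family
      full = fullFactorization T P m (λ i → i) (λ e → e) family-degree family-nonzero
        (λ i i∈T → proj₂ (pairs i) (T-split i i∈T))
      module Full = FullFactorization full

      weight≥1 : ∀ i → lookup T i ≡ true → 1 ℕ.≤ weight T P i
      weight≥1 i i∈T = ≡.subst (λ b → 1 ℕ.≤ maskℕ b (P.degree i)) (≡.sym i∈T) (degree≥1 i (T-split i i∈T))

      size-≤ : ∣ T ∣ ℕ.≤ degree
      size-≤ = ℕₚ.≤-trans (size-≤-sum T (weight T P) weight≥1) Full.bound

      module Full-size (size≡ : ∣ T ∣ ≡ degree) where

        degree≡1 : ∀ i → lookup T i ≡ true → P.degree i ≡ 1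
        degree≡1 i i∈T = ≡.trans (≡.cong (λ b → maskℕ b (P.degree i)) (≡.sym i∈T))
          (sum-minimal T (weight T P) weight≥1 (ℕₚ.≤-trans Full.bound (ℕₚ.≤-reflexive (≡.sym size≡))) i i∈T)

        rest-degree : degree ℕ.∸ natSum (weight T P) ≡ 0
        rest-degree = ℕₚ.m≤n⇒m∸n≡0 (ℕₚ.≤-trans (ℕₚ.≤-reflexive (≡.sym size≡)) (size-≤-sum T (weight T P) weight≥1))

        rest-constant : ∀ s → ∃[ c ] ∀ t → Full.g s t ≈ c
        rest-constant s = at (≡.subst (λ d → HasDegree≤ d Full.g) rest-degree Full.g-degree s)
          where
          at : (∃[ c ] Poly 0 c (Full.g s)) → ∃[ c ] ∀ t → Full.g s t ≈ c
          at (c , constant p) = c , p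

        record Linear (i : Fin m) : Set where
          field
            a b   : Fin 2 → Carrier
            R≈    : ∀ c t → P.R i c t ≈ a c + t * b c
            det≉0 : ¬ (a 0F * b 1F + - (a 1F * b 0F) ≈ 0#)

        linear : ∀ i → P.degree i ≡ 1 → Linear i
        linear i deg≡1 = record
          { a = λ c → proj₁ (lin c) ; b = b ; R≈ = λ c → proj₂ (lin c)
          ; det≉0 = λ e → linear-independent (P i) (λ c → proj₁ (lin c)) b (λ c → proj₂ (lin c)) (P.top i) b-top≉0 (difference-zero e) }
          where
          R-poly : ∀ c → ∃[ l ] Poly 1 l (P.R i c)
          R-poly c = ≡.subst (λ d → ∃[ l ] Poly d l (P.R i c)) deg≡1 (P.R-poly i c)
          b : Fin 2 → Carrier
          b c = proj₁ (R-poly c)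
          lin : ∀ c → ∃[ a ] ∀ t → P.R i c t ≈ a + t * b c
          lin c = linear-coefficients {m} (proj₂ (R-poly c))
          b-top≉0 : ¬ (b (P.top i) ≈ 0#)
          b-top≉0 e = P.lead≉0 i (trans (lead-unique (≡.subst (λ d → Poly d (P.lead i) (P.R i (P.top i))) deg≡1 (P.top-poly i))
                                                    (proj₂ (R-poly (P.top i)))) e)

        coefficients : ∀ i → Σ (Fin 2 → Carrier) λ a → Σ (Fin 2 → Carrier) λ b → lookup T i ≡ true →
          (∀ c t → P.R i c t ≈ a c + t * b c) × ¬ (a 0F * b 1F + - (a 1F * b 0F) ≈ 0#)
        coefficients i = choose (lookup T i) ≡.refl
          where
          choose : ∀ x → lookup T i ≡ x → Σ (Fin 2 → Carrier) λ a → Σ (Fin 2 → Carrier) λ b → lookup T i ≡ true →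
            (∀ c t → P.R i c t ≈ a c + t * b c) × ¬ (a 0F * b 1F + - (a 1F * b 0F) ≈ 0#)
          choose true i∈T = L.a , L.b , λ _ → L.R≈ , L.det≉0
            where module L = Linear (linear i (degree≡1 i i∈T))
          -- Default coefficients outside `T`, where the factor is masked.
          choose false i∉T = (λ _ → 0#) , (λ _ → 0#) , λ i∈T → ⊥-elim (absurd (≡.trans (≡.sym i∉T) i∈T))
            where
            absurd : false ≢ true
            absurd ()

        a b : Fin m → Fin 2 → Carrier
        a i = proj₁ (coefficients i)
        b i = proj₁ (proj₂ (coefficients i))

        g : Index m → Carrier
        g s = proj₁ (rest-constant s)

        row : ∀ i → Fin 2 → Covector (V j)
        row i c = covector₂ (B j) (a i c) (b i c)

        product : Index m → ∥ V j ∥ → Carrier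
        product s v = ∏ (λ i → mask (lookup T i) (⟦ row i (lookup s i) ⟧ v)) * g s

        product-form : ∀ s → IsForm (V j) ⟨K⟩ degree (product s)
        product-form s = ≡.subst (λ d → IsForm (V j) ⟨K⟩ d (product s)) size≡
          (equal (λ v → *-comm _ _) (form-scale {V j} {⟨K⟩} (g s) (masked-form T (λ i → row i (lookup s i)))))

        on-line : ∀ s t → values (form (line t)) s ≈ product s (line t)
        on-line s t = trans (Full.factors s t) (*-cong (∏-cong λ i → factor-at i (lookup T i) ≡.refl) (proj₂ (rest-constant s) t))
          where
          factor-at : ∀ i x → lookup T i ≡ x → mask x (P.R i (lookup s i) t) ≈ mask x (⟦ row i (lookup s i) ⟧ (line t))
          factor-at i false _ = refl
          factor-at i true i∈T = trans (proj₁ (proj₂ (proj₂ (coefficients i)) i∈T) (lookup s i) t)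
            (sym (+-cong (trans (*-congˡ (proj₁ (line-coordinates t))) (*-identityʳ _))
                         (trans (*-congˡ (proj₂ (line-coordinates t))) (*-comm _ _))))

        -- `on-line` gives the identity in the affine chart. Since `T` has `degree` elements, both
        -- sides are forms of the same degree; homogeneity extends the identity to nonzero first
        -- coordinate, and vanishing of forms to the point at infinity.
        factors : ∀ v s → values (form v) s ≈ product s v
        factors v s = difference-zero (form-vanishes {V j} {P = difference} (form-covector {V j} κ₀)
            (line 0# , λ e → 0≉1 (trans (sym e) (proj₁ (line-coordinates 0#)))) difference-form off-infinity v)
          where
          difference : ∥ V j ∥ → Carrier
          difference v = values (form v) s + - product s v
          difference-form : IsForm (V j) ⟨K⟩ degree difference
          difference-form = form-minus {V j} (form-map (Φ s) isForm) (product-form s)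
          off-infinity : ∀ v → ¬ (⟦ κ₀ ⟧ v ≈ 0#) → difference v ≈ 0#
          off-infinity v x≉0 = begin
            difference v                                   ≈⟨ form-cong difference-form v≈ ⟩
            difference (V._*ₗ_ j (⟦ κ₀ ⟧ v) (line t))      ≈⟨ form-homogeneous {V j} difference-form (⟦ κ₀ ⟧ v) (line t) ⟩
            _ * difference (line t)                        ≈⟨ *-congˡ (zero-difference (on-line s t)) ⟩
            _ * 0#                                         ≈⟨ zeroʳ _ ⟩
            0# ∎
            where
            y = proj₁ (inverse (⟦ κ₀ ⟧ v) x≉0)
            t = y * ⟦ κ₁ ⟧ v
            v≈ : V._≈ᴹ_ j v (V._*ₗ_ j (⟦ κ₀ ⟧ v) (line t))
            v≈ = coordinates-separate (B j) λ
              { 0F → sym (trans (cov-* κ₀ (⟦ κ₀ ⟧ v) (line t)) (trans (*-congˡ (proj₁ (line-coordinates t))) (*-identityʳ _)))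
              ; 1F → sym (trans (cov-* κ₁ (⟦ κ₀ ⟧ v) (line t)) (trans (*-congˡ (proj₂ (line-coordinates t)))
                       (trans (sym (*-assoc _ _ _)) (trans (*-congʳ (proj₂ (inverse (⟦ κ₀ ⟧ v) x≉0))) (*-identityˡ _))))) }

        linearSplitting : LinearSplitting T
        linearSplitting = record
          { a = a ; b = b ; det≉0 = λ i i∈T → proj₂ (proj₂ (proj₂ (coefficients i)) i∈T) ; g = g
          ; independent = λ i i∈T s c → trans (sym (proj₂ (rest-constant (s [ i ]≔ c)) 0#))
              (trans (Full.independent i i∈T s c 0#) (proj₂ (rest-constant s) 0#))
          ; factors = factors }

    module SplittingMaps {T : Subset m} (L : LinearSplitting T) where
      open LinearSplitting L

      splittingMap : ∀ i → LinearMap (V j) (V i)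
      splittingMap i = MatrixMap.matrixMap (B j) (B i) (a i) (b i)

      -- In slot `i` the tensor is proportional to the pair (`row i 0F`, `row i 1F`), which the
      -- vector with coordinates (`- row i 1F`, `row i 0F`) annihilates.
      splittingMap-incident : ∀ i → lookup T i ≡ true → ∀ v → Incident i (⟦ splittingMap i ⟧ v) (form v)
      splittingMap-incident i i∈T v s = begin
        ⟦ coordinate (B i) 0F ⟧ (⟦ splittingMap i ⟧ v) * values (form v) (s [ i ]≔ 0F) + ⟦ coordinate (B i) 1F ⟧ (⟦ splittingMap i ⟧ v) * values (form v) (s [ i ]≔ 1F)
          ≈⟨ +-cong (*-cong (proj₁ (coordinate-combination₂ (B i) _ _)) (at 0F)) (*-cong (proj₂ (coordinate-combination₂ (B i) _ _)) (at 1F)) ⟩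
        (- 1# * ⟦ row i 1F ⟧ v) * ((⟦ row i 0F ⟧ v * rest) * g s) + ⟦ row i 0F ⟧ v * ((⟦ row i 1F ⟧ v * rest) * g s)
          ≈⟨ solve 4 (λ p q e g → ((:- :1) :* q) :* ((p :* e) :* g) :+ p :* ((q :* e) :* g) := :0) refl (⟦ row i 0F ⟧ v) (⟦ row i 1F ⟧ v) rest (g s) ⟩
        0# ∎
        where
        entry : Index m → Fin m → Carrier
        entry s k = mask (lookup T k) (⟦ row k (lookup s k) ⟧ v)
        rest = ∏ (except i (entry s))
        at : ∀ c → values (form v) (s [ i ]≔ c) ≈ (⟦ row i c ⟧ v * rest) * g s
        at c = trans (factors v (s [ i ]≔ c)) (*-cong (trans (∏-split i (entry (s [ i ]≔ c))) (*-cong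
          (reflexive (≡.cong₂ (λ x c → mask x (⟦ row i c ⟧ v)) i∈T (lookup∘update i s c)))
          (∏-except-cong i λ k k≢i → reflexive (≡.cong (λ c → mask (lookup T k) (⟦ row k c ⟧ v)) (lookup∘update′ k≢i s c)))))
          (independent i i∈T s c))

  ∏-nonzero : ∀ {n} {f : Fin n → Carrier} → (∀ i → ¬ (f i ≈ 0#)) → ¬ (∏ f ≈ 0#)
  ∏-nonzero {zero}  ne = 1≉0
  ∏-nonzero {suc n} ne = *-nonzero (ne zero) (∏-nonzero (ne ∘ suc))

  module DecompositionOfSplitting {j : Fin m} (ψ : FactorizationCurve φ j) where

    open IncidentCurve (incidentCurve ψ)
    private
      module Vⱼ = LeftModule (V j)
      module T = LeftModule (V* V)

    module _ {S : Subset m} (L : CurveSplitting.LinearSplitting (incidentCurve ψ) S)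
      (size≡ : ∣ S ∣ ≡ RegularMap.deg (FactorizationCurve.curve ψ)) where
      open CurveSplitting.LinearSplitting L

      -- At the basis vector `b₁` the components of `row i` are the two entries of `b i`, which are
      -- not both zero because the determinant is nonzero. Contracting with the corresponding basis
      -- vector loses nothing.
      pivot : Fin m → Fin 2
      pivot i with em {b i 0F ≈ 0#}
      ... | yes _ = 1F
      ... | no  _ = 0F

      pivot≉0 : ∀ i → lookup S i ≡ true → ¬ (b i (pivot i) ≈ 0#)
      pivot≉0 i i∈S with em {b i 0F ≈ 0#}
      ... | no ne = ne
      ... | yes e = λ e′ → det≉0 i i∈S (trans (+-cong (*-congˡ e′) (-‿cong (*-congˡ e)))
            (solve 2 (λ x y → x :* :0 :+ :- (y :* :0) := :0) refl (a i 0F) (a i 1F)))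

      κ : Carrier
      κ = ∏ λ r → mask (lookup S r) (b r (pivot r))

      κ≉0 : ¬ (κ ≈ 0#)
      κ≉0 = ∏-nonzero λ r → by-case r (lookup S r) ≡.refl
        where
        by-case : ∀ r x → lookup S r ≡ x → ¬ (mask x (b r (pivot r)) ≈ 0#)
        by-case r true  e = pivot≉0 r e
        by-case r false e = 1≉0

      b₁ : ∥ V j ∥
      b₁ = basis (B j) 1F

      -- The remaining factor is constant along the curve, so one point determines it: at `b₁`,
      -- contracting the slots of `S` at their pivots leaves `κ` times the tensor with coordinates
      -- `g`.
      γ : Tensor {I = ∃[ r ] r ∉ S} (λ r → Dual (V (proj₁ r)))
      γ = contractSlots B S pivot (⟦ φ ⟧ (form b₁))

      row-b₁ : ∀ r c → ⟦ row r c ⟧ b₁ ≈ b r c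
      row-b₁ r c = trans (+-cong (*-congˡ (coordinate-other (B j) λ ())) (*-congˡ (coordinate-same (B j) 1F)))
        (solve 2 (λ x y → x :* :0 :+ y :* :1 := y) refl (a r c) (b r c))

      values-b₁ : ∀ s → values (form b₁) (replace B S pivot s) ≈ κ * g s
      values-b₁ s = trans (factors b₁ s′) (*-cong
        (∏-cong λ r → by-case r (lookup S r) ≡.refl)
        (independent-all S g independent s′ s λ r r∉S → ≡.trans (lookup∘tabulate _ r)
          (≡.cong (λ x → pick B S pivot x (pivot r) (lookup s r)) r∉S)))
        where
        s′ = replace B S pivot s
        by-case : ∀ r x → lookup S r ≡ x → mask x (⟦ row r (lookup s′ r) ⟧ b₁) ≈ mask x (b r (pivot r))
        by-case r false e = refl
        by-case r true  e = trans (row-b₁ r (lookup s′ r)) (reflexive (≡.cong (b r) (≡.trans (lookup∘tabulate _ r)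
          (≡.cong (λ x → pick B S pivot x (pivot r) (lookup s r)) e))))

      slotMap : ∀ r → LinearMap (Dual (V j)) (Dual (V r))
      slotMap r = dualMap (B j) (B r) (a r) (b r)

      -- In a plane the kernel of a nonzero α is spanned by the vector with coordinates
      -- `(- α₁ , α₀)`. It recovers the line ℓ from its annihilator.
      annihilated : Covector (V j) → ∥ V j ∥
      annihilated α = (- ⟦ α ⟧ b₁) Vⱼ.*ₗ basis (B j) 0F Vⱼ.+ᴹ ⟦ α ⟧ (basis (B j) 0F) Vⱼ.*ₗ b₁

      filled : Covector (V j) → ∥ V* V ∥
      filled α = fill {W = λ r → Dual (V r)} S (λ r _ → ⟦ slotMap r ⟧ α) γ

      coords-filled : ∀ α s → coords (filled α) s ≈ κ * values (form (annihilated α)) s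
      coords-filled α s = begin
        coords (filled α) s
          ≈⟨ coords-fill B S pivot (λ r → ⟦ slotMap r ⟧ α) (⟦ φ ⟧ (form b₁)) s ⟩
        (∏ λ r → mask (lookup S r) (⟦ ⟦ slotMap r ⟧ α ⟧ (corner s r))) * values (form b₁) (replace B S pivot s)
          ≈⟨ *-cong (∏-cong λ r → mask-cong (lookup S r) (entry-row r (lookup s r))) (values-b₁ s) ⟩
        (∏ λ r → mask (lookup S r) (⟦ row r (lookup s r) ⟧ (annihilated α))) * (κ * g s)
          ≈⟨ solve 3 (λ p k g → p :* (k :* g) := k :* (p :* g)) refl _ κ (g s) ⟩
        κ * ((∏ λ r → mask (lookup S r) (⟦ row r (lookup s r) ⟧ (annihilated α))) * g s)
          ≈⟨ *-congˡ (factors (annihilated α) s) ⟨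
        κ * values (form (annihilated α)) s ∎
        where
        mask-cong : ∀ x {y z} → y ≈ z → mask x y ≈ mask x z
        mask-cong true  e = e
        mask-cong false e = refl
        entry-row : ∀ r c → ⟦ ⟦ slotMap r ⟧ α ⟧ (basis (B r) c) ≈ ⟦ row r c ⟧ (annihilated α)
        entry-row r c = trans (dualMap-basis (B j) (B r) (a r) (b r) α c)
          (trans (solve 4 (λ a b x y → b :* x :+ :- (a :* y) := a :* (:- y) :+ b :* x) refl (a r c) (b r c) (⟦ α ⟧ (basis (B j) 0F)) (⟦ α ⟧ b₁))
            (sym (+-cong (*-congˡ (proj₁ (coordinate-combination₂ (B j) _ _))) (*-congˡ (proj₂ (coordinate-combination₂ (B j) _ _))))))

      annihilated-nonzero : ∀ α → NonZero (Dual (V j)) α → NonZero (V j) (annihilated α)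
      annihilated-nonzero α α≉0 e = α≉0 λ v → trans (covector-expand₂ (B j) α v)
        (trans (+-cong (*-congʳ α₀≈0) (*-congʳ α₁≈0)) (solve 2 (λ x y → :0 :* x :+ :0 :* y := :0) refl _ _))
        where
        α₀≈0 : ⟦ α ⟧ (basis (B j) 0F) ≈ 0#
        α₀≈0 = trans (sym (proj₂ (coordinate-combination₂ (B j) _ _))) (trans (cov-cong (coordinate (B j) 1F) e) (cov-0 (coordinate (B j) 1F)))
        α₁≈0 : ⟦ α ⟧ b₁ ≈ 0#
        α₁≈0 = trans (solve 1 (λ x → x := :- (:- x)) refl (⟦ α ⟧ b₁)) (trans (-‿cong (trans (sym (proj₁ (coordinate-combination₂ (B j) _ _)))
          (trans (cov-cong (coordinate (B j) 0F) e) (cov-0 (coordinate (B j) 0F))))) (solve 0 (:- :0 := :0) refl))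

      annihilated-sameLine : ∀ v α → NonZero (V j) v → NonZero (Dual (V j)) α → ⟦ α ⟧ v ≈ 0# → SameLine (V j) v (annihilated α)
      annihilated-sameLine v α v≉0 α≉0 αv≈0 = minor-sameLine j v≉0 (annihilated-nonzero α α≉0) (begin
        ⟦ coordinate (B j) 0F ⟧ v * ⟦ coordinate (B j) 1F ⟧ (annihilated α) + - (⟦ coordinate (B j) 1F ⟧ v * ⟦ coordinate (B j) 0F ⟧ (annihilated α))
          ≈⟨ +-cong (*-congˡ (proj₂ (coordinate-combination₂ (B j) _ _))) (-‿cong (*-congˡ (proj₁ (coordinate-combination₂ (B j) _ _)))) ⟩
        ⟦ coordinate (B j) 0F ⟧ v * ⟦ α ⟧ (basis (B j) 0F) + - (⟦ coordinate (B j) 1F ⟧ v * - ⟦ α ⟧ b₁)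
          ≈⟨ solve 4 (λ x y p q → x :* p :+ :- (y :* (:- q)) := p :* x :+ q :* y) refl (⟦ coordinate (B j) 0F ⟧ v) (⟦ coordinate (B j) 1F ⟧ v) (⟦ α ⟧ (basis (B j) 0F)) (⟦ α ⟧ b₁) ⟩
        ⟦ α ⟧ (basis (B j) 0F) * ⟦ coordinate (B j) 0F ⟧ v + ⟦ α ⟧ b₁ * ⟦ coordinate (B j) 1F ⟧ v
          ≈⟨ covector-expand₂ (B j) α v ⟨
        ⟦ α ⟧ v                                             ≈⟨ αv≈0 ⟩
        0# ∎)

      filled-multiple : ∀ α → filled α T.≈ᴹ κ T.*ₗ ⟦ φ ⟧ (form (annihilated α))
      filled-multiple α = tensor-ext {filled α} {κ ⊙ ⟦ φ ⟧ (form (annihilated α))} (coords-filled α)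

      decomposes : ∀ v → NonZero (V j) v → ∀ α → NonZero (Dual (V j)) α → ⟦ α ⟧ v ≈ 0# →
                   SameLine (V* V) (⟦ φ ⟧ (form v)) (filled α)
      decomposes v v≉0 α α≉0 αv≈0 = sameLine-trans (V* V) {⟦ φ ⟧ (form v)} {⟦ φ ⟧ (form (annihilated α))} {filled α}
        (image (sameLine-form (incidentCurve ψ) v (annihilated α) (annihilated-sameLine v α v≉0 α≉0 αv≈0)))
        (sameLine-sym (V* V) {filled α} {⟦ φ ⟧ (form (annihilated α))} (κ , κ≉0 , filled-multiple α))
        where
        image : ∀ {x y} → SameLine H x y → SameLine (V* V) (⟦ φ ⟧ x) (⟦ φ ⟧ y)
        image {x} {y} (c , c≉0 , e) = c , c≉0 , T.≈ᴹ-trans (LinearMap.⟦⟧-cong φ e) (LinearMap.*ₗ-homo φ c y)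

      -- A zero `γ` would fill to the zero tensor, which by `coords-filled` is `κ` times a point of
      -- the curve; `κ` and that point are nonzero.
      γ-nonzero : NonZero (⨂ (λ (r : ∃[ r ] r ∉ S) → Dual (V (proj₁ r)))) γ
      γ-nonzero γ≈0 = proj₂ nz (*-zero-cancelˡ κ≉0 (trans (sym (coords-filled α (proj₁ nz)))
        (cov-cong (coord (proj₁ nz)) (fill-cong {W = λ r → Dual (V r)} S (λ r → ⟦ slotMap r ⟧ α) γ≈0))))
        where
        α : Covector (V j)
        α = coordinate (B j) 1F
        α≉0 : NonZero (Dual (V j)) α
        α≉0 e = 0≉1 (trans (sym (e b₁)) (coordinate-same (B j) 1F))
        nz : ∃[ s ] ¬ (values (form (annihilated α)) s ≈ 0#)
        nz = Φ-nonzero (form (annihilated α)) (form-nonzero (annihilated α) (annihilated-nonzero α α≉0))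

      hasDecomposition : HasDecomposition φ ψ
      hasDecomposition = S , γ , (λ r _ → slotMap r) , size≡ , γ-nonzero ,
        (λ r r∈S → dualMap-isIsomorphism (B j) (B r) (a r) (b r) (det≉0 r ([]=⇒lookup r∈S))) , decomposes

  module SplitIndices (ψ : ∀ j → FactorizationCurve φ j) (j : Fin m) where

    open FactorizationCurve using (curve)
    open CurveSplitting (incidentCurve (ψ j)) public

    abstract
      T : Subset m
      T = tabulate λ i → ⌊ em {SplitSlot i} ⌋

      T⇒split : ∀ i → lookup T i ≡ true → SplitSlot i
      T⇒split i i∈T = from em (≡.trans (≡.sym (lookup∘tabulate (λ i → ⌊ em {SplitSlot i} ⌋) i)) i∈T)
        where
        from : (d : Dec (SplitSlot i)) → ⌊ d ⌋ ≡ true → SplitSlot i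
        from (yes p) _ = p

      split⇒T : ∀ i → SplitSlot i → i ∈ T
      split⇒T i split = lookup⇒[]= i T (≡.trans (lookup∘tabulate (λ i → ⌊ em {SplitSlot i} ⌋) i) (to em))
        where
        to : (d : Dec (SplitSlot i)) → ⌊ d ⌋ ≡ true
        to (yes _) = ≡.refl
        to (no ¬p) = ⊥-elim (¬p split)

    open FromSubset T T⇒split public using (size-≤; module Full-size)

    deg : ℕ
    deg = RegularMap.deg (curve (ψ j))

    line-minor : ¬ (minor j (line 0#) (line 1#) ≈ 0#)
    line-minor e = 1≉0 (trans (sym (trans (+-cong (*-cong (proj₁ (line-coordinates 0#)) (proj₂ (line-coordinates 1#)))
      (-‿cong (*-cong (proj₂ (line-coordinates 0#)) (proj₁ (line-coordinates 1#))))) (solve 0 (:1 :* :1 :+ :- (:0 :* :1) := :1) refl))) e)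

    sameImage⇒split : ∀ i → SameImage (curve (ψ i)) (curve (ψ j)) → SplitSlot i
    sameImage⇒split i same =
      (λ s s′ t → minors-at s s′ t (sameImage-incident (ψ i) (ψ j) same (line t) (line-nonzero t))) ,
      -- Two distinct parameters suffice to exclude a common incident vector; 0 and 1 are taken.
      λ v v≉0 p → sameImage-nonconstant (ψ i) (ψ j) same (line 0#) (line 1#) v line-minor (line-nonzero 0#) (line-nonzero 1#) v≉0 (p 0#) (p 1#)
      where
      minors-at : ∀ s s′ t → (∃[ v ] NonZero (V i) v × Incident i v (IncidentCurve.form (incidentCurve (ψ j)) (line t))) → _
      minors-at s s′ t (v , v≉0 , p) = incident-minors i v (IncidentCurve.form (incidentCurve (ψ j)) (line t)) v≉0 p s s′

    module _ (size≡ : ∣ T ∣ ≡ deg) where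

      splitting : LinearSplitting T
      splitting = Full-size.linearSplitting size≡

      open LinearSplitting splitting
      open SplittingMaps splitting

      T⇒sameImage : ∀ i → i ∈ T → SameImage (curve (ψ i)) (curve (ψ j))
      T⇒sameImage i i∈T = sameImage-from-linear (ψ i) (ψ j) (splittingMap i) matrixMap-surjective matrixMap-injective
        (splittingMap-incident i ([]=⇒lookup i∈T))
        where
        open MatrixMap (B j) (B i) (a i) (b i)
        open Invertible (det≉0 i ([]=⇒lookup i∈T))

    decomposable⇔size : Decomposable φ ψ j ⇔ (∣ T ∣ ≡ deg)
    decomposable⇔size = class-size (λ i → SameImage (curve (ψ i)) (curve (ψ j))) T
      (λ i same → split⇒T i (sameImage⇒split i same)) size-≤ T⇒sameImage

    size⇒hasDecomposition : ∣ T ∣ ≡ deg → HasDecomposition φ (ψ j)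
    size⇒hasDecomposition size≡ = DecompositionOfSplitting.hasDecomposition (ψ j) {T} (splitting size≡) size≡

-- A generic incidence kernel spanned by a vector of forms

module KernelLine (K : CommutativeRing 0ℓ 0ℓ) (F : IsInfiniteField K) (em : ExcludedMiddle 0ℓ)
  {m n : ℕ} {V : Fin m → VectorSpace K} {H : VectorSpace K}
  (φ : LinearAlgebra.LinearMap K H (LinearAlgebra.V* K V)) (φ-injective : LinearAlgebra.IsInjective K φ)
  (B : ∀ j → VectorSpaces.Basis K F em (V j) 2) (C : VectorSpaces.Basis K F em H (suc n)) where

  open CommutativeRing K hiding (zero)
  open FieldProperties K F em
  open LinearAlgebra K
  open LinearMap using (⟦_⟧)
  open VectorSpaces K F em
  open Tensors K F em
  open Forms K F em
  open Elimination K F em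
  open Curves.Incidence K F em {V = V} {H = H} φ φ-injective B C
  open Coordinates B
  open SetoidReasoning setoid
  private
    module H = LeftModule H
    module T = LeftModule (V* V)

  vector : (Fin (suc n) → Carrier) → ∥ H ∥
  vector x = linearCombination H x (basis C)

  coordinates : ∥ H ∥ → Fin (suc n) → Carrier
  coordinates x k = ⟦ coordinate C k ⟧ x

  module _ (j : Fin m) where

    -- The incidence equations in the coordinates of 𝔥: one row for each tensor index, entries
    -- linear in `v`.
    incidenceMatrix : Matrix {V j} {Index m} (suc n)
    incidenceMatrix s k v = contract j v (values (basis C k)) s

    incidenceMatrix-form : ∀ s k → IsForm (V j) ⟨K⟩ 1 (incidenceMatrix s k)
    incidenceMatrix-form s k = plus (times (coordinate (B j) 0F) (const (values (basis C k) (s [ j ]≔ 0F))))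
                                    (times (coordinate (B j) 1F) (const (values (basis C k) (s [ j ]≔ 1F))))

    dot-contract : ∀ v x s → dot (λ k → incidenceMatrix s k v) x ≈ contract j v (values (vector x)) s
    dot-contract v x s = trans (dot-comm (λ k → incidenceMatrix s k v) x)
      (sym (map-linearCombination (contraction j v s) x (basis C)))

    kernel-incident : ∀ v x → InKernel {V j} {Index m} incidenceMatrix v x → Incident j v (vector x)
    kernel-incident v x p s = trans (sym (dot-contract v x s)) (p s)

    incident-kernel : ∀ v x → Incident j v x → InKernel {V j} {Index m} incidenceMatrix v (coordinates x)
    incident-kernel v x p s = trans (dot-contract v (coordinates x) s)
      (trans (cov-cong (contraction j v s) (H.≈ᴹ-sym (expand C x))) (p s))

    kernel-at-point : ∀ v₀ →
      (∀ x y → Incident j v₀ x → Incident j v₀ y → ∀ k l → coordinates x k * coordinates y l ≈ coordinates x l * coordinates y k) →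
      PolynomialKernel {V j} {Index m} incidenceMatrix v₀
    kernel-at-point v₀ line = polynomialKernel n incidenceMatrix incidenceMatrix-form v₀ λ x y x∈ y∈ k l →
      trans (sym (*-cong (coordinate-combination C x k) (coordinate-combination C y l)))
        (trans (line (vector x) (vector y) (kernel-incident v₀ x x∈) (kernel-incident v₀ y y∈) k l)
               (*-cong (coordinate-combination C x l) (coordinate-combination C y k)))

    -- Dense stands for a Zariski dense set of points, on which the kernel of the
    -- incidence relation is known to be nonzero away from the zeros of G.
    module FromKernel (v₀ : ∥ V j ∥) (v₀≉0 : NonZero (V j) v₀)
      (kernel : PolynomialKernel {V j} {Index m} incidenceMatrix v₀)
      (Dense : ∥ V j ∥ → Set)
      (dense : ∀ {e P} → IsForm (V j) ⟨K⟩ e P → (∀ v → Dense v → P v ≈ 0#) → ∀ v → P v ≈ 0#)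
      {d : ℕ} (G : ∥ V j ∥ → Carrier) (G-form : IsForm (V j) ⟨K⟩ d G) (Gv₀≉0 : ¬ (G v₀ ≈ 0#))
      (incident-exists : ∀ v → Dense v → ¬ (G v ≈ 0#) → ∃[ x ] NonZero H x × Incident j v x) where

      open PolynomialKernel kernel

      solution : ∥ V j ∥ → ∥ H ∥
      solution v = vector (λ k → c k v)

      incident-multiple-solution : ∀ v → ¬ (D v ≈ 0#) → ∀ x → Incident j v x → ∃[ a ] x H.≈ᴹ a H.*ₗ solution v
      incident-multiple-solution v Dv≉0 x p = multiple (spans v Dv≉0 (coordinates x) (incident-kernel v x p))
        where
        multiple : (∃[ a ] ∀ k → coordinates x k ≈ a * c k v) → ∃[ a ] x H.≈ᴹ a H.*ₗ solution v
        multiple (a , e) = a , H.≈ᴹ-trans (expand C x) (H.≈ᴹ-trans (linearCombination-cong H (basis C) e)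
                                 (linearCombination-* H a (λ k → c k v) (basis C)))

      -- At a dense point with `D` and `G` nonzero there is a nonzero incident vector. It is a
      -- multiple of `solution v`, which is therefore incident too. Hence the incidence form times
      -- `D G` vanishes on the dense set, so identically, and `D G` can be cancelled.
      solution-incident : ∀ v → Incident j v (solution v)
      solution-incident v s = form-vanishes {V j} {D = DG} {P = Q} DG-form (v₀ , *-nonzero D≉0 Gv₀≉0) Q-form
        (λ v DG≉0 → *-zero-cancelˡ DG≉0 (trans (*-comm _ _) (dense {P = λ v → Q v * DG v} (form-* {V j} {⟨K⟩} Q-form DG-form) on-dense v))) v
        where
        DG : ∥ V j ∥ → Carrier
        DG v = D v * G v
        DG-form : IsForm (V j) ⟨K⟩ (degree-D ℕ.+ d) DG
        DG-form = form-* {V j} {⟨K⟩} D-form G-form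
        Q : ∥ V j ∥ → Carrier
        Q v = contract j v (values (solution v)) s
        Q-form : IsForm (V j) ⟨K⟩ (1 ℕ.+ degree-c) Q
        Q-form = equal (λ v → dot-contract v (λ k → c k v) s)
          (form-sum {V j} {⟨K⟩} λ k → form-* {V j} {⟨K⟩} (incidenceMatrix-form s k) (c-form k))
        from : ∀ v → ¬ (DG v ≈ 0#) → (∃[ x ] NonZero H x × Incident j v x) → Q v ≈ 0#
        from v DG≉0 (x , x≉0 , p) = multiple (incident-multiple-solution v (*-nonzeroˡ DG≉0) x p)
          where
          multiple : (∃[ a ] x H.≈ᴹ a H.*ₗ solution v) → Q v ≈ 0#
          multiple (a , e) = incident-sameLine j v {x} {solution v}
            (a , (λ a≈0 → x≉0 (H.≈ᴹ-trans e (H.≈ᴹ-trans (H.*ₗ-congʳ a≈0) (H.*ₗ-zeroˡ _)))) , e) p s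
        on-dense : ∀ v → Dense v → Q v * DG v ≈ 0#
        on-dense v v∈ = by-case (DG v ≟0)
          where
          by-case : Dec (DG v ≈ 0#) → Q v * DG v ≈ 0#
          by-case (yes DG≈0) = trans (*-congˡ DG≈0) (zeroʳ _)
          by-case (no DG≉0) = trans (*-congʳ (from v DG≉0 (incident-exists v v∈ (*-nonzeroʳ DG≉0)))) (zeroˡ _)

      InImage : ∥ V j ∥ → ∥ V* V ∥ → Set
      InImage v t = (∃[ x ] ⟦ φ ⟧ x T.≈ᴹ t) × Σ⁰ V j v t

      one-dimensional : ∀ v → NonZero (V j) v → ¬ (D v ≈ 0#) → SubspaceDimension (V* V) (InImage v) 1
      one-dimensional v v≉0 Dv≉0 = (λ _ → ⟦ φ ⟧ (solution v)) ,
        (λ _ → (solution v , T.≈ᴹ-refl) , incident-Σ⁰ j v (solution v) v≉0 (solution-incident v)) ,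
        independent , spanned
        where
        independent : ∀ (a : Fin 1 → Carrier) → linearCombination (V* V) a (λ _ → ⟦ φ ⟧ (solution v)) T.≈ᴹ T.0ᴹ → ∀ i → a i ≈ 0#
        independent a e zero = *-zero-cancelˡ (proj₂ (nonzero v Dv≉0)) (begin
          c k v * a zero                                   ≈⟨ *-comm _ _ ⟩
          a zero * c k v                                   ≈⟨ *-congˡ (coordinate-combination C (λ k → c k v) k) ⟨
          a zero * ⟦ coordinate C k ⟧ (solution v)         ≈⟨ cov-* (coordinate C k) (a zero) (solution v) ⟨
          ⟦ coordinate C k ⟧ (a zero H.*ₗ solution v)      ≈⟨ cov-cong (coordinate C k) aC≈0 ⟩
          ⟦ coordinate C k ⟧ H.0ᴹ                          ≈⟨ cov-0 (coordinate C k) ⟩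
          0# ∎)
          where
          k = proj₁ (nonzero v Dv≉0)
          aC≈0 : a zero H.*ₗ solution v H.≈ᴹ H.0ᴹ
          aC≈0 = φ-injective (T.≈ᴹ-trans (LinearMap.*ₗ-homo φ (a zero) (solution v))
            (T.≈ᴹ-trans (T.≈ᴹ-sym (T.+ᴹ-identityʳ _)) (T.≈ᴹ-trans e (T.≈ᴹ-sym (LinearMap.0ᴹ-homo φ)))))
        spanned : ∀ t → InImage v t → ∃[ a ] t T.≈ᴹ linearCombination (V* V) {1} a (λ _ → ⟦ φ ⟧ (solution v))
        spanned t ((x , φx≈t) , t∈) = multiple (incident-multiple-solution v Dv≉0 x
            (Σ⁰-incident j v x (Σ⁰-resp j v {t} {⟦ φ ⟧ x} (T.≈ᴹ-sym φx≈t) t∈)))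
          where
          multiple : (∃[ a ] x H.≈ᴹ a H.*ₗ solution v) → ∃[ a ] t T.≈ᴹ linearCombination (V* V) {1} a (λ _ → ⟦ φ ⟧ (solution v))
          multiple (a , e) = (λ _ → a) , T.≈ᴹ-trans (T.≈ᴹ-sym φx≈t) (T.≈ᴹ-trans (LinearMap.⟦⟧-cong φ e)
            (T.≈ᴹ-trans (LinearMap.*ₗ-homo φ a (solution v)) (T.≈ᴹ-sym (T.+ᴹ-identityʳ _))))

      generically-one-dimensional : Generic (V j) λ v → SubspaceDimension (V* V) (InImage v) 1
      generically-one-dimensional =
        record { size = 1 ; degree = λ _ → degree-D ; form = λ _ → D ; isForm = λ _ → D-form } ,
        (v₀ , v₀≉0 , zero , D≉0) ,
        λ { v v≉0 (zero , Dv≉0) → one-dimensional v v≉0 Dv≉0 }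

-- Complexifying a factorization structure and its curves

module ComplexStructure (R : CommutativeRing 0ℓ 0ℓ) (FR : IsInfiniteField R)
  (Fℂ : IsInfiniteField (complexNumbers R)) (em : ExcludedMiddle 0ℓ)
  (real-points : ∀ n → CommutativeRing._≈_ (complexNumbers R)
     (IsInfiniteField.point Fℂ n) (Complexification.fromReal R (IsInfiniteField.point FR n)))
  {m : ℕ} {V : Fin m → VectorSpace R} {H : VectorSpace R}
  (φ : LinearAlgebra.LinearMap R H (LinearAlgebra.V* R V))
  (structure : LinearAlgebra.IsFactorizationStructure R φ) where

  open CommutativeRing R hiding (zero)
  open RingProperties ring using (-0#≈0#)
  open RawSemiringDefs (Semiring.rawSemiring semiring) using (_^_)
  open RawMonoidDefs +-rawMonoid using (sum)
  open Solver R
  open Complexification R using (fromReal; 𝕚; dual⊗ℂ; tensor⊗ℂ; fromReal-*; fromReal-+)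
  module ℂ = CommutativeRing (complexNumbers R)
  module Lℂ = LinearAlgebra (complexNumbers R)
  open RawSemiringDefs (Semiring.rawSemiring ℂ.semiring) using () renaming (_^_ to _^ᶜ_)
  open RawMonoidDefs ℂ.+-rawMonoid using () renaming (sum to sumᶜ)
  open ComplexVectors R FR Fℂ em hiding (module ℂ; module Lℂ)
  open LR using (Covector; LinearMap; ∥_∥; Dual; V*; IsForm; ⟨K⟩)
  open LR.LinearMap using (⟦_⟧)
  open Lℂ.LinearMap using () renaming (⟦_⟧ to ⟦_⟧ᶜ)
  open LR.IsFactorizationStructure structure
  private
    module H = LeftModule H
    module Hᶜ = LeftModule (complexSpace R H)
    module ∏R = Products R
    module ∏C = Products (complexNumbers R)

  B : ∀ j → VR.Basis (V j) 2
  B j = VR.mkBasis (dimension-V j)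

  C : VR.Basis H (suc m)
  C = VR.mkBasis dimension-H

  Bᶜ : ∀ j → VC.Basis (complexSpaces R {m} {V} j) 2
  Bᶜ j = basisℂ {V j} (B j)

  Cᶜ : VC.Basis (complexSpace R H) (suc m)
  Cᶜ = basisℂ {H} C

  φᶜ : Lℂ.LinearMap (complexSpace R H) (Lℂ.V* (complexSpaces R {m} {V}))
  φᶜ = Complexification.complexify R {m} {V} {H} φ

  module TR = Tensors.Coordinates R FR em {V = V} B
  module TC = Tensors.Coordinates (complexNumbers R) Fℂ em {V = complexSpaces R {m} {V}} Bᶜ
  module IR = Geometry R FR em {V = V} {H = H} φ injective B C

  Index : Set
  Index = Tensors.Index R FR em m

  ∏-fromReal : ∀ {n} (f : Fin n → Carrier) → ∏C.∏ (λ i → fromReal (f i)) ℂ.≈ fromReal (∏R.∏ f)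
  ∏-fromReal {zero}  f = ℂ.refl {ℂ.1#}
  ∏-fromReal {suc n} f = ℂ.trans {fromReal (f zero) ℂ.* ∏C.∏ (λ i → fromReal (f (suc i)))}
    (ℂ.*-congˡ {fromReal (f zero)} {∏C.∏ (λ i → fromReal (f (suc i)))} (∏-fromReal (f ∘ suc)))
    (ℂ.sym {fromReal (f zero * ∏R.∏ (f ∘ suc))} (fromReal-* (f zero) (∏R.∏ (f ∘ suc))))

  coords-fromReal : ∀ t s → TC.coords (tensor⊗ℂ {m} {V} t) s ℂ.≈ fromReal (TR.coords t s)
  coords-fromReal (LR.pure α) s = ℂ.trans {TC.coords (tensor⊗ℂ {m} {V} (LR.pure α)) s}
    (∏C.∏-cong {f = λ r → ⟦ dual⊗ℂ {V r} (α r) ⟧ᶜ (real (V r) (TR.corner s r))} {g = λ r → fromReal (⟦ α r ⟧ (TR.corner s r))}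
      (λ r → dual⊗ℂ-real {V r} (α r) (TR.corner s r)))
    (∏-fromReal λ r → ⟦ α r ⟧ (TR.corner s r))
  coords-fromReal LR.𝟘 s = ℂ.refl {ℂ.0#}
  coords-fromReal (t LR.⊕ u) s = ℂ.trans {TC.coords (tensor⊗ℂ {m} {V} t) s ℂ.+ TC.coords (tensor⊗ℂ {m} {V} u) s}
    (ℂ.+-cong {TC.coords (tensor⊗ℂ {m} {V} t) s} {fromReal (TR.coords t s)} {TC.coords (tensor⊗ℂ {m} {V} u) s} {fromReal (TR.coords u s)}
      (coords-fromReal t s) (coords-fromReal u s))
    (ℂ.sym {fromReal (TR.coords t s + TR.coords u s)} (fromReal-+ (TR.coords t s) (TR.coords u s)))
  coords-fromReal (a LR.⊙ t) s = ℂ.trans {fromReal a ℂ.* TC.coords (tensor⊗ℂ {m} {V} t) s}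
    (ℂ.*-congˡ {fromReal a} {TC.coords (tensor⊗ℂ {m} {V} t) s} (coords-fromReal t s))
    (ℂ.sym {fromReal (a * TR.coords t s)} (fromReal-* a (TR.coords t s)))

  -- At real test vectors the complexified tensor has real and imaginary parts given by `x` and `y`
  -- separately. Injectivity and incidence at real points reduce to ℝ through this formula.
  coords-complexify : ∀ x y s → TC.coords (⟦ φᶜ ⟧ᶜ (x , y)) s ℂ.≈ (IR.values x s , IR.values y s)
  coords-complexify x y s = real+𝕚 {TC.coords (tensor⊗ℂ {m} {V} (⟦ φ ⟧ x)) s} {TC.coords (tensor⊗ℂ {m} {V} (⟦ φ ⟧ y)) s}
    (coords-fromReal (⟦ φ ⟧ x) s) (coords-fromReal (⟦ φ ⟧ y) s)

  injectiveᶜ : Lℂ.IsInjective φᶜ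
  injectiveᶜ {x , y} {x′ , y′} e = IR.Φ-ext (λ s → proj₁ (values≈ s)) , IR.Φ-ext (λ s → proj₂ (values≈ s))
    where
    values≈ : ∀ s → (IR.values x s , IR.values y s) ℂ.≈ (IR.values x′ s , IR.values y′ s)
    values≈ s = ℂ.trans {IR.values x s , IR.values y s} (ℂ.sym {TC.coords (⟦ φᶜ ⟧ᶜ (x , y)) s} (coords-complexify x y s))
      (ℂ.trans {TC.coords (⟦ φᶜ ⟧ᶜ (x , y)) s} (VC.cov-cong (TC.coord s) {⟦ φᶜ ⟧ᶜ (x , y)} {⟦ φᶜ ⟧ᶜ (x′ , y′)} e) (coords-complexify x′ y′ s))

  module IC = Curves.Incidence (complexNumbers R) Fℂ em {V = complexSpaces R {m} {V}} {H = complexSpace R H} φᶜ injectiveᶜ Bᶜ Cᶜ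

  contract-real : ∀ j v (a : Index → ℂ.Carrier) (b c : Index → Carrier) → (∀ s → a s ℂ.≈ (b s , c s)) →
                  ∀ s → TC.contract j (real (V j) v) a s ℂ.≈ (TR.contract j v b s , TR.contract j v c s)
  contract-real j v a b c e s = ℂ.+-cong {κ 0F ℂ.* a (s [ j ]≔ 0F)} {_ , _} {κ 1F ℂ.* a (s [ j ]≔ 1F)} {_ , _} (at 0F) (at 1F)
    where
    κ : Fin 2 → ℂ.Carrier
    κ k = ⟦ VC.coordinate (Bᶜ j) k ⟧ᶜ (real (V j) v)
    at : ∀ k → κ k ℂ.* a (s [ j ]≔ k) ℂ.≈ (⟦ VR.coordinate (B j) k ⟧ v * b (s [ j ]≔ k) , ⟦ VR.coordinate (B j) k ⟧ v * c (s [ j ]≔ k))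
    at k = ℂ.trans {κ k ℂ.* a (s [ j ]≔ k)} (ℂ.*-congˡ {κ k} {a (s [ j ]≔ k)} (e (s [ j ]≔ k)))
      (real-* {κ k} (refl , VR.cov-0 (VR.coordinate (B j) k)))

  contract-values-real : ∀ j v x y s → TC.contract j (real (V j) v) (IC.values (x , y)) s ℂ.≈
                         (TR.contract j v (IR.values x) s , TR.contract j v (IR.values y) s)
  contract-values-real j v x y = contract-real j v (IC.values (x , y)) (IR.values x) (IR.values y) (coords-complexify x y)

  incident-real : ∀ j v x y → IR.Incident j v x → IR.Incident j v y → IC.Incident j (real (V j) v) (x , y)
  incident-real j v x y p q s = ℂ.trans {TC.contract j (real (V j) v) (IC.values (x , y)) s} (contract-values-real j v x y s) (p s , q s)

  real-incident : ∀ j v x y → IC.Incident j (real (V j) v) (x , y) → IR.Incident j v x × IR.Incident j v y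
  real-incident j v x y p = (λ s → proj₁ (at s)) , (λ s → proj₂ (at s))
    where
    at : ∀ s → (TR.contract j v (IR.values x) s , TR.contract j v (IR.values y) s) ℂ.≈ ℂ.0#
    at s = ℂ.trans {TR.contract j v (IR.values x) s , TR.contract j v (IR.values y) s}
      (ℂ.sym {TC.contract j (real (V j) v) (IC.values (x , y)) s} (contract-values-real j v x y s)) (p s)

  real-nonzero : ∀ W v → LR.NonZero W v → Lℂ.NonZero (complexSpace R W) (real W v)
  real-nonzero W v v≉0 e = v≉0 (proj₁ e)

  open FieldProperties R FR em
  private
    module T = LeftModule (V* V)

  module AtSlot (j : Fin m) where

    G : Forms.GenericForm R FR em (V j) (λ v → LR.SubspaceDimension (V* V) (λ T → (∃[ x ] ⟦ φ ⟧ x T.≈ᴹ T) × LR.Σ⁰ V j v T) 1)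
    G = Forms.genericForm R FR em (B j) (intersection j)
    module G = Forms.GenericForm G

    record RealKernel (v : ∥ V j ∥) : Set where
      field
        z         : ∥ H ∥
        z≉0       : LR.NonZero H z
        incident  : IR.Incident j v z
        multiple  : ∀ x → IR.Incident j v x → ∃[ c ] x H.≈ᴹ c H.*ₗ z

    realKernel : ∀ v → ¬ (G.form v ≈ 0#) → RealKernel v
    realKernel v ne = from (G.generic v ne)
      where
      from : LR.SubspaceDimension (V* V) (λ T → (∃[ x ] ⟦ φ ⟧ x T.≈ᴹ T) × LR.Σ⁰ V j v T) 1 → RealKernel v
      from (b , b∈ , independent , spanned) = record
        { z = z
        ; z≉0 = λ z≈0 → 1≉0 (independent (λ _ → 1#) (T.≈ᴹ-trans (T.+ᴹ-identityʳ _) (T.≈ᴹ-trans (T.*ₗ-identityˡ (b zero))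
            (T.≈ᴹ-trans (T.≈ᴹ-sym φz≈b) (T.≈ᴹ-trans (LR.LinearMap.⟦⟧-cong φ z≈0) (LR.LinearMap.0ᴹ-homo φ))))) zero)
        ; incident = IR.Σ⁰-incident j v z (TR.Σ⁰-resp j v {b zero} {⟦ φ ⟧ z} (T.≈ᴹ-sym φz≈b) (proj₂ (b∈ zero)))
        ; multiple = λ x p → combine x (spanned (⟦ φ ⟧ x) ((x , T.≈ᴹ-refl) , IR.incident-Σ⁰ j v x (G.nonzero v ne) p))
        }
        where
        z = proj₁ (proj₁ (b∈ zero))
        φz≈b : ⟦ φ ⟧ z T.≈ᴹ b zero
        φz≈b = proj₂ (proj₁ (b∈ zero))
        combine : ∀ x → ∃[ c ] ⟦ φ ⟧ x T.≈ᴹ LR.linearCombination (V* V) c b → ∃[ c ] x H.≈ᴹ c H.*ₗ z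
        combine x (c , e) = c zero , injective (T.≈ᴹ-trans e (T.≈ᴹ-trans (T.+ᴹ-identityʳ _)
          (T.≈ᴹ-trans (T.*ₗ-congˡ (T.≈ᴹ-sym φz≈b)) (T.≈ᴹ-sym (LR.LinearMap.*ₗ-homo φ (c zero) z)))))

    v₀ : ∥ V j ∥
    v₀ = proj₁ G.witness

    κ : Fin (suc m) → ∥ H ∥ → Carrier
    κ k x = ⟦ VR.coordinate C k ⟧ x

    -- The equations at the real vector `v₀` are real, so real and imaginary part of a solution are
    -- each a real multiple of the same vector `z`; every complex solution is then a complex
    -- multiple of `z`.
    complex-line : ∀ x y → IC.Incident j (real (V j) v₀) x → IC.Incident j (real (V j) v₀) y → ∀ k l →
      ((κ k (proj₁ x) , κ k (proj₂ x)) ℂ.* (κ l (proj₁ y) , κ l (proj₂ y))) ℂ.≈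
      ((κ l (proj₁ x) , κ l (proj₂ x)) ℂ.* (κ k (proj₁ y) , κ k (proj₂ y)))
    complex-line (a , b) (a′ , b′) x∈ y∈ k l =
      ( trans (+-cong (*-cong (at a∈ k) (at a′∈ l)) (*-cong (-‿cong (at b∈ k)) (at b′∈ l)))
        (trans (solve 6 (λ α β α′ β′ z w → (α :* z) :* (α′ :* w) :+ (:- (β :* z)) :* (β′ :* w) := (α :* w) :* (α′ :* z) :+ (:- (β :* w)) :* (β′ :* z))
                 refl (proj₁ a∈) (proj₁ b∈) (proj₁ a′∈) (proj₁ b′∈) (κ k z) (κ l z))
          (sym (+-cong (*-cong (at a∈ l) (at a′∈ k)) (*-cong (-‿cong (at b∈ l)) (at b′∈ k)))))
      , trans (+-cong (*-cong (at a∈ k) (at b′∈ l)) (*-cong (at b∈ k) (at a′∈ l)))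
        (trans (solve 6 (λ α β α′ β′ z w → (α :* z) :* (β′ :* w) :+ (β :* z) :* (α′ :* w) := (α :* w) :* (β′ :* z) :+ (β :* w) :* (α′ :* z))
                 refl (proj₁ a∈) (proj₁ b∈) (proj₁ a′∈) (proj₁ b′∈) (κ k z) (κ l z))
          (sym (+-cong (*-cong (at a∈ l) (at b′∈ k)) (*-cong (at b∈ l) (at a′∈ k))))) )
      where
      open RealKernel (realKernel v₀ (proj₂ G.witness))
      a∈ = multiple a (proj₁ (real-incident j v₀ a b x∈))
      b∈ = multiple b (proj₂ (real-incident j v₀ a b x∈))
      a′∈ = multiple a′ (proj₁ (real-incident j v₀ a′ b′ y∈))
      b′∈ = multiple b′ (proj₂ (real-incident j v₀ a′ b′ y∈))
      at : ∀ {x} (x∈ : ∃[ c ] x H.≈ᴹ c H.*ₗ z) k → κ k x ≈ proj₁ x∈ * κ k z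
      at (c , e) k = trans (VR.cov-cong (VR.coordinate C k) e) (VR.cov-* (VR.coordinate C k) c z)

    Gᶜ : ComplexScalarForm {V j} G.degree G.form
    Gᶜ = complexScalarForm G.isForm
    module Gᶜ = ComplexScalarForm Gᶜ

    Gᶜ-nonzero : ∀ v → ¬ (G.form v ≈ 0#) → ¬ (Gᶜ.form (real (V j) v) ℂ.≈ ℂ.0#)
    Gᶜ-nonzero v ne e = ne (proj₁ (ℂ.trans {fromReal (G.form v)} (ℂ.sym {Gᶜ.form (real (V j) v)} (Gᶜ.at-real v)) e))

    -- The dense set fed to `FromKernel`: complex forms are determined by their values on it, and on
    -- it the real structure provides incident vectors.
    IsReal : Lℂ.∥ complexSpace R (V j) ∥ → Set
    IsReal z = ∃[ v ] z ≡ real (V j) v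

    real-kernel-exists : ∀ z → IsReal z → ¬ (Gᶜ.form z ℂ.≈ ℂ.0#) → ∃[ x ] Lℂ.NonZero (complexSpace R H) x × IC.Incident j z x
    real-kernel-exists z (v , ≡.refl) ne = real H K.z , real-nonzero H K.z K.z≉0 ,
      incident-real j v K.z H.0ᴹ K.incident (λ s → VR.cov-0 (IR.contraction j v s))
      where
      module K = RealKernel (realKernel v λ e → ne (ℂ.trans {Gᶜ.form (real (V j) v)} (Gᶜ.at-real v) (e , refl)))

    module KL = KernelLine (complexNumbers R) Fℂ em {V = complexSpaces R {m} {V}} {H = complexSpace R H} φᶜ injectiveᶜ Bᶜ Cᶜ

    module FK = KL.FromKernel j (real (V j) v₀) (real-nonzero (V j) v₀ (G.nonzero v₀ (proj₂ G.witness)))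
      (KL.kernel-at-point j (real (V j) v₀) complex-line)
      IsReal (λ p z → vanishes-at-real real-points {V j} p λ v → z (real (V j) v) (v , ≡.refl))
      Gᶜ.form Gᶜ.isForm (Gᶜ-nonzero v₀ (proj₂ G.witness)) real-kernel-exists

  isFactorizationStructureᶜ : Lℂ.IsFactorizationStructure φᶜ
  isFactorizationStructureᶜ = record
    { dimension-V = λ j → VC.Basis.dimension (Bᶜ j)
    ; dimension-H = VC.Basis.dimension Cᶜ
    ; injective = injectiveᶜ
    ; intersection = λ j → AtSlot.FK.generically-one-dimensional j
    }

  fromReal-product : ∀ {z w a b} → z ℂ.≈ fromReal a → w ℂ.≈ fromReal b → (z ℂ.* w) ℂ.≈ fromReal (a * b)
  fromReal-product {z} {w} {a} {b} e e′ = ℂ.trans {z ℂ.* w} (ℂ.*-cong {z} {fromReal a} {w} {fromReal b} e e′)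
    (ℂ.sym {fromReal (a * b)} (fromReal-* a b))

  fromReal-sum : ∀ {z w a b} → z ℂ.≈ fromReal a → w ℂ.≈ fromReal b → (z ℂ.+ w) ℂ.≈ fromReal (a + b)
  fromReal-sum {z} {w} {a} {b} e e′ = ℂ.trans {z ℂ.+ w} (ℂ.+-cong {z} {fromReal a} {w} {fromReal b} e e′)
    (ℂ.sym {fromReal (a + b)} (fromReal-+ a b))

  fromReal-neg : ∀ {z a} → z ℂ.≈ fromReal a → (ℂ.- z) ℂ.≈ fromReal (- a)
  fromReal-neg {z} {a} e = ℂ.trans {ℂ.- z} (ℂ.-‿cong {z} {fromReal a} e) (refl , -0#≈0#)

  fromReal-power : ∀ n {z a} → z ℂ.≈ fromReal a → (z ^ᶜ n) ℂ.≈ fromReal (a ^ n)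
  fromReal-power zero    e = ℂ.refl {ℂ.1#}
  fromReal-power (suc n) {z} {a} e = fromReal-product {z} {z ^ᶜ n} e (fromReal-power n e)

  fromReal-sums : ∀ {n} {z : Fin n → ℂ.Carrier} {a : Fin n → Carrier} → (∀ i → z i ℂ.≈ fromReal (a i)) → sumᶜ z ℂ.≈ fromReal (sum a)
  fromReal-sums {zero}  e = ℂ.refl {ℂ.0#}
  fromReal-sums {suc n} {z} {a} e = fromReal-sum {z zero} {sumᶜ (z ∘ suc)} (e zero) (fromReal-sums (e ∘ suc))

  values-real : ∀ x s → IC.values (real H x) s ℂ.≈ fromReal (IR.values x s)
  values-real x s = ℂ.trans {IC.values (real H x) s} (coords-complexify x H.0ᴹ s) (refl , VR.cov-0 (IR.Φ s))

  coordinate-real : ∀ j k v → ⟦ VC.coordinate (Bᶜ j) k ⟧ᶜ (real (V j) v) ℂ.≈ fromReal (⟦ VR.coordinate (B j) k ⟧ v)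
  coordinate-real j k v = refl , VR.cov-0 (VR.coordinate (B j) k)

  -- The real certificate is complexified term by term. The resulting identity between forms holds
  -- at real vectors, hence everywhere, and so excludes nonreal zeros of the curve as well.
  complexGenerates : ∀ {j e f} (p : IsForm (V j) H e f) → ∀ c →
    Curves.GeneratesPower R FR em {V j} {H} e f (VR.coordinate (B j) c) →
    Curves.GeneratesPower (complexNumbers R) Fℂ em {complexSpace R (V j)} {complexSpace R H} e (ComplexForm.form (complexForm p)) (VC.coordinate (Bᶜ j) c)
  complexGenerates {j} {e} {f} f-form c (d , n , p , η , p-form , identity) =
    d , n , (λ i → Pᶜ.form i) , (λ i → dual⊗ℂ {V = H} (η i)) , (λ i → Pᶜ.isForm i) ,
    λ z → SC.difference-zero (vanishes-at-real real-points {V j} {g = difference} difference-form at-real z)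
    where
    module SC = Solver (complexNumbers R)
    module FC = Forms (complexNumbers R) Fℂ em
    module fᶜ = ComplexForm (complexForm f-form)
    module Pᶜ i = ComplexScalarForm (complexScalarForm {V j} (p-form i))
    κ : Lℂ.Covector (complexSpace R (V j))
    κ = VC.coordinate (Bᶜ j) c
    lhs rhs difference : Lℂ.∥ complexSpace R (V j) ∥ → ℂ.Carrier
    lhs z = ⟦ κ ⟧ᶜ z ^ᶜ (d ℕ.+ e)
    rhs z = sumᶜ (λ i → Pᶜ.form i z ℂ.* ⟦ dual⊗ℂ {V = H} (η i) ⟧ᶜ (fᶜ.form z))
    difference z = lhs z ℂ.+ ℂ.- rhs z
    difference-form : Lℂ.IsForm (complexSpace R (V j)) Lℂ.⟨K⟩ (d ℕ.+ e) difference
    difference-form = FC.form-minus {complexSpace R (V j)} {f = lhs} {g = rhs} (FC.form-^ {complexSpace R (V j)} κ (d ℕ.+ e))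
      (FC.form-sum {complexSpace R (V j)} {Lℂ.⟨K⟩} λ i → FC.form-* {complexSpace R (V j)} {Lℂ.⟨K⟩} (Pᶜ.isForm i) (FC.form-map (dual⊗ℂ {V = H} (η i)) fᶜ.isForm))
    at-real : ∀ v → difference (real (V j) v) ℂ.≈ ℂ.0#
    at-real v = SC.zero-difference {lhs (real (V j) v)} {rhs (real (V j) v)} (ℂ.trans {lhs (real (V j) v)}
      (fromReal-power (d ℕ.+ e) {⟦ κ ⟧ᶜ (real (V j) v)} (coordinate-real j c v))
      (ℂ.trans {fromReal (⟦ VR.coordinate (B j) c ⟧ v ^ (d ℕ.+ e))} (identity v , refl)
        (ℂ.sym {rhs (real (V j) v)} (fromReal-sums λ i → fromReal-product {Pᶜ.form i (real (V j) v)} (Pᶜ.at-real i v)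
          (ℂ.trans {⟦ dual⊗ℂ {V = H} (η i) ⟧ᶜ (fᶜ.form (real (V j) v))} (VC.cov-cong (dual⊗ℂ {V = H} (η i)) (fᶜ.at-real v)) (dual⊗ℂ-real {H} (η i) (f v)))))))

  complexCurve : ∀ {j} → IR.IncidentCurve j → IC.IncidentCurve j
  complexCurve {j} f = record
    { form = fᶜ.form
    ; isForm = fᶜ.isForm
    ; generates = λ c → complexGenerates f.isForm c (f.generates c)
    ; incident = λ z s → vanishes-at-real real-points {V j} (IC.contract-form j fᶜ.isForm s) (λ v → at-real v s) z
    }
    where
    module f = IR.IncidentCurve f
    module fᶜ = ComplexForm (complexForm f.isForm)
    at-real : ∀ v → IC.Incident j (real (V j) v) (fᶜ.form (real (V j) v))
    at-real v = IC.incident-sameLine j (real (V j) v) {real H (f.form v)} {fᶜ.form (real (V j) v)}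
      (VC.sameLine-reflexive (complexSpace R H) (Hᶜ.≈ᴹ-sym (fᶜ.at-real v)))
      (incident-real j v (f.form v) H.0ᴹ (f.incident v) λ s → VR.cov-0 (IR.contraction j v s))

  module Comparison (ψ : ∀ j → LR.FactorizationCurve φ j) (ψᶜ : ∀ j → Lℂ.FactorizationCurve φᶜ j) (j : Fin m) where

    open IR.SplitIndices ψ j
    module f = IR.IncidentCurve (IR.incidentCurve (ψ j))

    fᶜ : IC.IncidentCurve j
    fᶜ = complexCurve (IR.incidentCurve (ψ j))
    module fᶜ = IC.IncidentCurve fᶜ

    χ : Lℂ.∥ complexSpace R (V j) ∥ → Lℂ.∥ complexSpace R H ∥
    χ = IC.IncidentCurve.form (IC.incidentCurve (ψᶜ j))

    -- The complexified form has the same degree as the real one and is again incident and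
    -- generating; such a curve has the degree of the j-th complex factorization curve.
    degree≡ : deg ≡ Lℂ.RegularMap.deg (Lℂ.FactorizationCurve.curve (ψᶜ j))
    degree≡ = IC.degree-unique (ψᶜ j) fᶜ

    at-real : ∀ w → fᶜ.form (real (V j) w) Hᶜ.≈ᴹ real H (f.form w)
    at-real = ComplexForm.at-real (complexForm f.isForm)

    χ-real : ∀ w → LR.NonZero (V j) w → Lℂ.SameLine (complexSpace R H) (real H (f.form w)) (χ (real (V j) w))
    χ-real w w≉0 = VC.sameLine-trans (complexSpace R H) {real H (f.form w)} {fᶜ.form (real (V j) w)} {χ (real (V j) w)}
      (VC.sameLine-reflexive (complexSpace R H) (Hᶜ.≈ᴹ-sym (at-real w)))
      (IC.unique-sameLine (ψᶜ j) fᶜ (real (V j) w) (real-nonzero (V j) w w≉0))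

    SameImageᶜ : Fin m → Set
    SameImageᶜ i = Lℂ.SameImage (Lℂ.FactorizationCurve.curve (ψᶜ i)) (Lℂ.FactorizationCurve.curve (ψᶜ j))

    line-minorᶜ : ¬ (IC.minor j (real (V j) (line 0#)) (real (V j) (line 1#)) ℂ.≈ ℂ.0#)
    line-minorᶜ e = line-minor (trans (sym (proj₁ minor≈)) (proj₁ e))
      where
      κ : Fin 2 → Carrier → ℂ.Carrier
      κ k t = ⟦ VC.coordinate (Bᶜ j) k ⟧ᶜ (real (V j) (line t))
      minor≈ : IC.minor j (real (V j) (line 0#)) (real (V j) (line 1#)) ℂ.≈ fromReal (IR.minor j (line 0#) (line 1#))
      minor≈ = fromReal-sum {κ 0F 0# ℂ.* κ 1F 1#} {ℂ.- (κ 1F 0# ℂ.* κ 0F 1#)}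
        (fromReal-product {κ 0F 0#} {κ 1F 1#} (coordinate-real j 0F (line 0#)) (coordinate-real j 1F (line 1#)))
        (fromReal-neg {κ 1F 0# ℂ.* κ 0F 1#} (fromReal-product {κ 1F 0#} {κ 0F 1#} (coordinate-real j 1F (line 0#)) (coordinate-real j 0F (line 1#))))

    -- The vector incident with a real point of the curve may be nonreal, but the minors it forces
    -- to vanish do not involve it and are real numbers. Nonconstancy is tested on real vectors
    -- only, and these are also complex ones.
    sameImageᶜ⇒split : ∀ i → SameImageᶜ i → SplitSlot i
    sameImageᶜ⇒split i same = minors , nonconstant
      where
      minors : ∀ s s′ t → _
      minors s s′ t = from (IC.sameImage-incident (ψᶜ i) (ψᶜ j) same (real (V j) w) (real-nonzero (V j) w w≉0))
        where
        w = line t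
        w≉0 = line-nonzero t
        x = f.form w
        product : ∀ s s′ → (IC.values (real H x) s ℂ.* IC.values (real H x) s′) ℂ.≈ fromReal (IR.values x s * IR.values x s′)
        product s s′ = fromReal-product {IC.values (real H x) s} {IC.values (real H x) s′} (values-real x s) (values-real x s′)
        from : (∃[ v ] Lℂ.NonZero (complexSpace R (V i)) v × IC.Incident i v (χ (real (V j) w))) →
               IR.values x (s [ i ]≔ 0F) * IR.values x (s′ [ i ]≔ 1F) ≈ IR.values x (s′ [ i ]≔ 0F) * IR.values x (s [ i ]≔ 1F)
        from (v , v≉0 , p) = trans (sym (proj₁ (product (s [ i ]≔ 0F) (s′ [ i ]≔ 1F))))
          (trans (proj₁ (IC.incident-minors i v (real H x) v≉0
              (IC.incident-sameLine i v {χ (real (V j) w)} {real H x} (VC.sameLine-sym (complexSpace R H) {real H x} (χ-real w w≉0)) p) s s′))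
            (proj₁ (product (s′ [ i ]≔ 0F) (s [ i ]≔ 1F))))
      nonconstant : ∀ v → LR.NonZero (V i) v → ¬ (∀ t → IR.Incident i v (f.form (line t)))
      nonconstant v v≉0 p = IC.sameImage-nonconstant (ψᶜ i) (ψᶜ j) same (real (V j) (line 0#)) (real (V j) (line 1#)) (real (V i) v)
        line-minorᶜ (real-nonzero (V j) (line 0#) (line-nonzero 0#)) (real-nonzero (V j) (line 1#) (line-nonzero 1#)) (real-nonzero (V i) v v≉0)
        (at 0#) (at 1#)
        where
        at : ∀ t → IC.Incident i (real (V i) v) (χ (real (V j) (line t)))
        at t = IC.incident-sameLine i (real (V i) v) {real H (f.form (line t))} {χ (real (V j) (line t))} (χ-real (line t) (line-nonzero t))
          (incident-real i v (f.form (line t)) H.0ᴹ (p t) λ s → VR.cov-0 (IR.contraction i v s))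

    module _ (splitting′ : LinearSplitting T) (i : Fin m) (i∈T : lookup T i ≡ true) where

      private
        module L = LinearSplitting splitting′
        g = SplittingMaps.splittingMap splitting′ i
        module Vᵢᶜ = LeftModule (complexSpace R (V i))
        module M = LinearSplittings.MatrixMap (complexNumbers R) Fℂ em {complexSpace R (V j)} {complexSpace R (V i)} (Bᶜ j) (Bᶜ i)
                     (λ c → fromReal (L.a i c)) (λ c → fromReal (L.b i c))
        module FC = Forms (complexNumbers R) Fℂ em

      detᶜ≉0 : ¬ ((fromReal (L.a i 0F) ℂ.* fromReal (L.b i 1F) ℂ.+ ℂ.- (fromReal (L.a i 1F) ℂ.* fromReal (L.b i 0F))) ℂ.≈ ℂ.0#)
      detᶜ≉0 e = L.det≉0 i i∈T (trans (sym (proj₁ det≈)) (proj₁ e))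
        where
        p q : ℂ.Carrier
        p = fromReal (L.a i 0F) ℂ.* fromReal (L.b i 1F)
        q = fromReal (L.a i 1F) ℂ.* fromReal (L.b i 0F)
        det≈ : (p ℂ.+ ℂ.- q) ℂ.≈ fromReal (L.a i 0F * L.b i 1F + - (L.a i 1F * L.b i 0F))
        det≈ = fromReal-sum {p} {ℂ.- q} (ℂ.sym {fromReal (L.a i 0F * L.b i 1F)} (fromReal-* (L.a i 0F) (L.b i 1F)))
          (fromReal-neg {q} (ℂ.sym {fromReal (L.a i 1F * L.b i 0F)} (fromReal-* (L.a i 1F) (L.b i 0F))))

      open M.Invertible detᶜ≉0

      row-real : ∀ c v → ⟦ M.row c ⟧ᶜ (real (V j) v) ℂ.≈ fromReal (⟦ L.row i c ⟧ v)
      row-real c v = fromReal-sum {fromReal (L.a i c) ℂ.* κ 0F} {fromReal (L.b i c) ℂ.* κ 1F}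
        (fromReal-product {fromReal (L.a i c)} {κ 0F} (ℂ.refl {fromReal (L.a i c)}) (coordinate-real j 0F v))
        (fromReal-product {fromReal (L.b i c)} {κ 1F} (ℂ.refl {fromReal (L.b i c)}) (coordinate-real j 1F v))
        where
        κ : Fin 2 → ℂ.Carrier
        κ k = ⟦ VC.coordinate (Bᶜ j) k ⟧ᶜ (real (V j) v)

      map-real : ∀ v → ⟦ M.matrixMap ⟧ᶜ (real (V j) v) Vᵢᶜ.≈ᴹ real (V i) (⟦ g ⟧ v)
      map-real v = Vᵢᶜ.≈ᴹ-trans (Vᵢᶜ.+ᴹ-cong
          (Vᵢᶜ.≈ᴹ-trans (Vᵢᶜ.*ₗ-congʳ {real (V i) (VR.basis (B i) 0F)} {(ℂ.- ℂ.1#) ℂ.* ⟦ M.row 1F ⟧ᶜ (real (V j) v)} {fromReal (- 1# * ⟦ L.row i 1F ⟧ v)}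
              (fromReal-product {ℂ.- ℂ.1#} {⟦ M.row 1F ⟧ᶜ (real (V j) v)} (fromReal-neg {ℂ.1#} (ℂ.refl {ℂ.1#})) (row-real 1F v)))
            (real-*-real (V i) (- 1# * ⟦ L.row i 1F ⟧ v) (VR.basis (B i) 0F)))
          (Vᵢᶜ.≈ᴹ-trans (Vᵢᶜ.*ₗ-congʳ {real (V i) (VR.basis (B i) 1F)} {⟦ M.row 0F ⟧ᶜ (real (V j) v)} {fromReal (⟦ L.row i 0F ⟧ v)} (row-real 0F v))
            (real-*-real (V i) (⟦ L.row i 0F ⟧ v) (VR.basis (B i) 1F))))
        (LeftModule.≈ᴹ-refl (V i) , LeftModule.+ᴹ-identityˡ (V i) _)

      map-incident-real : ∀ v → IC.Incident i (⟦ M.matrixMap ⟧ᶜ (real (V j) v)) (fᶜ.form (real (V j) v))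
      map-incident-real v s = ℂ.trans {TC.contract i (⟦ M.matrixMap ⟧ᶜ (real (V j) v)) (IC.values (fᶜ.form (real (V j) v))) s}
        (TC.contract-congᵛ i (map-real v) (IC.values (fᶜ.form (real (V j) v))) s)
        (IC.incident-sameLine i (real (V i) (⟦ g ⟧ v)) {real H (f.form v)} {fᶜ.form (real (V j) v)}
          (VC.sameLine-reflexive (complexSpace R H) (Hᶜ.≈ᴹ-sym (at-real v)))
          (incident-real i (⟦ g ⟧ v) (f.form v) H.0ᴹ (SplittingMaps.splittingMap-incident splitting′ i i∈T v)
            λ s → VR.cov-0 (IR.contraction i (⟦ g ⟧ v) s)) s)

      -- The complex matrix has real coefficients, so at real vectors this is the real incidence;
      -- the contraction is a form in `z` and therefore vanishes for all `z`.
      map-incident : ∀ z → IC.Incident i (⟦ M.matrixMap ⟧ᶜ z) (fᶜ.form z)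
      map-incident z s = vanishes-at-real real-points {V j}
        {g = λ z → TC.contract i (⟦ M.matrixMap ⟧ᶜ z) (IC.values (fᶜ.form z)) s}
        (Lℂ.plus (Lℂ.times (VC.composite (VC.coordinate (Bᶜ i) 0F) M.matrixMap) (FC.form-map (IC.Φ (s [ i ]≔ 0F)) fᶜ.isForm))
                 (Lℂ.times (VC.composite (VC.coordinate (Bᶜ i) 1F) M.matrixMap) (FC.form-map (IC.Φ (s [ i ]≔ 1F)) fᶜ.isForm)))
        (λ v → map-incident-real v s) z

      map-incident-χ : ∀ z → IC.Incident i (⟦ M.matrixMap ⟧ᶜ z) (χ z)
      map-incident-χ z = by-case em
        where
        by-case : Dec (LeftModule._≈ᴹ_ (complexSpace R (V j)) z (LeftModule.0ᴹ (complexSpace R (V j)))) → IC.Incident i (⟦ M.matrixMap ⟧ᶜ z) (χ z)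
        -- Curves are compared as lines only at nonzero vectors; at zero the incidence equations are
        -- trivial.
        by-case (yes z≈0) = IC.incident-zero i (χ z) (Vᵢᶜ.≈ᴹ-trans (Lℂ.LinearMap.⟦⟧-cong M.matrixMap z≈0) (Lℂ.LinearMap.0ᴹ-homo M.matrixMap))
        by-case (no z≉0) = IC.incident-sameLine i (⟦ M.matrixMap ⟧ᶜ z) {fᶜ.form z} {χ z} (IC.unique-sameLine (ψᶜ j) fᶜ z z≉0) (map-incident z)

      split⇒sameImageᶜ : SameImageᶜ i
      split⇒sameImageᶜ = IC.sameImage-from-linear (ψᶜ i) (ψᶜ j) M.matrixMap matrixMap-surjective matrixMap-injective map-incident-χ

    -- The complex class is measured by the set `T` of the real curve, and `degree≡` makes the two
    -- target sizes equal.
    decomposableᶜ⇔size : Lℂ.Decomposable φᶜ ψᶜ j ⇔ (∣ T ∣ ≡ deg)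
    decomposableᶜ⇔size = ≡.subst (λ e → Lℂ.Decomposable φᶜ ψᶜ j ⇔ (∣ T ∣ ≡ e)) (≡.sym degree≡)
      (class-size SameImageᶜ T (λ i same → split⇒T i (sameImageᶜ⇒split i same)) (≡.subst (∣ T ∣ ℕ.≤_) degree≡ size-≤)
        λ size i i∈T → split⇒sameImageᶜ (splitting (≡.trans size (≡.sym degree≡))) i ([]=⇒lookup i∈T))

    comparison : (LR.Decomposable φ ψ j ⇔ Lℂ.Decomposable φᶜ ψᶜ j) × (LR.Decomposable φ ψ j → LR.HasDecomposition φ (ψ j))
    comparison = mk⇔ (λ d → Equivalence.from decomposableᶜ⇔size (Equivalence.to decomposable⇔size d))
                     (λ d → Equivalence.from decomposable⇔size (Equivalence.to decomposableᶜ⇔size d)) ,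
                 λ d → size⇒hasDecomposition (Equivalence.to decomposable⇔size d)

theorem2p15 :
    ExcludedMiddle 0ℓ →
    (reals : Reals) →
    let ℝ = Reals.commutativeRing reals
        open LinearAlgebra ℝ
        open Complexification ℝ
    in
    (m : ℕ) (V : Fin m → VectorSpace ℝ) (𝔥 : VectorSpace ℝ)
    (φ : LinearMap 𝔥 (V* V)) →
    IsFactorizationStructure φ →
    Lℂ.IsFactorizationStructure (complexify φ) ×
    ((ψ : ∀ j → FactorizationCurve φ j)
     (ψℂ : ∀ j → Lℂ.FactorizationCurve (complexify φ) j)
     (j : Fin m) →
     (Decomposable φ ψ j ⇔ Lℂ.Decomposable (complexify φ) ψℂ j) ×
     (Decomposable φ ψ j → HasDecomposition φ (ψ j)))
theorem2p15 em reals m V 𝔥 φ structure =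
  ComplexStructure.isFactorizationStructureᶜ ℝ ℝ-field ℂ-field′ em real-points {V = V} {H = 𝔥} φ structure ,
  ComplexStructure.Comparison.comparison ℝ ℝ-field ℂ-field′ em real-points {V = V} {H = 𝔥} φ structure
  where
  open RealAndComplexFields reals
  ℂ-field′ = ℂ-field em
  real-points : ∀ n → CommutativeRing._≈_ (complexNumbers ℝ) (IsInfiniteField.point ℂ-field′ n)
                        (Complexification.fromReal ℝ (IsInfiniteField.point ℝ-field n))
  real-points n = CommutativeRing.refl ℝ , CommutativeRing.refl ℝ
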